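{- The satisfiability problem for the logic $\mathsf{AB}_{hom}$ over finite linear orders is EXPSPACE-hard. That is, the problem of deciding, given an $\mathsf{AB}_{hom}$ formula $\varphi$, whether there exists a finite homogeneous model $\mathbf{M}=(N,\mathcal{V})$ with $\mathbf{M},[0,N]\models\varphi$ is EXPSPACE-hard.
   Context: Syntax. Let $\mathrm{Prop}$ be a countable set of proposition letters. $\mathsf{AB}_{hom}$ formulas are generated by $\varphi ::= p \mid \neg\varphi \mid \varphi\vee\varphi \mid \langle A\rangle\varphi \mid \langle B\rangle\varphi$ with $p\in\mathrm{Prop}$. Models. For $N\in\mathbb{N}$ let $\mathbb{I}_N=\{[x,y] : 0\le x\le y\le N\}$ (point intervals $[x,x]$ included). A finite model is a pair $\mathbf{M}=(N,\mathcal{V})$ with $\mathcal{V}:\mathbb{I}_N\to 2^{\mathrm{Prop}}$. It is homogeneous if for all $p\in\mathrm{Prop}$ and $[x,y]\in\mathbb{I}_N$: $p\in\mathcal{V}([x,y])$ iff $p\in\mathcal{V}([z,z])$ for all $z\in[x,y]$. Semantics. $\mathbf{M},[x,y]\models p$ iff $p\in\mathcal{V}([x,y])$; $\neg,\vee$ as usual; $\mathbf{M},[x,y]\models\langle A\rangle\psi$ iff there is $y'$ with $y\le y'\le N$ and $\mathbf{M},[y,y']\models\psi$; $\mathbf{M},[x,y]\models\langle B\rangle\psi$ iff there is $y'$ with $x\le y'<y$ and $\mathbf{M},[x,y']\models\psi$. EXPSPACE is the class of problems decidable in space $2^{p(n)}$ for a polynomial $p$ in the input size $n$; hardness is with respect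 to standard (e.g. logarithmic-space) many-one reductions. -}

module Defs where

open import Data.Bool using (Bool; true; false; T; if_then_else_)
open import Data.Fin using (Fin)
open import Data.List using (List; []; _∷_; _++_; map; length; fromMaybe)
open import Data.List.Properties using (++-assoc; ∷-injectiveʳ)
open import Data.Maybe as Maybe using (Maybe; just; nothing)
open import Data.Nat
  using (ℕ; zero; suc; pred; _+_; _*_; _^_; _≤_; _<_; _⊓_; _≡ᵇ_; z≤n)
open import Data.Nat.Binary using (ℕᵇ; zero; 2[1+_]; 1+[2_])
open import Data.Nat.Logarithm using (⌊log₂_⌋)
open import Data.Nat.Properties using (≤-refl; ≤-trans; <⇒≤)
open import Data.Product using (Σ-syntax; ∃-syntax; _×_; _,_)
open import Data.Sum using (_⊎_; inj₁)
open import Data.Vec as Vec using (Vec; replicate; zipWith)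
open import Data.Vec.Relation.Unary.All using (All)
open import Function.Bundles using (_⇔_)
open import Level using (0ℓ)
open import Relation.Binary.PropositionalEquality using (_≡_; refl; sym; trans)
open import Relation.Nullary using (¬_)
open import Relation.Unary using (Pred)

-- Letters are numbered in binary, so that their names have the usual
-- logarithmic length when formulas are written as strings.
Letter : Set
Letter = ℕᵇ

data Formula : Set where
  var     : Letter → Formula
  neg     : Formula → Formula
  _or_    : Formula → Formula → Formula
  ⟨A⟩ ⟨B⟩ : Formula → Formula

-- The bounds are irrelevant, so an interval is determined by its endpoints.
record Interval (N : ℕ) : Set where
  constructor interval
  field
    lo hi  : ℕ
    .lo≤hi : lo ≤ hi
    .hi≤N  : hi ≤ N

record Model : Set where
  field
    N : ℕ
    𝒱 : Interval N → Letter → Bool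

point : ∀ {N} (z : ℕ) → .(z ≤ N) → Interval N
point z z≤N = interval z z ≤-refl z≤N

Homogeneous : Model → Set
Homogeneous M = ∀ p x y (x≤y : x ≤ y) (y≤N : y ≤ N) →
  T (𝒱 (interval x y x≤y y≤N) p)
    ⇔ (∀ z → x ≤ z → (z≤y : z ≤ y) → T (𝒱 (point z (≤-trans z≤y y≤N)) p))
  where open Model M

infix 4 _,_⊨_

_,_⊨_ : (M : Model) → Interval (Model.N M) → Formula → Set
M , I ⊨ var p    = T (Model.𝒱 M I p)
M , I ⊨ neg φ    = ¬ (M , I ⊨ φ)
M , I ⊨ (φ or ψ) = (M , I ⊨ φ) ⊎ (M , I ⊨ ψ)
M , interval x y _ _ ⊨ ⟨A⟩ ψ =
  ∃[ y′ ] Σ[ y≤y′ ∈ y ≤ y′ ] Σ[ y′≤N ∈ y′ ≤ Model.N M ]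
    (M , interval y y′ y≤y′ y′≤N ⊨ ψ)
M , interval x y _ y≤N ⊨ ⟨B⟩ ψ =
  ∃[ y′ ] Σ[ x≤y′ ∈ x ≤ y′ ] Σ[ y′<y ∈ y′ < y ]
    (M , interval x y′ x≤y′ (≤-trans (<⇒≤ y′<y) y≤N) ⊨ ψ)

Satisfiable : Formula → Set
Satisfiable φ = Σ[ M ∈ Model ]
  Homogeneous M × (M , interval 0 (Model.N M) z≤n ≤-refl ⊨ φ)

Language : Set → Set₁
Language A = Pred (List A) 0ℓ

data Symbol : Set where
  `¬ `∨ `A `B `p `1 `2 `end : Symbol

-- Bijective base-2 digits, least significant first, closed by a terminator.
digits : ℕᵇ → List Symbol
digits zero     = `end ∷ []
digits 2[1+ b ] = `2 ∷ digits b
digits 1+[2 b ] = `1 ∷ digits b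

encode : Formula → List Symbol
encode (var p)  = `p ∷ digits p
encode (neg φ)  = `¬ ∷ encode φ
encode (φ or ψ) = `∨ ∷ encode φ ++ encode ψ
encode (⟨A⟩ φ)  = `A ∷ encode φ
encode (⟨B⟩ φ)  = `B ∷ encode φ

digits-prefixFree : ∀ a b {xs ys} →
  digits a ++ xs ≡ digits b ++ ys → a ≡ b × xs ≡ ys
digits-prefixFree zero zero refl = refl , refl
digits-prefixFree 2[1+ a ] 2[1+ b ] eq with digits-prefixFree a b (∷-injectiveʳ eq)
... | refl , eq′ = refl , eq′
digits-prefixFree 1+[2 a ] 1+[2 b ] eq with digits-prefixFree a b (∷-injectiveʳ eq)
... | refl , eq′ = refl , eq′

encode-prefixFree : ∀ φ ψ {xs ys} →
  encode φ ++ xs ≡ encode ψ ++ ys → φ ≡ ψ × xs ≡ ys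
encode-prefixFree (var a) (var b) eq with digits-prefixFree a b (∷-injectiveʳ eq)
... | refl , eq′ = refl , eq′
encode-prefixFree (neg φ) (neg ψ) eq with encode-prefixFree φ ψ (∷-injectiveʳ eq)
... | refl , eq′ = refl , eq′
encode-prefixFree (⟨A⟩ φ) (⟨A⟩ ψ) eq with encode-prefixFree φ ψ (∷-injectiveʳ eq)
... | refl , eq′ = refl , eq′
encode-prefixFree (⟨B⟩ φ) (⟨B⟩ ψ) eq with encode-prefixFree φ ψ (∷-injectiveʳ eq)
... | refl , eq′ = refl , eq′
encode-prefixFree (φ₁ or φ₂) (ψ₁ or ψ₂) {xs} {ys} eq
  with encode-prefixFree φ₁ ψ₁
         (trans (sym (++-assoc (encode φ₁) (encode φ₂) xs))
           (trans (∷-injectiveʳ eq) (++-assoc (encode ψ₁) (encode ψ₂) ys)))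
... | refl , eq′ with encode-prefixFree φ₂ ψ₂ eq′
...   | refl , eq″ = refl , eq″

AB-SAT : Language Symbol
AB-SAT s = ∃[ φ ] (encode φ ≡ s × Satisfiable φ)

data Move : Set where
  left stay right : Move

-- A tape that is infinite to the right, with `nothing` as the blank;
-- moving left from cell 0 leaves the head where it is.
record Tape (Γ : Set) : Set where
  constructor tape
  field
    head  : ℕ
    cells : ℕ → Maybe Γ

open Tape public

moveHead : Move → ℕ → ℕ
moveHead left  i = pred i
moveHead stay  i = i
moveHead right i = suc i

read : ∀ {Γ} → Tape Γ → Maybe Γ
read t = cells t (head t)

act : ∀ {Γ} → Tape Γ → Maybe Γ × Move → Tape Γ
act (tape h c) (a , m) = tape (moveHead m h) (λ i → if i ≡ᵇ h then a else c i)

blankTape : ∀ {Γ} → Tape Γ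
blankTape = tape 0 (λ _ → nothing)

nth : ∀ {A : Set} → List A → ℕ → Maybe A
nth []       _       = nothing
nth (a ∷ _)  zero    = just a
nth (_ ∷ as) (suc i) = nth as i

-- A deterministic single-tape Turing machine.
record Decider (s : ℕ) : Set where
  field
    states aux : ℕ

  State = Fin states
  Γ     = Fin s ⊎ Fin aux

  field
    start   : State
    -- `just true` accepts, `just false` rejects, `nothing` goes on.
    verdict : State → Maybe Bool
    δ       : State → Maybe Γ → State × Maybe Γ × Move

module DeciderRun {s} (M : Decider s) where
  open Decider M

  record Config : Set where
    constructor config
    field
      state : State
      work  : Tape Γ

  open Config public

  initial : List (Fin s) → Config
  initial w = config start (tape 0 (λ i → Maybe.map inj₁ (nth w i)))

  step : Config → Config
  step c@(config q t) with verdict q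
  ... | just _  = c
  ... | nothing with δ q (read t)
  ...   | q′ , a , m = config q′ (act t (a , m))

  run : List (Fin s) → ℕ → Config
  run w zero    = initial w
  run w (suc t) = step (run w t)

  Decides : Language (Fin s) → Set
  Decides L = ∀ w → ∃[ t ] ∃[ b ]
    (verdict (state (run w t)) ≡ just b × (T b ⇔ L w))

  InSpace : (ℕ → ℕ) → Set
  InSpace S = ∀ w t → head (work (run w t)) < S (length w)

-- Coefficients, constant term first.
Polynomial : Set
Polynomial = List ℕ

eval : Polynomial → ℕ → ℕ
eval []       n = 0
eval (a ∷ as) n = a + n * eval as n

EXPSPACE : ∀ {s} → Language (Fin s) → Set
EXPSPACE {s} L = Σ[ M ∈ Decider s ] ∃[ p ]
  (DeciderRun.Decides M L × DeciderRun.InSpace M (λ n → 2 ^ eval p n))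

data InputCell (A : Set) : Set where
  ⊢ ⊣ : InputCell A
  ⌜_⌝ : A → InputCell A

-- The input tape holds ⊢ a₁ … aₙ ⊣ at positions 0 , … , n + 1.
readInput : ∀ {A} → List A → ℕ → InputCell A
readInput w zero = ⊢
readInput w (suc i) with nth w i
... | just a  = ⌜ a ⌝
... | nothing = ⊣

-- The input head cannot leave the input tape: otherwise its position would
-- be an unbounded counter not charged as space.
moveInput : ∀ {A : Set} → List A → Move → ℕ → ℕ
moveInput w m i = moveHead m i ⊓ suc (length w)

-- A deterministic Turing machine with a two-way read-only input tape,
-- `tapes` work tapes and a write-only output tape.
record Transducer (s : ℕ) (Out : Set) : Set where
  field
    states aux tapes : ℕ

  State = Fin states
  Γ     = Fin aux

  field
    start  : State
    halted : State → Bool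
    δ      : State → InputCell (Fin s) → Vec (Maybe Γ) tapes →
             State × Move × Vec (Maybe Γ × Move) tapes × Maybe Out

module TransducerRun {s Out} (M : Transducer s Out) where
  open Transducer M

  record Config : Set where
    constructor config
    field
      state  : State
      input  : ℕ
      work   : Vec (Tape Γ) tapes
      output : List Out

  open Config public

  initial : Config
  initial = config start 0 (replicate tapes blankTape) []

  step : List (Fin s) → Config → Config
  step w c@(config q i ts out) with halted q
  ... | true  = c
  ... | false with δ q (readInput w i) (Vec.map read ts)
  ...   | q′ , m , as , o =
    config q′ (moveInput w m i) (zipWith act ts as) (out ++ fromMaybe o)

  run : List (Fin s) → ℕ → Config
  run w zero    = initial
  run w (suc t) = step w (run w t)

  Computes : (List (Fin s) → List Out) → Set
  Computes f = ∀ w → ∃[ t ]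
    (T (halted (state (run w t))) × output (run w t) ≡ f w)

  -- The bound is per work tape; their number is fixed by the machine.
  InSpace : (ℕ → ℕ) → Set
  InSpace S = ∀ w t → All (λ τ → head τ < S (length w)) (work (run w t))

LogSpaceComputable : ∀ {s Out} → (List (Fin s) → List Out) → Set
LogSpaceComputable {s} {Out} f = Σ[ M ∈ Transducer s Out ] ∃[ c ]
  (TransducerRun.Computes M f ×
   TransducerRun.InSpace M (λ n → c * suc ⌊log₂ n ⌋))

_≤L_ : ∀ {s B} → Language (Fin s) → Language B → Set
L ≤L L′ = ∃[ f ] (LogSpaceComputable f × (∀ w → L w ⇔ L′ (f w)))

EXPSPACE-Hard : ∀ {B} → Language B → Set₁
EXPSPACE-Hard L′ = ∀ {s} (L : Language (Fin s)) → EXPSPACE L → L ≤L L′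

{-# OPTIONS --safe #-}

-- A computation of the decider is laid out backwards in time, one point per step.
-- A point is labelled by the state, the symbol read, and the head position as a
-- polynomially long binary word; beyond the starting time, n + 1 further points
-- write the input, and then a blank, onto the cells 0 , … , n. An interval
-- [x , y] sees both of its endpoints, so it can compare two head positions bit by
-- bit, and ⟨B⟩ can say that no point between x and y has the head position of x.
-- Hence "the symbol read at x is the one written at the first later point with
-- the same head position, or blank if there is none" is expressible, and together
-- with the local transition rules it determines the computation.
--
-- The formula is a fixed scheme of conjunctions over the bit positions i < 2 ^ W,
-- with W logarithmic in n, so that a binary counter of W cells suffices to print it.
module Submission where

open import Defs
open import Data.Bool using (Bool; true; false; T; not; _∧_; _xor_; if_then_else_)
open import Data.Bool.Properties using (T?)
open import Data.Empty using (⊥; ⊥-elim; ⊥-elim-irr)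
open import Data.Fin as Fin
  using (Fin; zero; suc; toℕ; fromℕ<; join; splitAt; combine; remQuot; _↑ˡ_; _↑ʳ_)
open import Data.Fin.Patterns using (0F; 1F; 2F; 3F)
open import Data.Fin.Properties
  using (toℕ<n; fromℕ<-toℕ; splitAt-join; splitAt-↑ˡ; splitAt-↑ʳ; remQuot-combine)
open import Data.List
  using (List; []; _∷_; _++_; length; map; replicate; drop; fromMaybe; _ʳ++_)
open import Data.List.Properties
  using (++-assoc; ++-identityʳ; length-++; length-map; length-replicate; length-ʳ++;
         map-++; map-replicate; ʳ++-ʳ++)
open import Data.List.Relation.Unary.All using (All; []; _∷_)
open import Data.Maybe as Maybe using (Maybe; just; nothing)
open import Data.Maybe.Properties using (just-injective) renaming (≡-dec to ≡-decᵐ)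
open import Data.Nat
open import Data.Nat.Binary using (ℕᵇ; zero; 2[1+_]; 1+[2_])
open import Data.Nat.Logarithm
  using (⌊log₂_⌋; ⌊log₂⌋-mono-≤; ⌊log₂[2*b]⌋≡1+⌊log₂b⌋; ⌊log₂[2^n]⌋≡n)
open import Data.Nat.Properties
open import Data.Nat.Tactic.RingSolver using (solve-∀)
open import Data.Product as Product using (Σ-syntax; ∃-syntax; _×_; _,_; proj₁; proj₂)
open import Data.Sum as Sum using (_⊎_; inj₁; inj₂; [_,_]′)
open import Data.Sum.Properties using () renaming (≡-dec to ≡-decˢ)
open import Data.Unit using (tt)
open import Data.Vec using (Vec; []; _∷_)
open import Data.Vec.Relation.Unary.All using ([]; _∷_) renaming (All to Allᵛ)
open import Function using (_∘_; _⇔_; mk⇔; Equivalence)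
open import Relation.Binary.Definitions using (DecidableEquality; tri<; tri≈; tri>)
open import Relation.Binary.PropositionalEquality
open import Relation.Nullary
  using (¬_; Dec; does; yes; no; contradiction; ¬?; _⊎-dec_; _→-dec_)
open import Relation.Nullary.Decidable using (map′; decidable-stable)

open Equivalence using (to; from)

-- Programs and their compilation to transducers

-- Why time has to run backwards: `⟨B⟩` moves the right endpoint of an interval only, so from
-- `[x , y]` the points in between can be compared with `x` but not with `y`. The last write to a
-- cell must therefore be the nearest suitable point to the right of the moment that reads it. As
-- every read is tied to its last write in this way, an exponentially long configuration is never
-- spelled out; a point carries just one head position. Letters are consulted at point intervals
-- alone, reached by `⟨B⟩` at the left and by `⟨A⟩` at the right endpoint, and a homogeneous
-- valuation amounts to an arbitrary labelling of the points. Adding one to a head position is not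
-- local in its bits. Each point is therefore also labelled with the carries of that increment, and
-- a successor is then checked one bit at a time. On the printing side, prefix notation and
-- conjunctions nested to the right are what makes logarithmic space enough: a loop emits its
-- conjuncts one after the other and never has to return in order to close a subformula.

first : ∀ {A : Set} → List A → Maybe A
first []      = nothing
first (x ∷ _) = just x

put : ∀ {A : Set} → A → List A → List A
put a []       = a ∷ []
put a (_ ∷ xs) = a ∷ xs

nth-ʳ++ : ∀ {A : Set} (ls {xs} : List A) k → nth (ls ʳ++ xs) (length ls + k) ≡ nth xs k
nth-ʳ++ []       k = refl
nth-ʳ++ (l ∷ ls) k = trans (cong (nth (ls ʳ++ _)) (sym (+-suc (length ls) k))) (nth-ʳ++ ls (suc k))

nth-first : ∀ {A : Set} (ls {rs} : List A) → nth (ls ʳ++ rs) (length ls) ≡ first rs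
nth-first ls {rs} =
  trans (cong (nth (ls ʳ++ rs)) (sym (+-identityʳ (length ls)))) (trans (nth-ʳ++ ls 0) (nth-0 rs))
  where
  nth-0 : ∀ xs → nth xs 0 ≡ first xs
  nth-0 []      = refl
  nth-0 (_ ∷ _) = refl

nth-inside : ∀ {A : Set} (v : List A) i → i < length v → ∃[ a ] nth v i ≡ just a
nth-inside (a ∷ v) zero    _        = a , refl
nth-inside (_ ∷ v) (suc i) (s≤s lt) = nth-inside v i lt

nth-beyond : ∀ {A : Set} (v : List A) i → length v ≤ i → nth v i ≡ nothing
nth-beyond []      i       le       = refl
nth-beyond (_ ∷ v) (suc i) (s≤s le) = nth-beyond v i le

-- This is the update performed by `act`, on a tape split at the head. If the head stands on the
-- first blank, `put` creates the cell.
nth-put : ∀ {A : Set} (a : A) ls {rs} i →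
  nth (ls ʳ++ put a rs) i ≡ (if i ≡ᵇ length ls then just a else nth (ls ʳ++ rs) i)
nth-put {A} a ls {rs} =
  subst (λ k → ∀ i → nth (ls ʳ++ put a rs) i ≡ (if i ≡ᵇ k then just a else nth (ls ʳ++ rs) i))
    (+-identityʳ (length ls)) (below ls 0 (base rs))
  where
  below : ∀ ls {xs ys : List A} k →
    (∀ i → nth ys i ≡ (if i ≡ᵇ k then just a else nth xs i)) →
    ∀ i → nth (ls ʳ++ ys) i ≡ (if i ≡ᵇ (length ls + k) then just a else nth (ls ʳ++ xs) i)
  below []       k eq = eq
  below (l ∷ ls) k eq rewrite sym (+-suc (length ls) k) = below ls (suc k) λ
    { zero → refl ; (suc i) → eq i }
  base : ∀ rs i → nth (put a rs) i ≡ (if i ≡ᵇ 0 then just a else nth rs i)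
  base []      zero    = refl
  base []      (suc _) = refl
  base (_ ∷ _) zero    = refl
  base (_ ∷ _) (suc _) = refl

length-put : ∀ {A : Set} (a : A) xs → length xs ≤ length (put a xs)
length-put a []       = z≤n
length-put a (_ ∷ xs) = ≤-refl

module Programs (s g : ℕ) (Out : Set) where

  Letters = Fin g
  Input   = InputCell (Fin s)
  Test    = Input → Maybe Letters → Bool
  Action  = Move × (Maybe Letters × Move) × Maybe Out

  infixr 5 _⨾_

  -- Structured programs allow output and space to be treated by induction on executions; the states
  -- of a machine enter only in the compilation.
  data Prog : Set where
    emit        : (Input → Maybe Letters → Maybe Out) → Prog
    workL workR : Prog
    write       : Letters → Prog
    scan        : Move → Prog
    _⨾_         : Prog → Prog → Prog
    while       : Test → Prog → Prog
    branch      : Test → Prog → Prog → Prog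

  size : Prog → ℕ
  size (emit _)       = 1
  size workL          = 1
  size workR          = 1
  size (write _)      = 1
  size (scan _)       = 1
  size (p ⨾ q)        = size p + size q
  size (while _ p)    = suc (size p)
  size (branch _ p q) = suc (size p + size q)

  entry : ∀ p → Fin (size p)
  entry (emit _)       = zero
  entry workL          = zero
  entry workR          = zero
  entry (write _)      = zero
  entry (scan _)       = zero
  entry (p ⨾ q)        = entry p ↑ˡ size q
  entry (while _ _)    = zero
  entry (branch _ _ _) = zero

  -- The states of p sit in S along e, and k is the state in which p exits.
  code : ∀ p {S : Set} → (Fin (size p) → S) → S →
         Fin (size p) → Input → Maybe Letters → S × Action
  code (emit f)       e k _       i c = k , stay , (c , stay) , f i c
  code workL          e k _       i c = k , stay , (c , left) , nothing
  code workR          e k _       i c = k , stay , (c , right) , nothing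
  code (write a)      e k _       i c = k , stay , (just a , stay) , nothing
  code (scan m)       e k _       i c = k , m , (c , stay) , nothing
  code (p ⨾ q)        e k x           =
    [ code p (e ∘ (_↑ˡ size q)) (e (size p ↑ʳ entry q)) , code q (e ∘ (size p ↑ʳ_)) k ]′
      (splitAt (size p) x)
  code (while t p)    e k zero    i c =
    (if t i c then e (suc (entry p)) else k) , stay , (c , stay) , nothing
  code (while t p)    e k (suc x)     = code p (e ∘ suc) (e zero) x
  code (branch t p q) e k zero    i c =
    (if t i c then e (suc (entry p ↑ˡ size q)) else e (suc (size p ↑ʳ entry q))) ,
    stay , (c , stay) , nothing
  code (branch t p q) e k (suc x)     =
    [ code p (e ∘ suc ∘ (_↑ˡ size q)) k , code q (e ∘ suc ∘ (size p ↑ʳ_)) k ]′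
      (splitAt (size p) x)

  -- The work tape holds ls ʳ++ rs, with the head on the first cell of rs.
  record Store : Set where
    constructor store
    field
      pos    : ℕ
      before : List Letters
      after  : List Letters
      sent   : List Out

  open Store

  extent : Store → ℕ
  extent (store _ ls rs _) = length (ls ʳ++ rs)

  module Execution (w : List (Fin s)) where

    test : Test → Store → Bool
    test t σ = t (readInput w (pos σ)) (first (after σ))

    -- There is no derivation for moving left from cell 0, nor for moving right from a blank. Hence
    -- `extent` grows by writing only, and it bounds the head position.
    data Exec : Prog → Store → Store → Set where
      emits : ∀ {f i ls rs o o′} →
        o ++ fromMaybe (f (readInput w i) (first rs)) ≡ o′ →
        Exec (emit f) (store i ls rs o) (store i ls rs o′)
      movesL : ∀ {i l ls rs o} → Exec workL (store i (l ∷ ls) rs o) (store i ls (l ∷ rs) o)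
      movesR : ∀ {i ls r rs o} → Exec workR (store i ls (r ∷ rs) o) (store i (r ∷ ls) rs o)
      writes : ∀ {a i ls rs o} → Exec (write a) (store i ls rs o) (store i ls (put a rs) o)
      scans  : ∀ {m i ls rs o} → Exec (scan m) (store i ls rs o) (store (moveInput w m i) ls rs o)
      _⨾_    : ∀ {p q σ σ₁ σ₂} → Exec p σ σ₁ → Exec q σ₁ σ₂ → Exec (p ⨾ q) σ σ₂
      again  : ∀ {t p σ σ₁ σ₂} → test t σ ≡ true →
        Exec p σ σ₁ → Exec (while t p) σ₁ σ₂ → Exec (while t p) σ σ₂
      leave  : ∀ {t p σ} → test t σ ≡ false → Exec (while t p) σ σ
      taken     : ∀ {t p q σ σ₁} → test t σ ≡ true → Exec p σ σ₁ → Exec (branch t p q) σ σ₁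
      passed-by : ∀ {t p q σ σ₁} → test t σ ≡ false → Exec q σ σ₁ → Exec (branch t p q) σ σ₁

    -- Thanks to monotonicity a bound on the final store is a bound on all stores of the execution.
    extent-mono : ∀ {p σ σ′} → Exec p σ σ′ → extent σ ≤ extent σ′
    extent-mono (emits _) = ≤-refl
    extent-mono movesL = ≤-refl
    extent-mono movesR = ≤-refl
    extent-mono (writes {a} {_} {ls} {rs})
      rewrite length-ʳ++ ls {rs} | length-ʳ++ ls {put a rs} = +-monoʳ-≤ (length ls) (length-put a rs)
    extent-mono scans = ≤-refl
    extent-mono (x ⨾ y) = ≤-trans (extent-mono x) (extent-mono y)
    extent-mono (again _ x y) = ≤-trans (extent-mono x) (extent-mono y)
    extent-mono (leave _) = ≤-refl
    extent-mono (taken _ x) = extent-mono x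
    extent-mono (passed-by _ x) = extent-mono x

  module Compiled (P : Prog) where

    transducer : Transducer s Out
    transducer = record
      { states = suc (size P)
      ; aux    = g
      ; tapes  = 1
      ; start  = suc (entry P)
      ; halted = λ { zero → true ; (suc _) → false }
      ; δ      = λ { zero    _ _        → zero , stay , (nothing , stay) ∷ [] , nothing
                   ; (suc x) i (c ∷ []) → single (code P suc zero x i c) }
      }
      where
      single : ∀ {S : Set} → S × Action → _
      single (q , m , a , o) = q , m , a ∷ [] , o

    open Transducer transducer using (State; halted; δ)
    open TransducerRun transducer

    module _ (w : List (Fin s)) (S : ℕ) where

      open Execution w

      Bounded : Config → Set
      Bounded c = Allᵛ (λ τ → head τ < S) (work c)

      data Reach : Config → Config → Set where
        here  : ∀ {c} → Reach c c
        there : ∀ {c c′} → Bounded c → Reach (step w c) c′ → Reach c c′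

      _▷▷_ : ∀ {c c′ c″} → Reach c c′ → Reach c′ c″ → Reach c c″
      here      ▷▷ r = r
      there b q ▷▷ r = there b (q ▷▷ r)

      -- The bound on `i` is kept because even `stay` passes through the minimum in `moveInput`.
      -- Cells are compared pointwise, since tapes are functions.
      data Represents (q : State) : Store → Config → Set where
        rep : ∀ {i ls rs o cs} → i ≤ suc (length w) → (∀ j → cs j ≡ nth (ls ʳ++ rs) j) →
          Represents q (store i ls rs o) (config q i (tape (length ls) cs ∷ []) o)

      -- The form in which the induction over programs can use the compiled machine: it mentions
      -- only the states that belong to `p`, and so it passes to the components of `p`.
      record Loaded (p : Prog) (e : Fin (size p) → State) (k : State) : Set where
        field
          live  : ∀ x → halted (e x) ≡ false
          agree : ∀ x i c → δ (e x) i (c ∷ []) ≡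
            (let q , m , a , o = code p e k x i c in q , m , a ∷ [] , o)

      open Loaded

      loadedˡ : ∀ {p q e k} → Loaded (p ⨾ q) e k →
        Loaded p (e ∘ (_↑ˡ size q)) (e (size p ↑ʳ entry q))
      loadedˡ {p} {q} l .live x = live l (x ↑ˡ size q)
      loadedˡ {p} {q} l .agree x i c with agree l (x ↑ˡ size q) i c
      ... | eq rewrite splitAt-↑ˡ (size p) x (size q) = eq

      loadedʳ : ∀ {p q e k} → Loaded (p ⨾ q) e k → Loaded q (e ∘ (size p ↑ʳ_)) k
      loadedʳ {p} {q} l .live x = live l (size p ↑ʳ x)
      loadedʳ {p} {q} l .agree x i c with agree l (size p ↑ʳ x) i c
      ... | eq rewrite splitAt-↑ʳ (size p) (size q) x = eq

      loadedᵇ : ∀ {t p e k} → Loaded (while t p) e k → Loaded p (e ∘ suc) (e zero)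
      loadedᵇ l .live x  = live l (suc x)
      loadedᵇ l .agree x = agree l (suc x)

      loadedᵗ : ∀ {t p q e k} → Loaded (branch t p q) e k → Loaded p (e ∘ suc ∘ (_↑ˡ size q)) k
      loadedᵗ {t} {p} {q} l .live x = live l (suc (x ↑ˡ size q))
      loadedᵗ {t} {p} {q} l .agree x i c with agree l (suc (x ↑ˡ size q)) i c
      ... | eq rewrite splitAt-↑ˡ (size p) x (size q) = eq

      loadedᶠ : ∀ {t p q e k} → Loaded (branch t p q) e k → Loaded q (e ∘ suc ∘ (size p ↑ʳ_)) k
      loadedᶠ {t} {p} {q} l .live x = live l (suc (size p ↑ʳ x))
      loadedᶠ {t} {p} {q} l .agree x i c with agree l (suc (size p ↑ʳ x)) i c
      ... | eq rewrite splitAt-↑ʳ (size p) (size q) x = eq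

      bounded : ∀ {q σ c} → extent σ < S → Represents q σ c → Bounded c
      bounded lt (rep {ls = ls} {rs} _ _) = ≤-<-trans
        (≤-trans (m≤m+n (length ls) (length rs)) (≤-reflexive (sym (length-ʳ++ ls)))) lt ∷ []

      step-eq : ∀ {q i ls rs o cs q′ m a mv o′} → halted q ≡ false →
        (∀ j → cs j ≡ nth (ls ʳ++ rs) j) →
        δ q (readInput w i) (first rs ∷ []) ≡ (q′ , m , (a , mv) ∷ [] , o′) →
        step w (config q i (tape (length ls) cs ∷ []) o) ≡
          config q′ (moveInput w m i) (act (tape (length ls) cs) (a , mv) ∷ []) (o ++ fromMaybe o′)
      step-eq {q} {ls = ls} {rs} {cs = cs} live cells-eq eq
        with halted q | live
      ... | false | refl
        rewrite trans (cells-eq (length ls)) (nth-first ls {rs}) | eq = refl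

      -- A machine step always writes. All instructions but `write` put back the symbol just read,
      -- be it a blank.
      unchanged : ∀ {ls rs} {cs : ℕ → Maybe Letters} → (∀ j → cs j ≡ nth (ls ʳ++ rs) j) →
        ∀ j → (if j ≡ᵇ length ls then first rs else cs j) ≡ nth (ls ʳ++ rs) j
      unchanged {ls} cells-eq j with j ≡ᵇ length ls in eq
      ... | false = cells-eq j
      ... | true rewrite ≡ᵇ⇒≡ j (length ls) (subst T (sym eq) tt) = sym (nth-first ls)

      advance : ∀ {q q′ i ls rs o σ′ c m a mv o′} →
        halted q ≡ false → length (ls ʳ++ rs) < S →
        δ q (readInput w i) (first rs ∷ []) ≡ (q′ , m , (a , mv) ∷ [] , o′) →
        (∀ {cs} → i ≤ suc (length w) → (∀ j → cs j ≡ nth (ls ʳ++ rs) j) →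
          Represents q′ σ′ (config q′ (moveInput w m i)
            (act (tape (length ls) cs) (a , mv) ∷ []) (o ++ fromMaybe o′))) →
        Represents q (store i ls rs o) c → ∃[ c′ ] (Reach c c′ × Represents q′ σ′ c′)
      advance {q} {q′} {ls = ls} {rs} {σ′ = σ′} live lt eq next r@(rep i≤ cells-eq) =
        _ , there (bounded lt r) here ,
        subst (Represents q′ σ′) (sym (step-eq {ls = ls} {rs} live cells-eq eq)) (next i≤ cells-eq)

      idle : ∀ {q′ i ls rs o cs} → i ≤ suc (length w) → (∀ j → cs j ≡ nth (ls ʳ++ rs) j) →
        Represents q′ (store i ls rs o)
          (config q′ (moveInput w stay i) (act (tape (length ls) cs) (first rs , stay) ∷ []) (o ++ []))
      idle {q′} {i} {ls} {rs} {o} {cs} i≤ cells-eq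
        rewrite m≤n⇒m⊓n≡m i≤ | ++-identityʳ o = rep i≤ (unchanged {ls} {rs} cells-eq)

      -- Induction on the execution, not on the program: a further round of a loop is a smaller
      -- derivation for the same program. The space bound is carried back from the final store by
      -- `extent-mono`.
      simulate : ∀ {p e k σ σ′ c} → Exec p σ σ′ → Loaded p e k → extent σ′ < S →
        Represents (e (entry p)) σ c → ∃[ c′ ] (Reach c c′ × Represents k σ′ c′)
      simulate {e = e} {k} (emits {f} {i} {ls} {rs} {o} refl) l lt =
        advance (live l zero) lt (agree l zero _ _) λ {cs} i≤ eq →
          subst (λ j → Represents k (store i ls rs (o ++ fromMaybe (f (readInput w i) (first rs))))
                         (config k j _ (o ++ fromMaybe (f (readInput w i) (first rs))))) (sym (m≤n⇒m⊓n≡m i≤))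
            (rep i≤ (unchanged {ls} {rs} eq))
      simulate {e = e} {k} (movesL {i} {x} {ls} {rs} {o}) l lt =
        advance (live l zero) lt (agree l zero _ _) λ {cs} i≤ eq →
          subst₂ (λ j o′ → Represents k (store i ls (x ∷ rs) o) (config k j _ o′))
            (sym (m≤n⇒m⊓n≡m i≤)) (sym (++-identityʳ o))
            (rep i≤ (unchanged {x ∷ ls} {rs} eq))
      simulate {e = e} {k} (movesR {i} {ls} {x} {rs} {o}) l lt =
        advance (live l zero) lt (agree l zero _ _) λ {cs} i≤ eq →
          subst₂ (λ j o′ → Represents k (store i (x ∷ ls) rs o) (config k j _ o′))
            (sym (m≤n⇒m⊓n≡m i≤)) (sym (++-identityʳ o))
            (rep i≤ (unchanged {ls} {x ∷ rs} eq))
      simulate {e = e} {k} x@(writes {a} {i} {ls} {rs} {o}) l lt =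
        advance (live l zero) (≤-<-trans (extent-mono x) lt) (agree l zero _ _) λ {cs} i≤ eq →
          subst₂ (λ j o′ → Represents k (store i ls (put a rs) o) (config k j _ o′))
            (sym (m≤n⇒m⊓n≡m i≤)) (sym (++-identityʳ o))
            (rep i≤ λ j → trans (cong (if j ≡ᵇ length ls then just a else_) (eq j))
                                (sym (nth-put a ls {rs} j)))
      simulate {e = e} {k} (scans {m} {i} {ls} {rs} {o}) l lt =
        advance (live l zero) lt (agree l zero _ _) λ {cs} i≤ eq →
          subst (λ o′ → Represents k (store (moveInput w m i) ls rs o) (config k _ _ o′))
            (sym (++-identityʳ o))
            (rep (m⊓n≤n (moveHead m i) _) (unchanged {ls} {rs} eq))
      simulate (x ⨾ y) l lt r
        with simulate x (loadedˡ l) (≤-<-trans (extent-mono y) lt) r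
      ... | _ , reach , r₁ with simulate y (loadedʳ l) lt r₁
      ... | _ , reach′ , r₂ = _ , reach ▷▷ reach′ , r₂
      simulate {e = e} {k} (again {t} {p} {store i ls rs o} eq x y) l lt r
        with advance (live l zero) (≤-<-trans (≤-trans (extent-mono x) (extent-mono y)) lt)
               (trans (agree l zero (readInput w i) (first rs))
                  (cong (λ b → (if b then e (suc (entry p)) else k) , stay , (first rs , stay) ∷ [] , nothing) eq))
               idle r
      ... | _ , reach , r₁
        with simulate x (loadedᵇ l) (≤-<-trans (extent-mono y) lt) r₁
      ... | _ , reach′ , r₂ with simulate y l lt r₂
      ... | _ , reach″ , r₃ = _ , reach ▷▷ (reach′ ▷▷ reach″) , r₃
      simulate {e = e} {k} (leave {t} {p} {store i ls rs o} eq) l lt =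
        advance (live l zero) lt
          (trans (agree l zero (readInput w i) (first rs))
            (cong (λ b → (if b then e (suc (entry p)) else k) , stay , (first rs , stay) ∷ [] , nothing) eq))
          idle
      simulate {e = e} {k} (taken {t} {p} {q} {store i ls rs o} eq x) l lt r
        with advance (live l zero) (≤-<-trans (extent-mono x) lt)
               (trans (agree l zero (readInput w i) (first rs))
                 (cong (λ b → (if b then e (suc (entry p ↑ˡ size q)) else e (suc (size p ↑ʳ entry q))) , stay , (first rs , stay) ∷ [] , nothing) eq))
               idle r
      ... | _ , reach , r₁ with simulate x (loadedᵗ l) lt r₁
      ... | _ , reach′ , r₂ = _ , reach ▷▷ reach′ , r₂
      simulate {e = e} {k} (passed-by {t} {p} {q} {store i ls rs o} eq x) l lt r
        with advance (live l zero) (≤-<-trans (extent-mono x) lt)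
               (trans (agree l zero (readInput w i) (first rs))
                 (cong (λ b → (if b then e (suc (entry p ↑ˡ size q)) else e (suc (size p ↑ʳ entry q))) , stay , (first rs , stay) ∷ [] , nothing) eq))
               idle r
      ... | _ , reach , r₁ with simulate x (loadedᶠ l) lt r₁
      ... | _ , reach′ , r₂ = _ , reach ▷▷ reach′ , r₂

      iterate-step : ℕ → Config → Config
      iterate-step zero    c = c
      iterate-step (suc t) c = step w (iterate-step t c)

      iterate-shift : ∀ t c → iterate-step t (step w c) ≡ step w (iterate-step t c)
      iterate-shift zero    c = refl
      iterate-shift (suc t) c = cong (step w) (iterate-shift t c)

      run-iterate : ∀ t → run w t ≡ iterate-step t initial
      run-iterate zero    = refl
      run-iterate (suc t) = cong (step w) (run-iterate t)

      step-halted : ∀ c → halted (state c) ≡ true → step w c ≡ c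
      step-halted c eq with halted (state c) | eq
      ... | true | refl = refl

      reach-end : ∀ {c c′} → Reach c c′ → ∃[ t ] iterate-step t c ≡ c′
      reach-end here = 0 , refl
      reach-end {c} (there _ r) with reach-end r
      ... | t , eq = suc t , trans (sym (iterate-shift t c)) eq

      -- `InSpace` speaks about all times, whereas `Reach` is a finite path. Past its end the halted
      -- configuration is a fixed point of `step`.
      reach-bounded : ∀ {c c′} → Reach c c′ → halted (state c′) ≡ true → Bounded c′ →
        ∀ t → Bounded (iterate-step t c)
      reach-bounded {c} here h b t = subst Bounded (sym (stays t)) b
        where
        stays : ∀ t → iterate-step t c ≡ c
        stays zero    = refl
        stays (suc t) = trans (cong (step w) (stays t)) (step-halted c h)
      reach-bounded (there b r) h b′ zero = b
      reach-bounded {c} (there b r) h b′ (suc t) =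
        subst Bounded (iterate-shift t c) (reach-bounded r h b′ t)

      module _ {i ls rs o} (exec : Exec P (store 0 [] [] []) (store i ls rs o))
               (lt : length (ls ʳ++ rs) < S) where

        private
          loaded : Loaded P suc zero
          loaded = record { live = λ _ → refl ; agree = λ _ _ _ → refl }

          result = simulate exec loaded lt (rep z≤n λ _ → refl)

          halts : ∀ {c} → Represents zero (store i ls rs o) c →
            T (halted (state c)) × output c ≡ o × halted (state c) ≡ true
          halts (rep _ _) = tt , refl , refl

        computes : ∃[ t ] (T (halted (state (run w t))) × output (run w t) ≡ o)
        computes with result
        ... | c , reach , r with reach-end reach
        ... | t , eq = t , subst (λ c → T (halted (state c)) × output c ≡ o)
                             (sym (trans (run-iterate t) eq))
                             (proj₁ (halts r) , proj₁ (proj₂ (halts r)))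

        inSpace : ∀ t → Bounded (run w t)
        inSpace t with result
        ... | c , reach , r = subst Bounded (sym (run-iterate t))
          (reach-bounded reach (proj₂ (proj₂ (halts r))) (bounded lt r) t)

-- Binary numerals, least significant bit first

bit : Bool → ℕ
bit b = if b then 1 else 0

value : List Bool → ℕ
value []       = 0
value (b ∷ bs) = bit b + 2 * value bs

increment : List Bool → List Bool
increment []           = []
increment (false ∷ bs) = true ∷ bs
increment (true ∷ bs)  = false ∷ increment bs

overflow : List Bool → Bool
overflow []           = true
overflow (false ∷ _)  = false
overflow (true ∷ bs)  = overflow bs

value-increment : ∀ bs →
  value (increment bs) + (if overflow bs then 2 ^ length bs else 0) ≡ suc (value bs)
value-increment []           = refl
value-increment (false ∷ bs) = +-identityʳ _
value-increment (true ∷ bs) with overflow bs | value-increment bs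
... | true  | eq = trans (sym (*-distribˡ-+ 2 (value (increment bs)) _)) (trans (cong (2 *_) eq) (lemma (value bs)))
  where
  lemma : ∀ v → 2 * suc v ≡ suc (suc (2 * v))
  lemma = solve-∀
... | false | eq = trans (+-identityʳ _)
  (trans (cong (2 *_) (trans (sym (+-identityʳ _)) eq)) (lemma (value bs)))
  where
  lemma : ∀ v → 2 * suc v ≡ suc (suc (2 * v))
  lemma = solve-∀

value-bound : ∀ bs → value bs < 2 ^ length bs
value-bound []       = s≤s z≤n
value-bound (b ∷ bs) = begin-strict
  bit b + 2 * value bs   ≤⟨ +-monoˡ-≤ _ (bit≤1 b) ⟩
  1 + 2 * value bs       <⟨ n<1+n _ ⟩
  2 + 2 * value bs       ≡⟨ sym (*-suc 2 (value bs)) ⟩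
  2 * suc (value bs)     ≤⟨ *-monoʳ-≤ 2 (value-bound bs) ⟩
  2 * 2 ^ length bs      ∎
  where
  open ≤-Reasoning
  bit≤1 : ∀ b → bit b ≤ 1
  bit≤1 true  = s≤s z≤n
  bit≤1 false = z≤n

length-increment : ∀ bs → length (increment bs) ≡ length bs
length-increment []           = refl
length-increment (false ∷ bs) = refl
length-increment (true ∷ bs)  = cong suc (length-increment bs)

increment-overflow : ∀ bs → overflow bs ≡ true → increment bs ≡ replicate (length bs) false
increment-overflow []          _  = refl
increment-overflow (true ∷ bs) eq = cong (false ∷_) (increment-overflow bs eq)

-- One more leading zero absorbs the overflow. In this way a counter of `W` cells can print names of
-- `W + 1` digits, including that of the successor of its largest value.
increment-extend : ∀ bs → increment (bs ++ false ∷ []) ≡ increment bs ++ overflow bs ∷ []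
increment-extend []           = refl
increment-extend (false ∷ bs) = refl
increment-extend (true ∷ bs)  = cong (false ∷_) (increment-extend bs)

-- Iteration, rather than division, mirrors how the work tape evolves from one pass of a loop to the
-- next.
numeral : ℕ → ℕ → List Bool
numeral k zero    = replicate k false
numeral k (suc i) = increment (numeral k i)

length-numeral : ∀ k i → length (numeral k i) ≡ k
length-numeral k zero    = length-replicate k
length-numeral k (suc i) = trans (length-increment (numeral k i)) (length-numeral k i)

-- Mutual with the next lemma: the value is right because no increment so far has wrapped around,
-- and by the value reached so far the next one cannot wrap around either.
value-numeral : ∀ k i → i < 2 ^ k → value (numeral k i) ≡ i
overflow-numeral : ∀ k i → suc i < 2 ^ k → overflow (numeral k i) ≡ false

value-numeral k zero _ = value-zeros k
  where
  value-zeros : ∀ k → value (replicate k false) ≡ 0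
  value-zeros zero    = refl
  value-zeros (suc k) = cong (2 *_) (value-zeros k)
value-numeral k (suc i) lt
  with overflow (numeral k i) | overflow-numeral k i lt | value-increment (numeral k i)
... | false | refl | eq =
  trans (sym (+-identityʳ _)) (trans eq (cong suc (value-numeral k i (<-trans (n<1+n i) lt))))

overflow-numeral k i lt with overflow (numeral k i) | value-increment (numeral k i)
... | false | _ = refl
... | true  | eq = contradiction lt (≤⇒≯ (begin
    2 ^ k                         ≡⟨ cong (2 ^_) (sym (length-numeral k i)) ⟩
    2 ^ length (numeral k i)      ≤⟨ m≤n+m _ (value (increment (numeral k i))) ⟩
    _                             ≡⟨ eq ⟩
    suc (value (numeral k i))     ≡⟨ cong suc (value-numeral k i (<-trans (n<1+n i) lt)) ⟩
    suc i                         ∎))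
  where open ≤-Reasoning

overflow-last : ∀ k i → suc i ≡ 2 ^ k → overflow (numeral k i) ≡ true
overflow-last k i last with overflow (numeral k i) | value-increment (numeral k i)
... | true  | _  = refl
... | false | eq = contradiction (value-bound (increment (numeral k i))) (<-irrefl (begin
    value (increment (numeral k i))         ≡⟨ sym (+-identityʳ _) ⟩
    _                                       ≡⟨ eq ⟩
    suc (value (numeral k i))               ≡⟨ cong suc (value-numeral k i (≤-reflexive last)) ⟩
    suc i                                   ≡⟨ last ⟩
    2 ^ k                                   ≡⟨ cong (2 ^_) (sym (length-numeral k (suc i))) ⟩
    2 ^ length (increment (numeral k i))    ∎))
  where open ≡-Reasoning

numeral-suc : ∀ k i → i < 2 ^ k → numeral (suc k) i ≡ numeral k i ++ false ∷ []
numeral-suc k zero _ = zeros k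
  where
  zeros : ∀ k → replicate (suc k) false ≡ replicate k false ++ false ∷ []
  zeros zero    = refl
  zeros (suc k) = cong (false ∷_) (zeros k)
numeral-suc k (suc i) lt = begin
  increment (numeral (suc k) i)                            ≡⟨ cong increment (numeral-suc k i i<) ⟩
  increment (numeral k i ++ false ∷ [])                    ≡⟨ increment-extend (numeral k i) ⟩
  increment (numeral k i) ++ overflow (numeral k i) ∷ []
    ≡⟨ cong (λ b → increment (numeral k i) ++ b ∷ []) (overflow-numeral k i lt) ⟩
  increment (numeral k i) ++ false ∷ []                    ∎
  where
  open ≡-Reasoning
  i< = <-trans (n<1+n i) lt

numeral-next : ∀ k i → i < 2 ^ k →
  numeral (suc k) (suc i) ≡ increment (numeral k i) ++ overflow (numeral k i) ∷ []
numeral-next k i lt =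
  trans (cong increment (numeral-suc k i lt)) (increment-extend (numeral k i))

-- In contrast to `increment` the numeral is lengthened when it overflows. Counting up from `[]`
-- thus gives numerals of logarithmic length.
grow : List Bool → List Bool
grow []           = true ∷ []
grow (false ∷ bs) = true ∷ bs
grow (true ∷ bs)  = false ∷ grow bs

counted : ℕ → List Bool → List Bool
counted zero    bs = bs
counted (suc r) bs = counted r (grow bs)

-- Formula schemes

-- In bijective base 2 every string of digits denotes a different number. Leading zeros count, so
-- lists of bits serve as names as they stand, and `unletter` inverts this map.
letter : List Bool → Letter
letter []           = ℕᵇ.zero
letter (false ∷ bs) = 1+[2 letter bs ]
letter (true ∷ bs)  = 2[1+ letter bs ]

symbol : Bool → Symbol
symbol false = `1
symbol true  = `2

digits-letter : ∀ bs cs → digits (letter (bs ++ cs)) ≡ map symbol bs ++ digits (letter cs)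
digits-letter []           cs = refl
digits-letter (false ∷ bs) cs = cong (`1 ∷_) (digits-letter bs cs)
digits-letter (true ∷ bs)  cs = cong (`2 ∷_) (digits-letter bs cs)

data Scheme (X : Set) : Set where
  lit   : List Bool → Scheme X
  leaf  : X → Scheme X
  neg′  : Scheme X → Scheme X
  _or′_ : Scheme X → Scheme X → Scheme X
  A′ B′ : Scheme X → Scheme X

⟦_⟧ : ∀ {X} → Scheme X → (X → Formula) → Formula
⟦ lit bs ⟧   ρ = var (letter bs)
⟦ leaf x ⟧   ρ = ρ x
⟦ neg′ φ ⟧   ρ = neg (⟦ φ ⟧ ρ)
⟦ φ or′ ψ ⟧  ρ = ⟦ φ ⟧ ρ or ⟦ ψ ⟧ ρ
⟦ A′ φ ⟧     ρ = ⟨A⟩ (⟦ φ ⟧ ρ)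
⟦ B′ φ ⟧     ρ = ⟨B⟩ (⟦ φ ⟧ ρ)

truth : Formula
truth = var (letter []) or neg (var (letter []))

_and_ : Formula → Formula → Formula
φ and ψ = neg (neg φ or neg ψ)

-- Ending in `truth` makes all conjuncts alike: each contributes a negation, a disjunction, a
-- negation, its own code and one more negation, and the code of the remainder follows. The printing
-- loop has no special last round.
conj : ℕ → ℕ → (ℕ → Formula) → Formula
conj i zero    f = truth
conj i (suc r) f = f i and conj (suc i) r f

-- Letters indexed by the loop variable i, and by its successor. The names have
-- one bit more than i needs, since the last successor is 2 ^ W.
data Indexed : Set where
  cur next : List Bool → Indexed

indexed : ℕ → ℕ → Indexed → Formula
indexed W i (cur t)  = var (letter (t ++ numeral (suc W) i))
indexed W i (next t) = var (letter (t ++ numeral (suc W) (suc i)))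

-- Outside of loops the loop variable is 0.
data Top : Set where
  outer  : Indexed → Top
  forall′ : Scheme Indexed → Top
  chain  : Top

-- Formulas that depend on the input, and the program that prints them

module Chains {s : ℕ} (link : Fin s → Formula → Formula) (end : Formula) where

  chained : List (Fin s) → Formula
  chained []      = end
  chained (a ∷ w) = link a (chained w)

  top : ℕ → List (Fin s) → Top → Formula
  top W w (outer x)   = indexed W 0 x
  top W w (forall′ φ) = conj 0 (2 ^ W) (λ i → ⟦ φ ⟧ (indexed W i))
  top W w chain       = chained w

-- The tape alphabet: 0 marks the left end, 1 and 2 are the bits, and 3 is
-- padding, used only while the input is being counted.
module Printing (s : ℕ) (link : Fin s → Formula → Formula) (prefix : Fin s → List Symbol)
                (end : Formula)
                (encode-link : ∀ a φ → encode (link a φ) ≡ prefix a ++ encode φ) where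

  open Programs s 4 Symbol
  open Chains link end

  digit : Bool → Fin 4
  digit false = 1F
  digit true  = 2F

  notMark isOne isZero isBlank notBlank isFull : Test
  notMark _ (just 0F) = false
  notMark _ _         = true
  isOne _ (just 2F) = true
  isOne _ _         = false
  isZero _ (just 1F) = true
  isZero _ _         = false
  isBlank _ nothing  = true
  isBlank _ (just _) = false
  notBlank _ nothing  = false
  notBlank _ (just _) = true
  isFull _ (just 2F) = true
  isFull _ (just 3F) = true
  isFull _ _         = false

  notStart isLetter notEnd : Test
  notStart ⊢ _ = false
  notStart _ _ = true
  isLetter ⌜ _ ⌝ _ = true
  isLetter _     _ = false
  notEnd ⊣ _ = false
  notEnd _ _ = true

  shown : Input → Maybe (Fin 4) → Maybe Symbol
  shown _ (just 1F) = just `1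
  shown _ (just 2F) = just `2
  shown _ _         = nothing

  skip rewind copy : Prog
  skip   = emit (λ _ _ → nothing)
  rewind = while notMark workL
  copy   = while notBlank (emit shown ⨾ workR)

  put1 : Symbol → Prog
  put1 x = emit (λ _ _ → just x)

  print : List Symbol → Prog
  print []       = skip
  print (x ∷ xs) = put1 x ⨾ print xs

  -- The name of the current index gets a zero as its extra top digit. The name of the next one is
  -- computed while it is printed, with the carry out of the counter as top digit; the tape itself
  -- is altered by `advanceIndex` only.
  printCurrent printNext advanceIndex : Prog
  printCurrent = workR ⨾ copy ⨾ put1 `1 ⨾ rewind
  printNext    = workR ⨾ while isOne (put1 `1 ⨾ workR) ⨾
    branch isZero (put1 `2 ⨾ workR ⨾ copy ⨾ put1 `1) (put1 `2) ⨾ rewind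
  advanceIndex = workR ⨾ while isOne (write 1F ⨾ workR) ⨾ branch isZero (write 2F) skip

  printIndexed : Indexed → Prog
  printIndexed (cur t)  = put1 `p ⨾ print (map symbol t) ⨾ printCurrent ⨾ put1 `end
  printIndexed (next t) = put1 `p ⨾ print (map symbol t) ⨾ printNext ⨾ put1 `end

  printScheme : ∀ {X} → (X → Prog) → Scheme X → Prog
  printScheme ρ (lit bs)   = print (`p ∷ digits (letter bs))
  printScheme ρ (leaf x)   = ρ x
  printScheme ρ (neg′ φ)   = put1 `¬ ⨾ printScheme ρ φ
  printScheme ρ (φ or′ ψ)  = put1 `∨ ⨾ printScheme ρ φ ⨾ printScheme ρ ψ
  printScheme ρ (A′ φ)     = put1 `A ⨾ printScheme ρ φ
  printScheme ρ (B′ φ)     = put1 `B ⨾ printScheme ρ φ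

  printPass : Scheme Indexed → Prog
  printPass φ = rewind ⨾ print (`¬ ∷ `∨ ∷ `¬ ∷ []) ⨾ printScheme printIndexed φ ⨾
    put1 `¬ ⨾ advanceIndex

  firstFor : (Fin s → List Symbol) → Input → Maybe (Fin 4) → Maybe Symbol
  firstFor f ⌜ a ⌝ _ = first (f a)
  firstFor f _     _ = nothing

  -- A step emits at most one symbol, so the string belonging to the scanned letter is printed
  -- position by position. All letters share these states; a string that has already ended emits
  -- nothing.
  printBySymbol : ℕ → (Fin s → List Symbol) → Prog
  printBySymbol zero    f = skip
  printBySymbol (suc n) f = emit (firstFor f) ⨾
    printBySymbol n (drop 1 ∘ f)

  longest : ∀ {k} (f : Fin k → List Symbol) → ∃[ n ] (∀ a → length (f a) ≤ n)
  longest {zero}  f = 0 , λ ()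
  longest {suc k} f with longest (f ∘ suc)
  ... | n , le = length (f zero) + n , λ
    { zero    → m≤m+n _ n
    ; (suc a) → ≤-trans (le a) (m≤n+m n _) }

  printTop : Top → Prog
  printTop (outer x)   = printIndexed x
  printTop (forall′ φ) =
    printPass φ ⨾ while notBlank (printPass φ) ⨾ rewind ⨾ print (encode truth)
  printTop chain       = while notStart (scan left) ⨾ scan right ⨾
    while isLetter (printBySymbol (proj₁ (longest prefix)) prefix ⨾ scan right) ⨾
    print (encode end)

  pad : ℕ → Prog
  pad zero    = skip
  pad (suc k) = workR ⨾ write 3F ⨾ pad k

  -- Each bit of the counter is followed by d cells of padding, to make the index
  -- range, 2 to the width, outgrow a given polynomial.
  countOne countInput : ℕ → Prog
  countOne d = workR ⨾ while isFull (branch isOne (write 1F) skip ⨾ workR) ⨾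
    branch isBlank (write 2F ⨾ pad d) (write 2F) ⨾ rewind
  countInput d = while notEnd (countOne d ⨾ scan right)

  setUp : ℕ → Prog
  setUp d = write 0F ⨾ countInput d ⨾ workR ⨾ while notBlank (write 1F ⨾ workR) ⨾ rewind

  printer : ℕ → Scheme Top → Prog
  printer d φ = setUp d ⨾ printScheme printTop φ

  module Printed (w : List (Fin s)) where

    open Execution w

    numerals : List Bool → List (Fin 4)
    numerals = map digit

    infixr 5 _⟫_
    cast : ∀ {p σ i ls rs o o′} → o ≡ o′ →
      Exec p σ (store i ls rs o) → Exec p σ (store i ls rs o′)
    cast refl x = x

    Emit : Prog → List (Fin 4) → List (Fin 4) → List Symbol → List (Fin 4) → List (Fin 4) → Set
    Emit p ls rs x ls′ rs′ = ∀ {i o} → Exec p (store i ls rs o) (store i ls′ rs′ (o ++ x))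

    _⟫_ : ∀ {p q ls rs x ls₁ rs₁ y ls₂ rs₂} → Emit p ls rs x ls₁ rs₁ → Emit q ls₁ rs₁ y ls₂ rs₂ →
      Emit (p ⨾ q) ls rs (x ++ y) ls₂ rs₂
    _⟫_ {x = x} {y = y} a b {o = o} = a ⨾ cast (++-assoc o x y) b

    loop : ∀ {t p ls rs x ls₁ rs₁ y ls₂ rs₂} → (∀ {i o} → test t (store i ls rs o) ≡ true) →
      Emit p ls rs x ls₁ rs₁ → Emit (while t p) ls₁ rs₁ y ls₂ rs₂ →
      Emit (while t p) ls rs (x ++ y) ls₂ rs₂
    loop {x = x} {y = y} eq a b {i} {o} = again (eq {i} {o}) a (cast (++-assoc o x y) b)

    quit : ∀ {t p ls rs} → (∀ {i o} → test t (store i ls rs o) ≡ false) → Emit (while t p) ls rs [] ls rs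
    quit eq {i} {o} = cast (sym (++-identityʳ o)) (leave (eq {i} {o}))

    silent : ∀ {p ls rs ls′ rs′} → (∀ {i o} → Exec p (store i ls rs o) (store i ls′ rs′ o)) →
      Emit p ls rs [] ls′ rs′
    silent x {o = o} = cast (sym (++-identityʳ o)) x

    one : ∀ {x ls rs} → Emit (put1 x) ls rs (x ∷ []) ls rs
    one = emits refl

    skips : ∀ {ls rs} → Emit skip ls rs [] ls rs
    skips = emits refl

    prints : ∀ xs {ls rs} → Emit (print xs) ls rs xs ls rs
    prints []       = skips
    prints (x ∷ xs) = one ⟫ prints xs

    NoMark : List (Fin 4) → Set
    NoMark = All (λ a → notMark ⊢ (just a) ≡ true)

    noMark-nth : ∀ {ds} i → NoMark ds → ∀ k → notMark i (nth ds k) ≡ true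
    noMark-nth               i []       k       = refl
    noMark-nth {suc _ ∷ _}   i (_ ∷ _)  zero    = refl
    noMark-nth               i (_ ∷ ds) (suc k) = noMark-nth i ds k

    noMark-digits : ∀ bs → NoMark (numerals bs)
    noMark-digits []           = []
    noMark-digits (false ∷ bs) = refl ∷ noMark-digits bs
    noMark-digits (true ∷ bs)  = refl ∷ noMark-digits bs

    rewinds : ∀ ls {rs ds} → ls ʳ++ rs ≡ 0F ∷ ds → NoMark ds → Emit rewind ls rs [] [] (0F ∷ ds)
    rewinds ls {rs} {ds} eq nm = silent (go ls eq)
      where
      go : ∀ ls {rs i o} → ls ʳ++ rs ≡ 0F ∷ ds →
        Exec rewind (store i ls rs o) (store i [] (0F ∷ ds) o)
      go []       refl = leave refl
      go (l ∷ ls) {rs} {i} eq = again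
        (trans (cong (notMark (readInput w i)) (trans (sym (nth-first (l ∷ ls)))
          (cong (λ τ → nth τ (suc (length ls))) eq))) (noMark-nth (readInput w i) nm (length ls)))
        movesL (go ls eq)

    copies : ∀ bs {ls} → Emit copy ls (numerals bs) (map symbol bs) (numerals bs ʳ++ ls) []
    copies []           = quit refl
    copies (false ∷ bs) = loop refl (emits refl ⟫ silent movesR) (copies bs)
    copies (true ∷ bs)  = loop refl (emits refl ⟫ silent movesR) (copies bs)

    infixr 6 _⟫∅_
    _⟫∅_ : ∀ {p q ls rs x ls₁ rs₁ ls₂ rs₂} → Emit p ls rs x ls₁ rs₁ → Emit q ls₁ rs₁ [] ls₂ rs₂ →
      Emit (p ⨾ q) ls rs x ls₂ rs₂
    _⟫∅_ {x = x} a b {o = o} = a ⨾ cast (++-identityʳ (o ++ x)) b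

    returns : ∀ bs ls {τ} → ls ʳ++ numerals bs ≡ τ → (numerals bs ʳ++ ls) ʳ++ [] ≡ τ
    returns bs ls eq = trans (ʳ++-ʳ++ (numerals bs)) (trans (cong (ls ʳ++_) (++-identityʳ _)) eq)

    printsCurrent : ∀ bs →
      Emit printCurrent [] (0F ∷ numerals bs) (map symbol (bs ++ false ∷ [])) [] (0F ∷ numerals bs)
    printsCurrent bs rewrite map-++ symbol bs (false ∷ []) =
      silent movesR ⟫ copies bs ⟫ one ⟫∅ rewinds (numerals bs ʳ++ _) (returns bs _ refl) (noMark-digits bs)

    printsCarry : ∀ bs {ls ds} → ls ʳ++ numerals bs ≡ 0F ∷ ds → NoMark ds → Emit
      (while isOne (put1 `1 ⨾ workR) ⨾ branch isZero (put1 `2 ⨾ workR ⨾ copy ⨾ put1 `1) (put1 `2) ⨾ rewind)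
      ls (numerals bs) (map symbol (increment bs ++ overflow bs ∷ [])) [] (0F ∷ ds)
    printsCarry [] eq nm = leave refl ⨾ passed-by refl one ⨾ cast (++-identityʳ _) (rewinds _ eq nm)
    printsCarry (false ∷ bs) eq nm rewrite map-++ symbol bs (false ∷ []) =
      leave refl ⨾ taken refl (one ⟫ silent movesR ⟫ copies bs ⟫ one) ⨾
      cast (++-identityʳ _) (rewinds _ (returns bs _ eq) nm)
    printsCarry (true ∷ bs) {ls} eq nm {i} {o} with printsCarry bs {2F ∷ ls} eq nm {i} {o ++ `1 ∷ []}
    ... | a ⨾ b = again refl (one ⨾ movesR) a ⨾ cast (++-assoc o _ _) b

    printsNext : ∀ bs → Emit printNext [] (0F ∷ numerals bs)
      (map symbol (increment bs ++ overflow bs ∷ [])) [] (0F ∷ numerals bs)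
    printsNext bs = silent movesR ⟫ printsCarry bs refl (noMark-digits bs)

    -- The head stays where the carry has stopped, which is a blank exactly if the counter has
    -- wrapped around. This is the exit test of the loop in `printTop`, and the reason why
    -- `printPass` starts by rewinding.
    advances : ∀ bs ls {i o} → ∃[ ls′ ] ∃[ rs′ ]
      (Exec (while isOne (write 1F ⨾ workR) ⨾ branch isZero (write 2F) skip)
         (store i ls (numerals bs) o) (store i ls′ rs′ o) ×
       ls′ ʳ++ rs′ ≡ ls ʳ++ numerals (increment bs) ×
       (∀ j → notBlank j (first rs′) ≡ not (overflow bs)))
    advances [] ls = ls , [] , (leave refl ⨾ passed-by refl (emits (++-identityʳ _))) , refl , λ _ → refl
    advances (false ∷ bs) ls = ls , 2F ∷ numerals bs , (leave refl ⨾ taken refl writes) , refl , λ _ → refl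
    advances (true ∷ bs) ls {i} {o} with advances bs (1F ∷ ls) {i} {o}
    ... | ls′ , rs′ , (a ⨾ b) , eq , blank =
      ls′ , rs′ , (again refl (writes ⨾ movesR) a ⨾ b) , eq , blank

    Inside : ℕ → Set
    Inside i = i ≤ suc (length w)

    -- Unlike in `Emit`, the input head may end elsewhere, since printing the chain scans the input.
    -- The work tape and its head are restored, so that such programs compose freely.
    Prints : Prog → List (Fin 4) → List Symbol → Set
    Prints p τ x = ∀ {i o} → Inside i → ∃[ i′ ]
      (Inside i′ × Exec p (store i [] τ o) (store i′ [] τ (o ++ x)))

    infixr 5 _⟫ᵖ_
    _⟫ᵖ_ : ∀ {p q τ x y} → Prints p τ x → Prints q τ y → Prints (p ⨾ q) τ (x ++ y)
    _⟫ᵖ_ {x = x} {y} a b {o = o} i≤ with a {o = o} i≤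
    ... | i₁ , i₁≤ , ea with b {o = o ++ x} i₁≤
    ... | i₂ , i₂≤ , eb = i₂ , i₂≤ , ea ⨾ cast (++-assoc o x y) eb

    still : ∀ {p τ x} → Emit p [] τ x [] τ → Prints p τ x
    still a {i} i≤ = i , i≤ , a

    prints-scheme : ∀ {X} {τ} {ρ : X → Prog} {σ : X → Formula} →
      (∀ x → Prints (ρ x) τ (encode (σ x))) →
      ∀ φ → Prints (printScheme ρ φ) τ (encode (⟦ φ ⟧ σ))
    prints-scheme h (lit bs)  = still (prints _)
    prints-scheme h (leaf x)  = h x
    prints-scheme h (neg′ φ)  = still one ⟫ᵖ prints-scheme h φ
    prints-scheme h (φ or′ ψ) = still one ⟫ᵖ prints-scheme h φ ⟫ᵖ prints-scheme h ψ
    prints-scheme h (A′ φ)    = still one ⟫ᵖ prints-scheme h φ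
    prints-scheme h (B′ φ)    = still one ⟫ᵖ prints-scheme h φ

    encode-letter : ∀ t bs →
      encode (var (letter (t ++ bs))) ≡ `p ∷ map symbol t ++ map symbol bs ++ `end ∷ []
    encode-letter t bs = cong (`p ∷_) (trans (digits-letter t bs)
      (cong (map symbol t ++_) (trans (cong (digits ∘ letter) (sym (++-identityʳ bs)))
        (digits-letter bs []))))

    module _ (W : ℕ) where

      content : ℕ → List (Fin 4)
      content i = 0F ∷ numerals (numeral W i)

      prints-indexed : ∀ i → i < 2 ^ W → ∀ x →
        Prints (printIndexed x) (content i) (encode (indexed W i x))
      prints-indexed i lt (cur t)
        rewrite encode-letter t (numeral (suc W) i) | numeral-suc W i lt =
        still (one ⟫ prints (map symbol t) ⟫ printsCurrent (numeral W i) ⟫ one)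
      prints-indexed i lt (next t)
        rewrite encode-letter t (numeral (suc W) (suc i)) | numeral-next W i lt =
        still (one ⟫ prints (map symbol t) ⟫ printsNext (numeral W i) ⟫ one)

      module _ (φ : Scheme Indexed) where

        body : ℕ → Formula
        body i = ⟦ φ ⟧ (indexed W i)

        passed : ℕ → List Symbol
        passed i = (`¬ ∷ `∨ ∷ `¬ ∷ []) ++ encode (body i) ++ `¬ ∷ []

        passes : ℕ → ℕ → List Symbol
        passes i zero    = []
        passes i (suc r) = passed i ++ passes (suc i) r

        encode-conj : ∀ i r → encode (conj i r body) ≡ passes i r ++ encode truth
        encode-conj i zero    = refl
        encode-conj i (suc r) = cong (λ x → `¬ ∷ `∨ ∷ `¬ ∷ x) (begin
          encode (body i) ++ `¬ ∷ encode (conj (suc i) r body)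
            ≡⟨ cong (λ x → encode (body i) ++ `¬ ∷ x) (encode-conj (suc i) r) ⟩
          encode (body i) ++ `¬ ∷ passes (suc i) r ++ encode truth
            ≡⟨ sym (++-assoc (encode (body i)) (`¬ ∷ []) _) ⟩
          (encode (body i) ++ `¬ ∷ []) ++ passes (suc i) r ++ encode truth
            ≡⟨ sym (++-assoc (encode (body i) ++ `¬ ∷ []) _ _) ⟩
          ((encode (body i) ++ `¬ ∷ []) ++ passes (suc i) r) ++ encode truth ∎)
          where open ≡-Reasoning

        prints-pass : ∀ i → i < 2 ^ W → ∀ {ls rs j o} → Inside j → ls ʳ++ rs ≡ content i →
          ∃[ j′ ] ∃[ ls′ ] ∃[ rs′ ] (Inside j′ ×
            Exec (printPass φ) (store j ls rs o) (store j′ ls′ rs′ (o ++ passed i)) ×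
            ls′ ʳ++ rs′ ≡ content (suc i) ×
            (∀ k → notBlank k (first rs′) ≡ not (overflow (numeral W i))))
        prints-pass i lt {ls} {rs} {j} {o} j≤ eq
          with prints-scheme {σ = indexed W i} (prints-indexed i lt) φ {o = o ++ _} j≤
        ... | j′ , j′≤ , e with advances (numeral W i) (0F ∷ []) {j′} {o ++ passed i}
        ... | ls′ , rs′ , e′ , eq′ , blank = j′ , ls′ , rs′ , j′≤ ,
          (cast (++-identityʳ o) (rewinds ls eq (noMark-digits (numeral W i))) ⨾
           prints _ ⨾ e ⨾ cast append one ⨾ movesR ⨾ e′) , eq′ , blank
          where
          append : _
          append = trans (++-assoc (o ++ `¬ ∷ `∨ ∷ `¬ ∷ []) _ _) (++-assoc o _ _)

        -- The overflow that ends the loop also resets the counter to zero, the state in which the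
        -- next loop expects it.
        prints-passes : ∀ r i → i + suc r ≡ 2 ^ W → ∀ {ls rs j o} → Inside j →
          ls ʳ++ rs ≡ content i →
          ∃[ j′ ] ∃[ ls′ ] ∃[ rs′ ] (Inside j′ ×
            Exec (printPass φ ⨾ while notBlank (printPass φ)) (store j ls rs o)
              (store j′ ls′ rs′ (o ++ passes i (suc r))) ×
            ls′ ʳ++ rs′ ≡ content 0)
        prints-passes r i r-left {ls} {rs} {j} {o} j≤ eq
          with prints-pass i (≤-trans (m<m+n i (s≤s z≤n)) (≤-reflexive r-left)) {ls} {rs} {o = o} j≤ eq
        prints-passes zero i r-left {o = o} j≤ eq | j′ , ls′ , rs′ , j′≤ , e , eq′ , blank =
          j′ , ls′ , rs′ , j′≤ ,
          (e ⨾ cast (cong (o ++_) (sym (++-identityʳ (passed i))))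
            (leave (trans (blank (readInput w j′)) (cong not done)))) ,
          trans eq′ (cong (λ bs → 0F ∷ numerals bs)
            (trans (increment-overflow (numeral W i) done)
              (cong (λ k → replicate k false) (length-numeral W i))))
          where
          done = overflow-last W i (trans (sym (trans (+-suc i 0) (cong suc (+-identityʳ i)))) r-left)
        prints-passes (suc r) i r-left {o = o} j≤ eq | j′ , ls′ , rs′ , j′≤ , e , eq′ , blank
          with prints-passes r (suc i) (trans (sym (+-suc i (suc r))) r-left) {ls′} {rs′} {o = o ++ passed i} j′≤ eq′
        ... | j″ , ls″ , rs″ , j″≤ , (e₁ ⨾ e₂) , eq″ =
          j″ , ls″ , rs″ , j″≤ ,
          (e ⨾ again (trans (blank (readInput w j′)) (cong not more)) e₁
            (cast (++-assoc o (passed i) _) e₂)) , eq″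
          where
          more = overflow-numeral W i (≤-trans (s≤s (m<m+n i (s≤s z≤n)))
            (≤-reflexive (trans (sym (+-suc i (suc r))) r-left)))

        prints-forall : Prints (printTop (forall′ φ)) (content 0) (encode (conj 0 (2 ^ W) body))
        prints-forall {i} {o} i≤ with prints-passes (pred (2 ^ W)) 0 (suc-pred (2 ^ W) {{m^n≢0 2 W}}) {[]} {content 0} {o = o} i≤ refl
        ... | j , ls , rs , j≤ , (e₁ ⨾ e₂) , eq = j , j≤ ,
          e₁ ⨾ e₂ ⨾ cast (++-identityʳ _) (rewinds ls eq (noMark-digits (numeral W 0))) ⨾
          cast (trans (++-assoc o _ _) (cong (o ++_) (sym
            (trans (cong (λ k → encode (conj 0 k body)) (sym (suc-pred (2 ^ W) {{m^n≢0 2 W}})))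
              (encode-conj 0 (suc (pred (2 ^ W)))))))) (prints (encode truth))

    n = length w

    notStart-suc : ∀ i c → notStart (readInput w (suc i)) c ≡ true
    notStart-suc i c with nth w i
    ... | just _  = refl
    ... | nothing = refl

    read-letter : ∀ {i a} → nth w i ≡ just a → readInput w (suc i) ≡ ⌜ a ⌝
    read-letter {i} eq with nth w i | eq
    ... | just _ | refl = refl

    read-end : ∀ {i} → nth w i ≡ nothing → readInput w (suc i) ≡ ⊣
    read-end {i} eq with nth w i | eq
    ... | nothing | refl = refl

    scanned : ∀ {m i ls rs o} → moveHead m i ≤ suc n →
      Exec (scan m) (store i ls rs o) (store (moveHead m i) ls rs o)
    scanned {m} {i} {ls} {rs} {o} le =
      subst (λ j → Exec (scan m) (store i ls rs o) (store j ls rs o)) (m≤n⇒m⊓n≡m le) scans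

    toStart : ∀ i {ls rs o} → Inside i → Exec (while notStart (scan left)) (store i ls rs o) (store 0 ls rs o)
    toStart zero              i≤ = leave refl
    toStart (suc i) {rs = rs} i≤ = again (notStart-suc i (first rs)) (scanned (<⇒≤ i≤)) (toStart i (<⇒≤ i≤))

    first-drop : ∀ {A : Set} (xs : List A) → fromMaybe (first xs) ++ drop 1 xs ≡ xs
    first-drop []      = refl
    first-drop (_ ∷ _) = refl

    prints-by-symbol : ∀ {i a} → readInput w i ≡ ⌜ a ⌝ → ∀ k f → length (f a) ≤ k →
      ∀ {ls rs o} → Exec (printBySymbol k f) (store i ls rs o) (store i ls rs (o ++ f a))
    prints-by-symbol {a = a} eq zero f le with f a
    prints-by-symbol eq zero f z≤n | [] = emits refl
    prints-by-symbol {i} {a} eq (suc k) f le {ls} {rs} {o} =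
      emits (cong (λ x → o ++ fromMaybe (firstFor f x (first rs))) eq) ⨾
      cast (trans (++-assoc o _ _) (cong (o ++_) (first-drop (f a))))
        (prints-by-symbol eq k (drop 1 ∘ f) (shorter (f a) le))
      where
      shorter : ∀ (xs : List Symbol) → length xs ≤ suc k → length (drop 1 xs) ≤ k
      shorter []       _        = z≤n
      shorter (_ ∷ xs) (s≤s le) = le

    prefixes : List (Fin s) → List Symbol
    prefixes []      = []
    prefixes (a ∷ v) = prefix a ++ prefixes v

    encode-chained : ∀ v → encode (chained v) ≡ prefixes v ++ encode end
    encode-chained []      = refl
    encode-chained (a ∷ v) = trans (encode-link a (chained v))
      (trans (cong (prefix a ++_) (encode-chained v)) (sym (++-assoc (prefix a) _ _)))

    prints-letters : ∀ v k → k + length v ≡ n → (∀ j → nth w (k + j) ≡ nth v j) → ∀ {τ o} →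
      Exec (while isLetter (printBySymbol (proj₁ (longest prefix)) prefix ⨾ scan right))
        (store (suc k) [] τ o) (store (suc n) [] τ (o ++ prefixes v))
    prints-letters [] k len suffix {τ} {o}
      rewrite sym (trans (sym (+-identityʳ k)) len) = cast (sym (++-identityʳ o))
        (leave (cong (λ x → isLetter x (first τ))
          (read-end (trans (cong (nth w) (sym (+-identityʳ k))) (suffix 0)))))
    prints-letters (a ∷ v) k len suffix {τ} {o} = again
      (cong (λ x → isLetter x (first τ)) here-letter)
      (prints-by-symbol here-letter (proj₁ (longest prefix)) prefix (proj₂ (longest prefix) a) ⨾
       scanned (s≤s (≤-trans (m≤m+n (suc k) (length v)) (≤-reflexive len′))))
      (cast (++-assoc o _ _) (prints-letters v (suc k) len′
        (λ j → trans (cong (nth w) (sym (+-suc k j))) (suffix (suc j)))))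
      where
      here-letter = read-letter (trans (cong (nth w) (sym (+-identityʳ k))) (suffix 0))
      len′ = trans (sym (+-suc k (length v))) len

    prints-chain : ∀ {τ} → Prints (printTop chain) τ (encode (chained w))
    prints-chain {o = o} i≤ = suc n , ≤-refl ,
      toStart _ i≤ ⨾ scanned (s≤s z≤n) ⨾
      prints-letters w 0 refl (λ _ → refl) ⨾
      cast (trans (++-assoc o _ _) (cong (o ++_) (sym (encode-chained w)))) (prints (encode end))

    prints-top : ∀ W x → Prints (printTop x) (content W 0) (encode (top W w x))
    prints-top W (outer x)   = prints-indexed W 0 (m^n>0 2 W) x
    prints-top W (forall′ φ) = prints-forall W φ
    prints-top W chain       = prints-chain

    module _ (d : ℕ) where

      blocks : List Bool → List (Fin 4)
      blocks []       = []
      blocks (b ∷ bs) = digit b ∷ replicate d 3F ++ blocks bs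

      length-blocks : ∀ bs → length (blocks bs) ≡ length bs * suc d
      length-blocks []       = refl
      length-blocks (b ∷ bs) = cong suc (trans (length-++ (replicate d 3F))
        (cong₂ _+_ (length-replicate d) (length-blocks bs)))

      noMark-blocks : ∀ bs → NoMark (blocks bs)
      noMark-blocks [] = []
      noMark-blocks (b ∷ bs) = digit-noMark b ∷ padded d
        where
        digit-noMark : ∀ b → notMark ⊢ (just (digit b)) ≡ true
        digit-noMark true  = refl
        digit-noMark false = refl
        padded : ∀ k → NoMark (replicate k 3F ++ blocks bs)
        padded zero    = noMark-blocks bs
        padded (suc k) = refl ∷ padded k

      pads : ∀ k a ls {i o} → ∃[ ls′ ] ∃[ rs′ ]
        (Exec (pad k) (store i ls (a ∷ []) o) (store i ls′ rs′ o) ×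
         ls′ ʳ++ rs′ ≡ ls ʳ++ (a ∷ replicate k 3F))
      pads zero    a ls = ls , a ∷ [] , emits (++-identityʳ _) , refl
      pads (suc k) a ls with pads k 3F (a ∷ ls)
      ... | ls′ , rs′ , e , eq = ls′ , rs′ , (movesR ⨾ writes ⨾ e) , eq

      passFull raise : Prog
      passFull = while isFull (branch isOne (write 1F) skip ⨾ workR)
      raise    = branch isBlank (write 2F ⨾ pad d) (write 2F)

      -- Padding counts as full, so a carry runs through it to the next bit.
      passes-padding : ∀ k {p ls rs i o σ} →
        Exec (passFull ⨾ p) (store i (replicate k 3F ʳ++ ls) rs o) σ →
        Exec (passFull ⨾ p) (store i ls (replicate k 3F ++ rs) o) σ
      passes-padding zero    e = e
      passes-padding (suc k) e with passes-padding k e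
      ... | e₁ ⨾ e₂ = again refl (passed-by refl (emits (++-identityʳ _)) ⨾ movesR) e₁ ⨾ e₂

      raises : ∀ bs ls {i o} → ∃[ ls′ ] ∃[ rs′ ]
        (Exec (passFull ⨾ raise) (store i ls (blocks bs) o) (store i ls′ rs′ o) ×
         ls′ ʳ++ rs′ ≡ ls ʳ++ blocks (grow bs))
      raises [] ls with pads d 2F ls
      ... | ls′ , rs′ , e , eq = ls′ , rs′ , (leave refl ⨾ taken refl (writes ⨾ e)) ,
        trans eq (cong (λ x → ls ʳ++ (2F ∷ x)) (sym (++-identityʳ (replicate d 3F))))
      raises (false ∷ bs) ls = ls , blocks (true ∷ bs) , (leave refl ⨾ passed-by refl writes) , refl
      raises (true ∷ bs) ls {i} {o} with raises bs (replicate d 3F ʳ++ 1F ∷ ls) {i} {o}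
      ... | ls′ , rs′ , e , eq with passes-padding d e
      ... | e₁ ⨾ e₂ = ls′ , rs′ , (again refl (taken refl writes ⨾ movesR) e₁ ⨾ e₂) ,
        trans eq (ʳ++-ʳ++ (replicate d 3F))

      counts-one : ∀ bs {i o} →
        Exec (countOne d) (store i [] (0F ∷ blocks bs) o) (store i [] (0F ∷ blocks (grow bs)) o)
      counts-one bs {i} {o} with raises bs (0F ∷ []) {i} {o}
      ... | ls′ , rs′ , (e₁ ⨾ e₂) , eq =
        movesR ⨾ e₁ ⨾ e₂ ⨾ cast (++-identityʳ o) (rewinds ls′ eq (noMark-blocks (grow bs)))

      notEnd-inside : ∀ i c → i < suc n → notEnd (readInput w i) c ≡ true
      notEnd-inside zero    c lt       = refl
      notEnd-inside (suc i) c (s≤s lt) with nth w i | nth-inside w i lt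
      ... | just _ | _ = refl

      -- The marker `⊢` is counted together with the letters. The total `suc n` gives the counter a
      -- bit even for the empty input.
      counts : ∀ r i bs {o} → i + r ≡ suc n → Exec (countInput d)
        (store i [] (0F ∷ blocks bs) o) (store (suc n) [] (0F ∷ blocks (counted r bs)) o)
      counts zero i bs eq rewrite trans (sym (+-identityʳ i)) eq =
        leave (cong (λ x → notEnd x (just 0F)) (read-end (nth-beyond w n ≤-refl)))
      counts (suc r) i bs eq = again
        (notEnd-inside i (just 0F) (≤-trans (m<m+n i (s≤s z≤n)) (≤-reflexive eq)))
        (counts-one bs ⨾ scanned (≤-trans (m<m+n i (s≤s z≤n)) (≤-reflexive eq)))
        (counts r (suc i) (grow bs) (trans (sym (+-suc i r)) eq))

      clears : ∀ ds {ls i o} → Exec (while notBlank (write 1F ⨾ workR))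
        (store i ls ds o) (store i (replicate (length ds) 1F ʳ++ ls) [] o)
      clears []       = leave refl
      clears (_ ∷ ds) = again refl (writes ⨾ movesR) (clears ds)

      width : ℕ
      width = length (counted (suc n) []) * suc d

      sets-up : Exec (setUp d) (store 0 [] [] []) (store (suc n) [] (content width 0) [])
      sets-up = writes ⨾ counts (suc n) 0 [] refl ⨾ movesR ⨾ clears bs ⨾
        rewinds (replicate (length bs) 1F ʳ++ 0F ∷ []) cleared (noMark-digits (replicate width false))
        where
        bs = blocks (counted (suc n) [])
        cleared : (replicate (length bs) 1F ʳ++ 0F ∷ []) ʳ++ [] ≡ content width 0
        cleared = trans (ʳ++-ʳ++ (replicate (length bs) 1F)) (cong (0F ∷_)
          (trans (++-identityʳ _) (trans (cong (λ k → replicate k 1F) (length-blocks (counted (suc n) [])))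
            (sym (map-replicate digit width false)))))

      printer-correct : ∀ φ → ∃[ i ]
        Exec (printer d φ) (store 0 [] [] [])
          (store i [] (content width 0) (encode (⟦ φ ⟧ (top width w))))
      printer-correct φ with prints-scheme {σ = top width w} (prints-top width) φ {o = []} ≤-refl
      ... | i , _ , e = i , (sets-up ⨾ e)

-- The width of the counter, and the space used by the printer

value-grow : ∀ bs → value (grow bs) ≡ suc (value bs)
value-grow []           = refl
value-grow (false ∷ bs) = refl
value-grow (true ∷ bs)  = trans (cong (2 *_) (value-grow bs)) (*-suc 2 (value bs))

value-counted : ∀ r bs → value (counted r bs) ≡ r + value bs
value-counted zero    bs = refl
value-counted (suc r) bs =
  trans (value-counted r (grow bs)) (trans (cong (r +_) (value-grow bs)) (+-suc r (value bs)))

-- Numerals without leading zeros; only for these does the value bound the length from above.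
data Normal : List Bool → Set where
  top-bit : Normal (true ∷ [])
  _∷_     : ∀ b {bs} → Normal bs → Normal (b ∷ bs)

normal-grow : ∀ {bs} → Normal bs → Normal (grow bs)
normal-grow top-bit      = false ∷ top-bit
normal-grow (false ∷ nb) = true ∷ nb
normal-grow (true ∷ nb)  = false ∷ normal-grow nb

normal-counted : ∀ r {bs} → Normal bs → Normal (counted r bs)
normal-counted zero    nb = nb
normal-counted (suc r) nb = normal-counted r (normal-grow nb)

normal-value : ∀ {bs} → Normal bs → 2 ^ length bs ≤ 2 * value bs
normal-value top-bit           = ≤-refl
normal-value (_∷_ b {bs} nb) = *-monoʳ-≤ 2 (≤-trans (normal-value nb) (m≤n+m _ (bit b)))

countedBits : ℕ → ℕ
countedBits n = length (counted (suc n) [])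

countedBits-lower : ∀ n → suc n < 2 ^ countedBits n
countedBits-lower n = subst (_< 2 ^ countedBits n)
  (trans (value-counted (suc n) []) (+-identityʳ (suc n))) (value-bound (counted (suc n) []))

countedBits-upper : ∀ n → countedBits n ≤ 2 + ⌊log₂ n ⌋
countedBits-upper n = begin
  countedBits n                    ≡⟨ sym (⌊log₂[2^n]⌋≡n (countedBits n)) ⟩
  -- The first of the `suc n` increments turns `[]` into the normal numeral 1, and `n` of them
  -- remain.
  ⌊log₂ (2 ^ countedBits n) ⌋       ≤⟨ ⌊log₂⌋-mono-≤ (normal-value (normal-counted n top-bit)) ⟩
  ⌊log₂ (2 * value (counted (suc n) [])) ⌋
    ≡⟨ cong (λ v → ⌊log₂ (2 * v) ⌋) (trans (value-counted (suc n) []) (+-identityʳ (suc n))) ⟩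
  ⌊log₂ (2 * suc n) ⌋               ≡⟨ ⌊log₂[2*b]⌋≡1+⌊log₂b⌋ (suc n) ⟩
  1 + ⌊log₂ suc n ⌋                 ≤⟨ s≤s (log-suc n) ⟩
  2 + ⌊log₂ n ⌋                     ∎
  where
  open ≤-Reasoning
  log-suc : ∀ n → ⌊log₂ suc n ⌋ ≤ suc ⌊log₂ n ⌋
  log-suc zero    = ≤-trans (≤-reflexive (⌊log₂[2^n]⌋≡n 0)) z≤n
  log-suc (suc n) = ≤-trans
    (⌊log₂⌋-mono-≤ {suc (suc n)} {2 * suc n} (s≤s (≤-trans (s≤s (m≤m+n n _)) (≤-reflexive (sym (+-suc n _))))))
    (≤-reflexive (⌊log₂[2*b]⌋≡1+⌊log₂b⌋ (suc n)))

indexWidth : ℕ → ℕ → ℕ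
indexWidth d n = countedBits n * suc d

module _ {s} (link : Fin s → Formula → Formula) (prefix : Fin s → List Symbol) (end : Formula)
         (encode-link : ∀ a φ → encode (link a φ) ≡ prefix a ++ encode φ) where

  open Printing s link prefix end encode-link
  open Chains link end using (top)

  printed-logSpace : ∀ d φ →
    LogSpaceComputable (λ w → encode (⟦ φ ⟧ (top (indexWidth d (length w)) w)))
  printed-logSpace d φ =
    -- The tape holds the mark and at most `(2 + L) * suc d` bits, where `L` is the logarithm. The
    -- factor `2 * suc d` covers the bits; the other 2 covers the mark and the strict inequality.
    transducer , suc (suc (2 * suc d)) ,
    (λ w → computes w (space w) (proj₂ (correct w)) (fits w)) ,
    (λ w → inSpace w (space w) (proj₂ (correct w)) (fits w))
    where
    open Programs s 4 Symbol using (module Compiled)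
    open Compiled (printer d φ)
    correct = λ w → Printed.printer-correct w d φ
    space : List (Fin s) → ℕ
    space w = suc (suc (2 * suc d)) * suc ⌊log₂ length w ⌋
    fits : ∀ w → length (Printed.content w (indexWidth d (length w)) 0) < space w
    fits w = begin-strict
      suc (length (map digit (numeral W 0))) ≡⟨ cong suc (trans (length-map digit (numeral W 0)) (length-numeral W 0)) ⟩
      suc W                                  ≤⟨ s≤s (*-monoˡ-≤ (suc d) (countedBits-upper (length w))) ⟩
      suc ((2 + L) * suc d)                  <⟨ n<1+n _ ⟩
      2 + (2 + L) * suc d                    ≤⟨ m≤m+n _ _ ⟩
      (2 + (2 + L) * suc d) + (2 * L + L * suc d) ≡⟨ lemma L d ⟩
      space w                                ∎
      where
      open ≤-Reasoning
      W = indexWidth d (length w)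
      L = ⌊log₂ length w ⌋
      lemma : ∀ L d → (2 + (2 + L) * suc d) + (2 * L + L * suc d) ≡ suc (suc (2 * suc d)) * suc L
      lemma = solve-∀

n<2^n : ∀ n → n < 2 ^ n
n<2^n zero    = s≤s z≤n
n<2^n (suc n) = +-mono-≤ (m^n>0 2 n) (≤-trans (n<2^n n) (m≤m+n (2 ^ n) 0))

-- The base is at least 2 even for `n = 0`, so a coefficient `a` is absorbed by an exponent that is
-- at least `a`, because `a < 2 ^ a`. One further factor `2 + n` pays for the sum.
powers-dominate : ∀ p → ∃[ e ] (∀ n → eval p n ≤ (2 + n) ^ suc e)
powers-dominate [] = 0 , λ _ → z≤n
powers-dominate (a ∷ p) with powers-dominate p
... | e , le = suc (a + e) , λ n → begin
  a + n * eval p n                               ≤⟨ +-mono-≤ (a≤ n) (*-monoʳ-≤ n (≤-trans (le n) (^-monoʳ-≤ (2 + n) (s≤s (m≤n+m e a))))) ⟩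
  (2 + n) ^ suc (a + e) + n * (2 + n) ^ suc (a + e) ≤⟨ *-monoˡ-≤ ((2 + n) ^ suc (a + e)) (n≤1+n (suc n)) ⟩
  (2 + n) * (2 + n) ^ suc (a + e)                ∎
  where
  open ≤-Reasoning
  a≤ : ∀ n → a ≤ (2 + n) ^ suc (a + e)
  a≤ n = ≤-trans (<⇒≤ (n<2^n a)) (≤-trans (^-monoˡ-≤ a (s≤s (s≤s z≤n)))
    (^-monoʳ-≤ (2 + n) (≤-trans (m≤m+n a e) (n≤1+n _))))

headBits : ℕ → ℕ → ℕ
headBits d n = 2 ^ indexWidth d n

-- This fixes the amount of padding: repeating every counter bit `suc e` times raises
-- `2 ^ countedBits n`, which exceeds `suc n`, to the power `suc e`. The first bound makes cell `n`,
-- the last one to be provided, addressable.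
headBits-dominate : ∀ p → ∃[ d ] (∀ n → n ≤ headBits d n × eval p n ≤ headBits d n)
headBits-dominate p with powers-dominate p
... | e , le = e , λ n →
  ≤-trans (≤-trans (m≤n+m n 2) (≤-trans (≤-reflexive (sym (^-identityʳ (2 + n))))
    (^-monoʳ-≤ (2 + n) {1} {suc e} (s≤s z≤n)))) (bound n) , ≤-trans (le n) (bound n)
  where
  bound : ∀ n → (2 + n) ^ suc e ≤ headBits e n
  bound n = ≤-trans (^-monoˡ-≤ (suc e) (countedBits-lower n))
    (≤-reflexive (^-*-assoc 2 (countedBits n) (suc e)))

-- Derived connectives of schemes

module _ {X : Set} where

  infixr 6 _and′_
  infixr 5 _imp′_

  _and′_ _imp′_ _iff′_ _xor′_ : Scheme X → Scheme X → Scheme X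
  φ and′ ψ = neg′ (neg′ φ or′ neg′ ψ)
  φ imp′ ψ = neg′ φ or′ ψ
  φ iff′ ψ = (φ and′ ψ) or′ (neg′ φ and′ neg′ ψ)
  φ xor′ ψ = neg′ (φ iff′ ψ)

  truth′ falsity′ proper′ point′ unit′ : Scheme X
  truth′   = lit [] or′ neg′ (lit [])
  falsity′ = neg′ truth′
  proper′  = B′ truth′
  point′   = neg′ proper′
  unit′    = proper′ and′ neg′ (B′ proper′)

  -- Among the proper prefixes of `[x , y]` the only point is `[x , x]`, and it is there just if
  -- `x < y`. Among the intervals that begin at `y` the only point is `[y , y]`.
  atLeft atRight : Scheme X → Scheme X
  atLeft φ  = B′ (point′ and′ φ)
  atRight φ = A′ (point′ and′ φ)

  -- A full decision tree over `k` formulas. Its size is exponential in `k`, but in the reduction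
  -- `k` depends on the decider alone.
  choose : (ℕ → Scheme X) → ∀ k → (Vec Bool k → Scheme X) → Scheme X
  choose l zero    F = F []
  choose l (suc k) F =
    (l k and′ choose l k (F ∘ (true ∷_))) or′ (neg′ (l k) and′ choose l k (F ∘ (false ∷_)))

  -- Only intervals [x , y] with x < N are reached.
  everywhere : Scheme X → Scheme X
  everywhere φ = neg′ (B′ (A′ (neg′ φ)))

vecOf : (ℕ → Bool) → ∀ k → Vec Bool k
vecOf f zero    = []
vecOf f (suc k) = f k ∷ vecOf f k

-- Semantics of formulas

unit-formula point-formula : Formula
unit-formula  = ⟨B⟩ truth and neg (⟨B⟩ (⟨B⟩ truth))
point-formula = neg (⟨B⟩ truth)

module Semantics (M : Model) where

  open Model M

  -- Conjunction and universal statements are encoded by negation, so unfolding them takes double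
  -- negation elimination. It is available constructively because the model is finite and its
  -- valuation Boolean.
  holds? : ∀ φ I → Dec (M , I ⊨ φ)
  holds? (var p)  I = T? (𝒱 I p)
  holds? (neg φ)  I = ¬? (holds? φ I)
  holds? (φ or ψ) I = holds? φ I ⊎-dec holds? ψ I
  holds? (⟨A⟩ φ)  (interval x y x≤y y≤N) =
    map′ (λ (y′ , _ , h) → y′ , h) (λ (y′ , h) → y′ , s≤s (proj₁ (proj₂ h)) , h)
      (anyUpTo? here (suc N))
    where
    here : ∀ y′ → Dec (Σ[ y≤y′ ∈ y ≤ y′ ] Σ[ y′≤N ∈ y′ ≤ N ] (M , interval y y′ y≤y′ y′≤N ⊨ φ))
    here y′ with y ≤? y′ | y′ ≤? N
    ... | no ¬p | _     = no (¬p ∘ proj₁)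
    ... | yes _ | no ¬q = no (¬q ∘ proj₁ ∘ proj₂)
    ... | yes p | yes q = map′ (λ h → p , q , h) (λ (_ , _ , h) → h) (holds? φ _)
  holds? (⟨B⟩ φ)  (interval x y x≤y y≤N) =
    map′ (λ (y′ , _ , h) → y′ , h) (λ (y′ , h) → y′ , proj₁ (proj₂ h) , h)
      (anyUpTo? here y)
    where
    here : ∀ y′ → Dec (Σ[ x≤y′ ∈ x ≤ y′ ] Σ[ y′<y ∈ y′ < y ]
      (M , interval x y′ x≤y′ (≤-trans (<⇒≤ y′<y) y≤N) ⊨ φ))
    here y′ with x ≤? y′ | y′ <? y
    ... | no ¬p | _     = no (¬p ∘ proj₁)
    ... | yes _ | no ¬q = no (¬q ∘ proj₁ ∘ proj₂)
    ... | yes p | yes q = map′ (λ h → p , q , h) (λ (_ , _ , h) → h) (holds? φ _)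

  module _ {I : Interval N} where

    ⊨truth : M , I ⊨ truth
    ⊨truth with T? (𝒱 I (letter []))
    ... | yes p = inj₁ p
    ... | no ¬p = inj₂ ¬p

    ⊨and : ∀ φ ψ → (M , I ⊨ φ and ψ) ⇔ ((M , I ⊨ φ) × (M , I ⊨ ψ))
    ⊨and φ ψ = mk⇔
      (λ h → decidable-stable (holds? φ I) (h ∘ inj₁) , decidable-stable (holds? ψ I) (h ∘ inj₂))
      λ { (p , q) (inj₁ ¬p) → ¬p p ; (p , q) (inj₂ ¬q) → ¬q q }

    ⊨imp : ∀ φ ψ → (M , I ⊨ neg φ or ψ) ⇔ ((M , I ⊨ φ) → (M , I ⊨ ψ))
    ⊨imp φ ψ = mk⇔ (λ { (inj₁ ¬p) p → contradiction p ¬p ; (inj₂ q) _ → q }) back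
      where
      back : _
      back f with holds? φ I
      ... | yes p = inj₂ (f p)
      ... | no ¬p = inj₁ ¬p

    module _ {X : Set} {ρ : X → Formula} where

      ⊨and′ : ∀ φ ψ →
        (M , I ⊨ ⟦ φ and′ ψ ⟧ ρ) ⇔ ((M , I ⊨ ⟦ φ ⟧ ρ) × (M , I ⊨ ⟦ ψ ⟧ ρ))
      ⊨and′ φ ψ = ⊨and (⟦ φ ⟧ ρ) (⟦ ψ ⟧ ρ)

      ⊨and-bool : ∀ φ ψ {a b} → (M , I ⊨ ⟦ φ ⟧ ρ) ⇔ T a → (M , I ⊨ ⟦ ψ ⟧ ρ) ⇔ T b →
        (M , I ⊨ ⟦ φ and′ ψ ⟧ ρ) ⇔ T (a ∧ b)
      ⊨and-bool φ ψ {true}  e f = mk⇔ (to f ∘ proj₂ ∘ to (⊨and′ φ ψ))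
        (λ q → from (⊨and′ φ ψ) (from e tt , from f q))
      ⊨and-bool φ ψ {false} e f = mk⇔ (to e ∘ proj₁ ∘ to (⊨and′ φ ψ)) λ ()

      ⊨iff : ∀ φ ψ {a b} → (M , I ⊨ ⟦ φ ⟧ ρ) ⇔ T a → (M , I ⊨ ⟦ ψ ⟧ ρ) ⇔ T b →
        (M , I ⊨ ⟦ φ iff′ ψ ⟧ ρ) ⇔ (a ≡ b)
      ⊨iff φ ψ {true}  {true}  e f =
        mk⇔ (λ _ → refl) (λ _ → inj₁ (from (⊨and′ φ ψ) (from e tt , from f tt)))
      ⊨iff φ ψ {true}  {false} e f = mk⇔
        (λ { (inj₁ h) → ⊥-elim (to f (proj₂ (to (⊨and′ φ ψ) h)))
           ; (inj₂ h) → ⊥-elim (proj₁ (to (⊨and′ (neg′ φ) (neg′ ψ)) h) (from e tt)) }) λ ()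
      ⊨iff φ ψ {false} {true}  e f = mk⇔
        (λ { (inj₁ h) → ⊥-elim (to e (proj₁ (to (⊨and′ φ ψ) h)))
           ; (inj₂ h) → ⊥-elim (proj₂ (to (⊨and′ (neg′ φ) (neg′ ψ)) h) (from f tt)) }) λ ()
      ⊨iff φ ψ {false} {false} e f =
        mk⇔ (λ _ → refl) (λ _ → inj₂ (from (⊨and′ (neg′ φ) (neg′ ψ)) (to e , to f)))

      ⊨xor : ∀ φ ψ {a b} → (M , I ⊨ ⟦ φ ⟧ ρ) ⇔ T a → (M , I ⊨ ⟦ ψ ⟧ ρ) ⇔ T b →
        (M , I ⊨ ⟦ φ xor′ ψ ⟧ ρ) ⇔ T (a xor b)
      ⊨xor φ ψ {a} {b} e f with ⊨iff φ ψ e f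
      ⊨xor φ ψ {true}  {true}  e f | g = mk⇔ (λ h → h (from g refl)) λ ()
      ⊨xor φ ψ {true}  {false} e f | g = mk⇔ (λ _ → tt) (λ _ h → contradiction (to g h) λ ())
      ⊨xor φ ψ {false} {true}  e f | g = mk⇔ (λ _ → tt) (λ _ h → contradiction (to g h) λ ())
      ⊨xor φ ψ {false} {false} e f | g = mk⇔ (λ h → h (from g refl)) λ ()

      ⊨choose : ∀ {l g} → (∀ i → (M , I ⊨ ⟦ l i ⟧ ρ) ⇔ T (g i)) →
        ∀ k F → (M , I ⊨ ⟦ choose l k F ⟧ ρ) ⇔ (M , I ⊨ ⟦ F (vecOf g k) ⟧ ρ)
      ⊨choose e zero    F = mk⇔ (λ h → h) (λ h → h)
      ⊨choose {l} {g} e (suc k) F with g k | e k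
      ... | b | ek = pick b ek
        where
        if-set if-unset : Scheme X
        if-set   = choose l k (F ∘ (true ∷_))
        if-unset = choose l k (F ∘ (false ∷_))
        pick : ∀ b → (M , I ⊨ ⟦ l k ⟧ ρ) ⇔ T b →
          (M , I ⊨ ⟦ choose l (suc k) F ⟧ ρ) ⇔ (M , I ⊨ ⟦ F (b ∷ vecOf g k) ⟧ ρ)
        pick true  ek = mk⇔
          (λ { (inj₁ h) → to (⊨choose {l} e k (F ∘ (true ∷_))) (proj₂ (to (⊨and′ (l k) if-set) h))
             ; (inj₂ h) → ⊥-elim (proj₁ (to (⊨and′ (neg′ (l k)) if-unset) h) (from ek tt)) })
          (λ h → inj₁ (from (⊨and′ (l k) if-set)
            (from ek tt , from (⊨choose {l} e k (F ∘ (true ∷_))) h)))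
        pick false ek = mk⇔
          (λ { (inj₁ h) → ⊥-elim (to ek (proj₁ (to (⊨and′ (l k) if-set) h)))
             ; (inj₂ h) → to (⊨choose {l} e k (F ∘ (false ∷_))) (proj₂ (to (⊨and′ (neg′ (l k)) if-unset) h)) })
          (λ h → inj₂ (from (⊨and′ (neg′ (l k)) if-unset)
            (to ek , from (⊨choose {l} e k (F ∘ (false ∷_))) h)))

    ⊨conj : ∀ i r f → (M , I ⊨ conj i r f) ⇔ (∀ j → i ≤ j → j < i + r → M , I ⊨ f j)
    ⊨conj i zero f = mk⇔
      (λ _ j i≤j j<i → contradiction (≤-trans j<i (≤-reflexive (+-identityʳ i))) (≤⇒≯ i≤j))
      (λ _ → ⊨truth)
    ⊨conj i (suc r) f = mk⇔ forth back
      where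
      both = ⊨and (f i) (conj (suc i) r f)
      forth : M , I ⊨ conj i (suc r) f → ∀ j → i ≤ j → j < i + suc r → M , I ⊨ f j
      forth h j i≤j j< with i ≟ j
      ... | yes refl = proj₁ (to both h)
      ... | no i≢j   = to (⊨conj (suc i) r f) (proj₂ (to both h)) j
        (≤∧≢⇒< i≤j i≢j) (≤-trans j< (≤-reflexive (+-suc i r)))
      back : (∀ j → i ≤ j → j < i + suc r → M , I ⊨ f j) → M , I ⊨ conj i (suc r) f
      back h = from both (h i ≤-refl (m<m+n i (s≤s z≤n)) ,
        from (⊨conj (suc i) r f) λ j i<j j< →
          h j (<⇒≤ i<j) (≤-trans j< (≤-reflexive (sym (+-suc i r)))))

  -- Clamping the position to `N` makes the labels total functions on `ℕ`, which can be used without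
  -- a proof of the bound.
  value-at : ℕ → Letter → Bool
  value-at z p = 𝒱 (point (z ⊓ N) (m⊓n≤n z N)) p

  value-at-point : ∀ {z} .(z≤N : z ≤ N) p → value-at z p ≡ 𝒱 (point z z≤N) p
  value-at-point {z} z≤N p = go (m≤n⇒m⊓n≡m (recompute-≤ z≤N)) 
    where
    -- Bounds of intervals are irrelevant; a usable proof is recovered by deciding the inequality.
    recompute-≤ : ∀ {m n} → .(m ≤ n) → m ≤ n
    recompute-≤ {m} {n} le with m ≤? n
    ... | yes p = p
    ... | no ¬p = ⊥-elim (contr le)
      where
      contr : .(m ≤ n) → ⊥
      contr le = Data.Empty.⊥-elim-irr (¬p le)
    go : ∀ {z′} .{z′≤N : z′ ≤ N} → z′ ≡ z → 𝒱 (point z′ z′≤N) p ≡ 𝒱 (point z z≤N) p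
    go refl = refl

  module _ {x y} (x≤y : x ≤ y) (y≤N : y ≤ N) where

    private
      I = interval x y x≤y y≤N

    ⊨proper : (M , I ⊨ ⟨B⟩ truth) ⇔ (x < y)
    ⊨proper = mk⇔ (λ (_ , p , q , _) → ≤-<-trans p q) back
      where
      back : x < y → M , I ⊨ ⟨B⟩ truth
      back x<y = x , ≤-refl , x<y , ⊨truth {interval x x ≤-refl (≤-trans (<⇒≤ x<y) y≤N)}

  module _ {x y} (x≤y : x ≤ y) (y≤N : y ≤ N) where

    private
      I = interval x y x≤y y≤N

    ⊨unit : (M , I ⊨ unit-formula) ⇔ (y ≡ suc x)
    ⊨unit = mk⇔ forth back
      where
      both = ⊨and {I} (⟨B⟩ truth) (neg (⟨B⟩ (⟨B⟩ truth)))
      forth : M , I ⊨ unit-formula → y ≡ suc x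
      forth h = ≤-antisym
        (≮⇒≥ λ lt → proj₂ (to both h)
          (suc x , n≤1+n x , lt , from (⊨proper (n≤1+n x) (≤-trans (<⇒≤ lt) y≤N)) ≤-refl))
        (to (⊨proper x≤y y≤N) (proj₁ (to both h)))
      short : y ≡ suc x → ¬ (M , I ⊨ ⟨B⟩ (⟨B⟩ truth))
      short refl (y′ , p , q , r) =
        <-irrefl refl (≤-trans (to (⊨proper p (≤-trans (<⇒≤ q) y≤N)) r) (s≤s⁻¹ q))
      back : y ≡ suc x → M , I ⊨ unit-formula
      back eq = from both (from (⊨proper x≤y y≤N) (≤-reflexive (sym eq)) , short eq)

    ⊨point : (M , I ⊨ point-formula) ⇔ (y ≡ x)
    ⊨point = mk⇔ (λ h → sym (≤∧≮⇒≡ x≤y (h ∘ from (⊨proper x≤y y≤N))))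
      λ eq h → <-irrefl (sym eq) (to (⊨proper x≤y y≤N) h)

  module _ {x : ℕ} (p : Letter) where

    ⊨here : ∀ {z} (x≤z : x ≤ z) (z≤N : z ≤ N) →
      (M , interval x z x≤z z≤N ⊨ point-formula and var p) ⇔ (z ≡ x × T (value-at x p))
    ⊨here {z} x≤z z≤N = mk⇔ forth back
      where
      both = ⊨and {interval x z x≤z z≤N} point-formula (var p)
      forth : M , interval x z x≤z z≤N ⊨ point-formula and var p → z ≡ x × T (value-at x p)
      forth h with to (⊨point x≤z z≤N) (proj₁ (to both h))
      ... | refl = refl , subst T (sym (value-at-point z≤N p)) (proj₂ (to both h))
      back : z ≡ x × T (value-at x p) → M , interval x z x≤z z≤N ⊨ point-formula and var p
      back (refl , v) = from both (from (⊨point x≤z z≤N) refl , subst T (value-at-point z≤N p) v)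

  module _ {x y} (x≤y : x ≤ y) (y≤N : y ≤ N) (p : Letter) where

    private
      I = interval x y x≤y y≤N

    ⊨right : (M , I ⊨ ⟨A⟩ (point-formula and var p)) ⇔ T (value-at y p)
    ⊨right = mk⇔ forth back
      where
      forth : M , I ⊨ ⟨A⟩ (point-formula and var p) → T (value-at y p)
      forth (y′ , y≤y′ , y′≤N , h) = proj₂ (to (⊨here p y≤y′ y′≤N) h)
      back : T (value-at y p) → M , I ⊨ ⟨A⟩ (point-formula and var p)
      back v = y , ≤-refl , y≤N , from (⊨here p ≤-refl y≤N) (refl , v)

    ⊨left : x < y → (M , I ⊨ ⟨B⟩ (point-formula and var p)) ⇔ T (value-at x p)
    ⊨left x<y = mk⇔ forth back
      where
      forth : M , I ⊨ ⟨B⟩ (point-formula and var p) → T (value-at x p)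
      forth (y′ , x≤y′ , y′<y , h) = proj₂ (to (⊨here p x≤y′ (≤-trans (<⇒≤ y′<y) y≤N)) h)
      back : T (value-at x p) → M , I ⊨ ⟨B⟩ (point-formula and var p)
      back v = x , ≤-refl , x<y ,
        from (⊨here p ≤-refl (≤-trans (<⇒≤ x<y) y≤N)) (refl , v)

  ⊨everywhere : ∀ φ →
    (M , interval 0 N z≤n ≤-refl ⊨ neg (⟨B⟩ (⟨A⟩ (neg φ)))) ⇔
      (∀ {x y} → x < N → (x≤y : x ≤ y) (y≤N : y ≤ N) → M , interval x y x≤y y≤N ⊨ φ)
  ⊨everywhere φ = mk⇔
    (λ h {x} {y} x<N x≤y y≤N → decidable-stable (holds? φ _)
      λ ¬p → h (x , z≤n , x<N , y , x≤y , y≤N , ¬p))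
    back
    where
    back : (∀ {x y} → x < N → (x≤y : x ≤ y) (y≤N : y ≤ N) → M , interval x y x≤y y≤N ⊨ φ) →
      ¬ (M , interval 0 N z≤n ≤-refl ⊨ ⟨B⟩ (⟨A⟩ (neg φ)))
    back h (x , _ , x<N , y , x≤y , y≤N , ¬p) = ¬p (h x<N x≤y y≤N)

-- Finite types and their one-hot codes

-- A retraction from `Fin card` is all that decoding asks for: the code of an element has to
-- determine it.
record Finite (A : Set) : Set where
  field
    card       : ℕ
    index      : A → Fin card
    elem       : Fin card → A
    elem-index : ∀ a → elem (index a) ≡ a

open Finite

fin-finite : ∀ n → Finite (Fin n)
fin-finite n = record { card = n ; index = λ i → i ; elem = λ i → i ; elem-index = λ _ → refl }

maybe-finite : ∀ {A} → Finite A → Finite (Maybe A)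
maybe-finite {A} F = record
  { card       = suc (card F)
  ; index      = λ { nothing → zero ; (just a) → suc (index F a) }
  ; elem       = λ { zero → nothing ; (suc i) → just (elem F i) }
  ; elem-index = λ { nothing → refl ; (just a) → cong just (elem-index F a) }
  }

sum-finite : ∀ {A B} → Finite A → Finite B → Finite (A ⊎ B)
sum-finite F G = record
  { card       = card F + card G
  ; index      = λ x → join (card F) (card G) (Sum.map (index F) (index G) x)
  ; elem       = λ i → Sum.map (elem F) (elem G) (splitAt (card F) i)
  ; elem-index = λ x → trans (cong (Sum.map (elem F) (elem G)) (splitAt-join (card F) (card G) (Sum.map (index F) (index G) x))) (back x)
  }
  where
  back : ∀ x → Sum.map (elem F) (elem G) (Sum.map (index F) (index G) x) ≡ x
  back (inj₁ a) = cong inj₁ (elem-index F a)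
  back (inj₂ b) = cong inj₂ (elem-index G b)

product-finite : ∀ {A B} → Finite A → Finite B → Finite (A × B)
product-finite F G = record
  { card       = card F * card G
  ; index      = λ (a , b) → combine (index F a) (index G b)
  ; elem       = λ i → Product.map (elem F) (elem G) (remQuot (card G) i)
  ; elem-index = λ (a , b) → trans (cong (Product.map (elem F) (elem G)) (remQuot-combine (index F a) (index G b)))
      (cong₂ _,_ (elem-index F a) (elem-index G b))
  }

-- The highest set letter wins. Whatever letters a model sets at a point, they denote one moment or
-- `nothing`, and uniqueness need not be expressed by the formula.
hot : ∀ {k} → Vec Bool k → Maybe ℕ
hot []                = nothing
hot {suc k} (b ∷ bs) = if b then just k else hot bs

hot-vecOf : ∀ k {j} → j < k → hot (vecOf (_≡ᵇ j) k) ≡ just j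
hot-vecOf (suc k) {j} j<k with k ≡ᵇ j in eq
... | true  = cong just (≡ᵇ⇒≡ k j (subst T (sym eq) tt))
... | false = hot-vecOf k (≤∧≢⇒< (s≤s⁻¹ j<k) λ { refl → subst T eq (≡⇒≡ᵇ k k refl) })

module _ {A : Set} (F : Finite A) where

  lookup-elem : Maybe ℕ → Maybe A
  lookup-elem nothing  = nothing
  lookup-elem (just i) with i <? card F
  ... | yes i< = just (elem F (fromℕ< i<))
  ... | no _   = nothing

  decode : Vec Bool (card F) → Maybe A
  decode v = lookup-elem (hot v)

  decode-code : ∀ a → decode (vecOf (_≡ᵇ toℕ (index F a)) (card F)) ≡ just a
  decode-code a rewrite hot-vecOf (card F) (toℕ<n (index F a))
    with toℕ (index F a) <? card F
  ... | yes i< = cong just (trans (cong (elem F) (fromℕ<-toℕ (index F a) i<)) (elem-index F a))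
  ... | no ¬p  = contradiction (toℕ<n (index F a)) ¬p

-- Numbers as m-bit words

number : ℕ → (ℕ → Bool) → ℕ
number zero    f = 0
number (suc m) f = number m f + bit (f m) * 2 ^ m

-- The carries of adding one to `f`, axiomatised by a recurrence whose clauses inspect bit `j` and
-- the carries `j` and `j + 1` only, as the conjuncts of the formula do.
record Carries (m : ℕ) (f k : ℕ → Bool) : Set where
  constructor carries
  field
    start : k 0 ≡ true
    onward : ∀ j → j < m → k (suc j) ≡ k j ∧ f j

Same : ℕ → (f g : ℕ → Bool) → Set
Same m f g = ∀ j → j < m → f j ≡ g j

-- g is the successor of f, whose carries are k.
Succ : ℕ → (f k g : ℕ → Bool) → Set
Succ m f k g = ∀ j → j < m → g j ≡ f j xor k j

Zeros : ℕ → (ℕ → Bool) → Set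
Zeros m f = ∀ j → j < m → f j ≡ false

number-bound : ∀ m f → number m f < 2 ^ m
number-bound zero    f = s≤s z≤n
number-bound (suc m) f = +-mono-<-≤ (number-bound m f) (bit-bound (f m))
  where
  bit-bound : ∀ b → bit b * 2 ^ m ≤ 2 ^ m + 0
  bit-bound true  = ≤-refl
  bit-bound false = z≤n

number-same : ∀ m {f g} → Same m f g → number m f ≡ number m g
number-same zero    eq = refl
number-same (suc m) eq =
  cong₂ (λ n b → n + bit b * 2 ^ m) (number-same m λ j lt → eq j (m<n⇒m<1+n lt)) (eq m ≤-refl)

-- If the top bits differ, one number is at least `2 ^ m` and the other is below it; otherwise the
-- top bits cancel.
number-injective : ∀ m {f g} → number m f ≡ number m g → Same m f g
number-injective (suc m) {f} {g} eq j j<m with f m in fm | g m in gm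
... | true  | false = contradiction (number-bound m g) (≤⇒≯ (≤-trans (≤-trans (m≤m+n (2 ^ m) 0) (m≤n+m _ (number m f)))
  (≤-reflexive (trans eq (+-identityʳ _)))))
... | false | true  = contradiction (number-bound m f) (≤⇒≯ (≤-trans (≤-trans (m≤m+n (2 ^ m) 0) (m≤n+m _ (number m g)))
  (≤-reflexive (trans (sym eq) (+-identityʳ _)))))
... | true  | true  with m≤n⇒m<n∨m≡n (s≤s⁻¹ j<m)
...   | inj₁ lt   = number-injective m (+-cancelʳ-≡ _ _ _ eq) j lt
...   | inj₂ refl = trans fm (sym gm)
number-injective (suc m) {f} {g} eq j j<m | false | false with m≤n⇒m<n∨m≡n (s≤s⁻¹ j<m)
...   | inj₁ lt   = number-injective m (+-cancelʳ-≡ _ _ _ eq) j lt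
...   | inj₂ refl = trans fm (sym gm)

number-zeros : ∀ m {f} → Zeros m f → number m f ≡ 0
number-zeros m eq = trans (number-same m eq) (zeros m)
  where
  zeros : ∀ m → number m (λ _ → false) ≡ 0
  zeros zero    = refl
  zeros (suc m) = trans (+-identityʳ _) (zeros m)

zeros-number : ∀ m {f} → number m f ≡ 0 → Zeros m f
zeros-number m eq = number-injective m (trans eq (sym (number-zeros m {λ _ → false} λ _ _ → refl)))

number-succ : ∀ m {f k g} → Carries m f k → Succ m f k g →
  number m g + bit (k m) * 2 ^ m ≡ suc (number m f)
number-succ zero    (carries k0 _) eq rewrite k0 = refl
number-succ (suc m) {f} {k} {g} (carries k0 kn) eq
  with number-succ m {f} {k} {g} (carries k0 λ j lt → kn j (m<n⇒m<1+n lt)) (λ j lt → eq j (m<n⇒m<1+n lt))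
... | ih rewrite kn m ≤-refl | eq m ≤-refl with f m | k m
... | true  | true  = trans (cong₂ _+_ (+-identityʳ (number m g)) (shift (2 ^ m))) (trans (sym (+-assoc (number m g) (2 ^ m + 0) (2 ^ m + 0))) (cong (_+ (2 ^ m + 0)) ih))
  where
  shift : ∀ p → p + (p + 0) + 0 ≡ p + 0 + (p + 0)
  shift p = trans (+-identityʳ _) (cong (_+ (p + 0)) (sym (+-identityʳ p)))
... | true  | false = trans (+-identityʳ _) (cong (_+ (2 ^ m + 0)) (trans (sym (+-identityʳ _)) ih))
... | false | true  = trans (+-identityʳ _) (trans ih (sym (+-identityʳ _)))
... | false | false = trans (+-identityʳ _) (trans ih (sym (+-identityʳ _)))

carry : (ℕ → Bool) → ℕ → Bool
carry f zero    = true
carry f (suc j) = carry f j ∧ f j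

-- Because the word is built by iterated increment, consecutive words satisfy `Succ` by `refl`.
word : ℕ → ℕ → Bool
word zero    j = false
word (suc h) j = word h j xor carry (word h) j

number-word : ∀ m h → h < 2 ^ m → number m (word h) ≡ h
number-word m zero    lt = number-zeros m λ _ _ → refl
number-word m (suc h) lt
  with carry (word h) m | number-succ m {word h} {carry (word h)} {word (suc h)} (carries refl λ _ _ → refl) (λ _ _ → refl)
... | false | eq = trans (sym (+-identityʳ _)) (trans eq (cong suc (number-word m h (<-trans (n<1+n h) lt))))
... | true  | eq = contradiction lt (≤⇒≯ (≤-trans (≤-trans (m≤m+n (2 ^ m) 0) (m≤n+m _ (number m (word (suc h)))))
  (≤-reflexive (trans eq (cong suc (number-word m h (<-trans (n<1+n h) lt)))))))

-- The reduction

iff-true : ∀ {b} → T b ⇔ (b ≡ true)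
iff-true = mk⇔ (λ { t → go t }) (λ { refl → tt })
  where
  go : ∀ {b} → T b → b ≡ true
  go {true} _ = refl

-- The leading digits keep three families of letters apart: those coding moments begin with `false`,
-- bits with `true , false` and carries with `true , true`.
bitTag carryTag : List Bool
bitTag   = true ∷ false ∷ []
carryTag = true ∷ true ∷ []

recordLetter : ℕ → List Bool
recordLetter i = false ∷ replicate i true

-- The direction describes the left endpoint, the later one in time: it is one above the right
-- endpoint in `upBody` and one below it in `downBody`.
sameBody upBody downBody zeroBody carryBody : Scheme Indexed
sameBody  = atLeft (leaf (cur bitTag)) iff′ atRight (leaf (cur bitTag))
upBody    = atLeft (leaf (cur bitTag)) iff′ (atRight (leaf (cur bitTag)) xor′ atRight (leaf (cur carryTag)))
downBody  = atRight (leaf (cur bitTag)) iff′ (atLeft (leaf (cur bitTag)) xor′ atLeft (leaf (cur carryTag)))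
zeroBody  = atRight (leaf (cur bitTag)) iff′ falsity′
carryBody = atRight (leaf (next carryTag)) iff′
  (atRight (leaf (cur carryTag)) and′ atRight (leaf (cur bitTag)))

sameHead : Scheme Top
sameHead = proper′ and′ leaf (forall′ sameBody)

guard : ∀ {X} → Bool → Scheme X
guard true  = truth′
guard false = falsity′

module Reduction {s : ℕ} (D : Decider s) where

  open Decider D

  _≟ᶜ_ : DecidableEquality (Maybe Γ)
  _≟ᶜ_ = ≡-decᵐ (≡-decˢ Fin._≟_ Fin._≟_)

  -- A point of the model is a moment of the computation, or it provides the
  -- initial contents of a cell.
  Moment : Set
  Moment = (State × Maybe Γ) ⊎ Maybe (Fin s)

  pattern running q a = inj₁ (q , a)
  pattern providing a = inj₂ a

  moments : Finite Moment
  moments = sum-finite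
    (product-finite (fin-finite states) (maybe-finite (sum-finite (fin-finite s) (fin-finite aux))))
    (maybe-finite (fin-finite s))

  written : Moment → Maybe Γ
  written (running q a) = proj₁ (proj₂ (δ q a))
  written (providing a) = Maybe.map inj₁ a

  -- The constraints on the head positions of two adjacent points. The pair of their moments selects
  -- one of them, so the case distinction is finite and depends on the decider alone. `back`
  -- includes the left move that is stopped at cell 0.
  data Kind : Set where
    never same up back filled begin : Kind

  moveKind : Move → Kind
  moveKind left  = back
  moveKind stay  = same
  moveKind right = up

  stepKind : State → Maybe Bool → State × Maybe Γ × Move → Kind
  stepKind q′ (just _) _            = never
  stepKind q′ nothing  (q″ , _ , m) = if does (q′ Fin.≟ q″) then moveKind m else never

  -- The order of the points reverses time: the second argument comes first.
  kind : Maybe Moment → Maybe Moment → Kind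
  kind (just (running q′ _))       (just (running q a)) = stepKind q′ (verdict q) (δ q a)
  kind (just (running q _))        (just (providing _)) = if does (q Fin.≟ start) then begin else never
  kind (just (providing (just _))) (just (providing _)) = filled
  kind _                           _                    = never

  compatible : Maybe Moment → Maybe Moment → Bool
  compatible (just (running q a)) (just r) = does (a ≟ᶜ written r)
  compatible _                    _        = true

  readsBlank : Maybe Moment → Bool
  readsBlank (just (running q a)) = does (a ≟ᶜ nothing)
  readsBlank _                    = true

  provides : Maybe (Fin s) → Maybe Moment → Bool
  provides a (just (providing a′)) = does (≡-decᵐ Fin._≟_ a a′)
  provides a _                     = false

  isRunning : Maybe Moment → Bool
  isRunning (just (running _ _)) = true
  isRunning _                    = false

  isAccepting : Maybe Bool → Bool
  isAccepting (just b) = b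
  isAccepting nothing  = false

  accepts : Maybe Moment → Bool
  accepts (just (running q _)) = isAccepting (verdict q)
  accepts _                    = false

  K : ℕ
  K = Finite.card moments

  leftMoment rightMoment : ∀ {X} → (Maybe Moment → Scheme X) → Scheme X
  leftMoment F  = choose (atLeft ∘ lit ∘ recordLetter) K (F ∘ decode moments)
  rightMoment F = choose (atRight ∘ lit ∘ recordLetter) K (F ∘ decode moments)

  kindScheme : Kind → Scheme Top
  kindScheme never  = falsity′
  kindScheme same   = leaf (forall′ sameBody)
  kindScheme up     = leaf (forall′ upBody)
  kindScheme back   = (leaf (forall′ zeroBody) and′ leaf (forall′ sameBody)) or′
                      (neg′ (leaf (forall′ zeroBody)) and′ leaf (forall′ downBody))
  kindScheme filled = leaf (forall′ downBody)
  kindScheme begin  = leaf (forall′ sameBody) and′ leaf (forall′ zeroBody)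

  carryScheme stepScheme memoryScheme blankScheme acceptScheme chainScheme localScheme scheme : Scheme Top
  carryScheme  = atRight (leaf (outer (cur carryTag))) and′ leaf (forall′ carryBody)
  stepScheme   = unit′ imp′ leftMoment λ r → rightMoment λ r′ → kindScheme (kind r r′)
  -- ⟨B⟩ makes y the first point after x with the head in the same cell.
  memoryScheme = (sameHead and′ neg′ (B′ sameHead)) imp′
    leftMoment λ r → rightMoment λ r′ → guard (compatible r r′)
  blankScheme  = neg′ (A′ sameHead) imp′ rightMoment λ r → guard (readsBlank r)
  acceptScheme = leftMoment λ r → guard (accepts r)
  -- The unit interval straddles the starting time: its left end is still running, and the provision
  -- of cell 0 begins at its right end.
  chainScheme  = unit′ and′ (leftMoment (λ r → guard (isRunning r)) and′ A′ (leaf chain))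
  localScheme  = carryScheme and′ (stepScheme and′ (memoryScheme and′ blankScheme))
  scheme       = acceptScheme and′ (everywhere localScheme and′ B′ (A′ chainScheme))

  -- Leaves are drawn from the empty type, hence this formula does not vary with the width.
  provision : Maybe (Fin s) → Formula
  provision a = ⟦ point′ and′ rightMoment (λ r → guard (provides a r)) ⟧ (⊥-elim {Whatever = Formula})

  -- `⟨A⟩` with a unit interval and `⟨A⟩` again lead to the next point. The continuation `φ` comes
  -- last in the encoding, which permits printing the chain in one scan of the input.
  link : Fin s → Formula → Formula
  link a φ = provision (just a) and ⟨A⟩ (unit-formula and ⟨A⟩ φ)

  linkPrefix : Fin s → List Symbol
  linkPrefix a = `¬ ∷ `∨ ∷ `¬ ∷ encode (provision (just a)) ++
    `¬ ∷ `A ∷ `¬ ∷ `∨ ∷ `¬ ∷ encode unit-formula ++ `¬ ∷ `A ∷ []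

  encode-link : ∀ a φ → encode (link a φ) ≡ linkPrefix a ++ encode φ
  encode-link a φ = cong (λ x → `¬ ∷ `∨ ∷ `¬ ∷ x)
    (sym (++-assoc (encode (provision (just a)))
      (`¬ ∷ `A ∷ `¬ ∷ `∨ ∷ `¬ ∷ encode unit-formula ++ `¬ ∷ `A ∷ []) (encode φ)))

  open Chains link (provision nothing)

  formula : ℕ → List (Fin s) → Formula
  formula W w = ⟦ scheme ⟧ (top W w)

  module _ (W : ℕ) where

    m = 2 ^ W

    record Labels : Set where
      field
        moment : ℕ → Maybe Moment
        bits   : ℕ → ℕ → Bool
        carry′ : ℕ → ℕ → Bool

    module Validity (N : ℕ) (L : Labels) where

      open Labels L

      KindHolds : Kind → ℕ → ℕ → Set
      KindHolds never  x y = ⊥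
      KindHolds same   x y = Same m (bits x) (bits y)
      KindHolds up     x y = Succ m (bits y) (carry′ y) (bits x)
      KindHolds back   x y = (Zeros m (bits y) × Same m (bits x) (bits y)) ⊎
                             (¬ Zeros m (bits y) × Succ m (bits x) (carry′ x) (bits y))
      KindHolds filled x y = Succ m (bits x) (carry′ x) (bits y)
      KindHolds begin  x y = Same m (bits x) (bits y) × Zeros m (bits y)

      -- As labels beyond `N` are clamped rather than absent, the last provision records the bound,
      -- and the earlier bounds follow from it.
      Provided : ℕ → List (Fin s) → Set
      Provided z []      = z ≤ N × T (provides nothing (moment z))
      Provided z (a ∷ w) = T (provides (just a) (moment z)) × Provided (suc z) w

      provided-bound : ∀ {z} w → Provided z w → z ≤ N
      provided-bound []      = proj₁
      provided-bound (a ∷ w) = <⇒≤ ∘ provided-bound w ∘ proj₂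

      -- What the formula says about the labels of points. Both directions of the reduction argue
      -- from this record and leave the semantics of intervals behind.
      record Valid (w : List (Fin s)) : Set where
        field
          accepting : T (accepts (moment 0))
          carrying  : ∀ {z} → z ≤ N → Carries m (bits z) (carry′ z)
          stepping  : ∀ {x} → x < N → KindHolds (kind (moment x) (moment (suc x))) x (suc x)
          reading   : ∀ {x y} → x < y → y ≤ N → Same m (bits x) (bits y) →
            (∀ {y′} → x < y′ → y′ < y → ¬ Same m (bits x) (bits y′)) → T (compatible (moment x) (moment y))
          blank     : ∀ {y} → y ≤ N → (∀ {y′} → y < y′ → y′ ≤ N → ¬ Same m (bits y) (bits y′)) →
            T (readsBlank (moment y))
          starting  : ∃[ x ] (T (isRunning (moment x)) × Provided (suc x) w)

    module _ (M : Model) where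

      open Model M
      open Semantics M

      labels : Labels
      labels = record
        { moment = λ z → decode moments (vecOf (λ i → value-at z (letter (recordLetter i))) K)
        ; bits   = λ z i → value-at z (letter (bitTag ++ numeral (suc W) i))
        ; carry′ = λ z i → value-at z (letter (carryTag ++ numeral (suc W) i))
        }

      open Labels labels
      open Validity N labels

      module _ {I : Interval N} {X : Set} {ρ : X → Formula} where

        ⊨guard : ∀ b → (M , I ⊨ ⟦ guard b ⟧ ρ) ⇔ T b
        ⊨guard true  = mk⇔ (λ _ → tt) (λ _ → ⊨truth)
        ⊨guard false = mk⇔ (λ h → h ⊨truth) λ ()

      ⊨forall : ∀ {I} φ → (M , I ⊨ conj 0 m (λ i → ⟦ φ ⟧ (indexed W i))) ⇔
        (∀ j → j < m → M , I ⊨ ⟦ φ ⟧ (indexed W j))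
      ⊨forall φ = mk⇔ (λ h j → to (⊨conj 0 m (λ i → ⟦ φ ⟧ (indexed W i))) h j z≤n)
        (λ h → from (⊨conj 0 m (λ i → ⟦ φ ⟧ (indexed W i))) λ j _ → h j)

      ∀-⇔ : ∀ {A B : ℕ → Set} → (∀ j → A j ⇔ B j) → (∀ j → j < m → A j) ⇔ (∀ j → j < m → B j)
      ∀-⇔ e = mk⇔ (λ h j lt → to (e j) (h j lt)) (λ h j lt → from (e j) (h j lt))

      _∙_ : ∀ {A B C : Set} → A ⇔ B → B ⇔ C → A ⇔ C
      e ∙ f = mk⇔ (to f ∘ to e) (from e ∘ from f)

      module _ {x y} (x≤y : x ≤ y) (y≤N : y ≤ N) where

        private
          I = interval x y x≤y y≤N

        right-cur : ∀ t i → (M , I ⊨ ⟦ atRight (leaf (cur t)) ⟧ (indexed W i)) ⇔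
          T (value-at y (letter (t ++ numeral (suc W) i)))
        right-cur t i = ⊨right x≤y y≤N (letter (t ++ numeral (suc W) i))

        right-next : ∀ t i → (M , I ⊨ ⟦ atRight (leaf (next t)) ⟧ (indexed W i)) ⇔
          T (value-at y (letter (t ++ numeral (suc W) (suc i))))
        right-next t i = ⊨right x≤y y≤N (letter (t ++ numeral (suc W) (suc i)))

        ⊨rightMoment : ∀ {X} {ρ : X → Formula} F →
          (M , I ⊨ ⟦ rightMoment F ⟧ ρ) ⇔ (M , I ⊨ ⟦ F (moment y) ⟧ ρ)
        ⊨rightMoment F = ⊨choose {I} {l = atRight ∘ lit ∘ recordLetter}
          (λ i → ⊨right x≤y y≤N (letter (recordLetter i))) K (F ∘ decode moments)

        ⊨zero : (M , I ⊨ conj 0 m (λ i → ⟦ zeroBody ⟧ (indexed W i))) ⇔ Zeros m (bits y)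
        ⊨zero = ⊨forall {I} zeroBody ∙ ∀-⇔ λ j →
          ⊨iff {I} {ρ = indexed W j} (atRight (leaf (cur bitTag))) falsity′ (right-cur bitTag j) (⊨guard {ρ = indexed W j} false)

        ⊨carries : ∀ w → (M , I ⊨ ⟦ carryScheme ⟧ (top W w)) ⇔ Carries m (bits y) (carry′ y)
        ⊨carries w = ⊨and′ {I} {ρ = top W w} (atRight (leaf (outer (cur carryTag)))) (leaf (forall′ carryBody)) ∙
          mk⇔ (λ (p , q) → carries (to iff-true (to (right-cur carryTag 0) p)) (to rest q))
              (λ (carries p q) → from (right-cur carryTag 0) (from iff-true p) , from rest q)
          where
          rest = ⊨forall {I} carryBody ∙ ∀-⇔ λ j →
            ⊨iff {I} {ρ = indexed W j} (atRight (leaf (next carryTag))) (atRight (leaf (cur carryTag)) and′ atRight (leaf (cur bitTag)))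
              (right-next carryTag j)
              (⊨and-bool {I} {ρ = indexed W j} (atRight (leaf (cur carryTag))) (atRight (leaf (cur bitTag)))
                (right-cur carryTag j) (right-cur bitTag j))

        module _ (x<y : x < y) where

          left-cur : ∀ t i → (M , I ⊨ ⟦ atLeft (leaf (cur t)) ⟧ (indexed W i)) ⇔
            T (value-at x (letter (t ++ numeral (suc W) i)))
          left-cur t i = ⊨left x≤y y≤N (letter (t ++ numeral (suc W) i)) x<y

          ⊨leftMoment : ∀ {X} {ρ : X → Formula} F →
            (M , I ⊨ ⟦ leftMoment F ⟧ ρ) ⇔ (M , I ⊨ ⟦ F (moment x) ⟧ ρ)
          ⊨leftMoment F = ⊨choose {I} {l = atLeft ∘ lit ∘ recordLetter}
            (λ i → ⊨left x≤y y≤N (letter (recordLetter i)) x<y) K (F ∘ decode moments)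

          ⊨same : (M , I ⊨ conj 0 m (λ i → ⟦ sameBody ⟧ (indexed W i))) ⇔ Same m (bits x) (bits y)
          ⊨same = ⊨forall {I} sameBody ∙ ∀-⇔ λ j →
            ⊨iff {I} {ρ = indexed W j} (atLeft (leaf (cur bitTag))) (atRight (leaf (cur bitTag))) (left-cur bitTag j) (right-cur bitTag j)

          ⊨up : (M , I ⊨ conj 0 m (λ i → ⟦ upBody ⟧ (indexed W i))) ⇔ Succ m (bits y) (carry′ y) (bits x)
          ⊨up = ⊨forall {I} upBody ∙ ∀-⇔ λ j →
            ⊨iff {I} {ρ = indexed W j} (atLeft (leaf (cur bitTag))) (atRight (leaf (cur bitTag)) xor′ atRight (leaf (cur carryTag)))
              (left-cur bitTag j)
              (⊨xor {I} {ρ = indexed W j} (atRight (leaf (cur bitTag))) (atRight (leaf (cur carryTag))) (right-cur bitTag j) (right-cur carryTag j))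

          ⊨down : (M , I ⊨ conj 0 m (λ i → ⟦ downBody ⟧ (indexed W i))) ⇔ Succ m (bits x) (carry′ x) (bits y)
          ⊨down = ⊨forall {I} downBody ∙ ∀-⇔ λ j →
            ⊨iff {I} {ρ = indexed W j} (atRight (leaf (cur bitTag))) (atLeft (leaf (cur bitTag)) xor′ atLeft (leaf (cur carryTag)))
              (right-cur bitTag j)
              (⊨xor {I} {ρ = indexed W j} (atLeft (leaf (cur bitTag))) (atLeft (leaf (cur carryTag))) (left-cur bitTag j) (left-cur carryTag j))

          ⊨kind : ∀ w k → (M , I ⊨ ⟦ kindScheme k ⟧ (top W w)) ⇔ KindHolds k x y
          ⊨kind w never  = ⊨guard {ρ = top W w} false
          ⊨kind w same   = ⊨same
          ⊨kind w up     = ⊨up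
          ⊨kind w back   = mk⇔
            (λ { (inj₁ h) → let p , q = to a h in inj₁ (to ⊨zero p , to ⊨same q)
               ; (inj₂ h) → let p , q = to b h in inj₂ (p ∘ from ⊨zero , to ⊨down q) })
            (λ { (inj₁ (p , q)) → inj₁ (from a (from ⊨zero p , from ⊨same q))
               ; (inj₂ (p , q)) → inj₂ (from b (p ∘ to ⊨zero , from ⊨down q)) })
            where
            a = ⊨and′ {I} {ρ = top W w} (leaf (forall′ zeroBody)) (leaf (forall′ sameBody))
            b = ⊨and′ {I} {ρ = top W w} (neg′ (leaf (forall′ zeroBody))) (leaf (forall′ downBody))
          ⊨kind w filled = ⊨down
          ⊨kind w begin  = ⊨and′ {I} {ρ = top W w} (leaf (forall′ sameBody)) (leaf (forall′ zeroBody)) ∙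
            mk⇔ (λ (p , q) → to ⊨same p , to ⊨zero q) (λ (p , q) → from ⊨same p , from ⊨zero q)

        ⊨sameHead : ∀ w → (M , I ⊨ ⟦ sameHead ⟧ (top W w)) ⇔ (x < y × Same m (bits x) (bits y))
        ⊨sameHead w = ⊨and′ {I} {ρ = top W w} proper′ (leaf (forall′ sameBody)) ∙
          mk⇔ (λ (p , q) → let lt = to (⊨proper x≤y y≤N) p in lt , to (⊨same lt) q)
              (λ (lt , q) → from (⊨proper x≤y y≤N) lt , from (⊨same lt) q)

        ⊨step : ∀ w → (M , I ⊨ ⟦ stepScheme ⟧ (top W w)) ⇔
          (y ≡ suc x → KindHolds (kind (moment x) (moment y)) x y)
        ⊨step w = ⊨imp {I} unit-formula (⟦ body ⟧ (top W w)) ∙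
          mk⇔ (λ h eq → let lt = ≤-reflexive (sym eq) in to (inner lt) (h (from (⊨unit x≤y y≤N) eq)))
              (λ h u → let eq = to (⊨unit x≤y y≤N) u ; lt = ≤-reflexive (sym eq) in from (inner lt) (h eq))
          where
          body : Scheme Top
          body = leftMoment λ r → rightMoment λ r′ → kindScheme (kind r r′)
          inner : x < y → (M , I ⊨ ⟦ body ⟧ (top W w)) ⇔ KindHolds (kind (moment x) (moment y)) x y
          inner lt = ⊨leftMoment lt (λ r → rightMoment λ r′ → kindScheme (kind r r′)) ∙
            (⊨rightMoment (λ r′ → kindScheme (kind (moment x) r′)) ∙ ⊨kind lt w (kind (moment x) (moment y)))

      module _ {x y} (x≤y : x ≤ y) (y≤N : y ≤ N) where

        private
          I = interval x y x≤y y≤N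

        ⊨memory : ∀ w → (M , I ⊨ ⟦ memoryScheme ⟧ (top W w)) ⇔
          (x < y → Same m (bits x) (bits y) →
            (∀ {y′} → x < y′ → y′ < y → ¬ Same m (bits x) (bits y′)) → T (compatible (moment x) (moment y)))
        ⊨memory w = ⊨imp {I} (⟦ sameHead and′ neg′ (B′ sameHead) ⟧ (top W w)) (⟦ body ⟧ (top W w)) ∙ mk⇔ forth back′
          where
          body : Scheme Top
          body = leftMoment λ r → rightMoment λ r′ → guard (compatible r r′)
          inner : x < y → (M , I ⊨ ⟦ body ⟧ (top W w)) ⇔ T (compatible (moment x) (moment y))
          inner lt = ⊨leftMoment x≤y y≤N lt (λ r → rightMoment λ r′ → guard (compatible r r′)) ∙
            (⊨rightMoment x≤y y≤N (λ r′ → guard (compatible (moment x) r′)) ∙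
             ⊨guard {ρ = top W w} (compatible (moment x) (moment y)))
          both = ⊨and′ {I} {ρ = top W w} sameHead (neg′ (B′ sameHead))
          Fresh = ∀ {y′} → x < y′ → y′ < y → ¬ Same m (bits x) (bits y′)
          head⇔ : ∀ {y′} (x≤y′ : x ≤ y′) (y′≤N : y′ ≤ N) →
            (M , interval x y′ x≤y′ y′≤N ⊨ ⟦ sameHead ⟧ (top W w)) ⇔ (x < y′ × Same m (bits x) (bits y′))
          head⇔ x≤y′ y′≤N = ⊨sameHead x≤y′ y′≤N w
          forth : (M , I ⊨ ⟦ sameHead and′ neg′ (B′ sameHead) ⟧ (top W w) → M , I ⊨ ⟦ body ⟧ (top W w)) →
            x < y → Same m (bits x) (bits y) → Fresh → T (compatible (moment x) (moment y))
          forth h lt eq fresh = to (inner lt) (h (from both (from (head⇔ x≤y y≤N) (lt , eq) ,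
            λ (y′ , x≤y′ , y′<y , h′) → let lt′ , eq′ = to (head⇔ x≤y′ (≤-trans (<⇒≤ y′<y) y≤N)) h′
                                        in fresh lt′ y′<y eq′)))
          back′ : (x < y → Same m (bits x) (bits y) → Fresh → T (compatible (moment x) (moment y))) →
            M , I ⊨ ⟦ sameHead and′ neg′ (B′ sameHead) ⟧ (top W w) → M , I ⊨ ⟦ body ⟧ (top W w)
          back′ h p = let q , r = to both p ; lt , eq = to (head⇔ x≤y y≤N) q in
            from (inner lt) (h lt eq λ {y′} lt′ y′<y eq′ → r
              (y′ , <⇒≤ lt′ , y′<y , from (head⇔ (<⇒≤ lt′) (≤-trans (<⇒≤ y′<y) y≤N)) (lt′ , eq′)))

        ⊨blank : ∀ w → (M , I ⊨ ⟦ blankScheme ⟧ (top W w)) ⇔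
          ((∀ {y′} → y < y′ → y′ ≤ N → ¬ Same m (bits y) (bits y′)) → T (readsBlank (moment y)))
        ⊨blank w = ⊨imp {I} (⟦ neg′ (A′ sameHead) ⟧ (top W w)) (⟦ body ⟧ (top W w)) ∙ mk⇔ forth back′
          where
          body : Scheme Top
          body = rightMoment λ r → guard (readsBlank r)
          inner : (M , I ⊨ ⟦ body ⟧ (top W w)) ⇔ T (readsBlank (moment y))
          inner = ⊨rightMoment x≤y y≤N (λ r → guard (readsBlank r)) ∙ ⊨guard {ρ = top W w} (readsBlank (moment y))
          Fresh = ∀ {y′} → y < y′ → y′ ≤ N → ¬ Same m (bits y) (bits y′)
          forth : (M , I ⊨ ⟦ neg′ (A′ sameHead) ⟧ (top W w) → M , I ⊨ ⟦ body ⟧ (top W w)) →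
            Fresh → T (readsBlank (moment y))
          forth h fresh = to inner (h λ (y′ , y≤y′ , y′≤N , h′) →
            let lt , eq = to (⊨sameHead y≤y′ y′≤N w) h′ in fresh lt y′≤N eq)
          back′ : (Fresh → T (readsBlank (moment y))) →
            M , I ⊨ ⟦ neg′ (A′ sameHead) ⟧ (top W w) → M , I ⊨ ⟦ body ⟧ (top W w)
          back′ h p = from inner (h λ {y′} lt y′≤N eq → p
            (y′ , <⇒≤ lt , y′≤N , from (⊨sameHead (<⇒≤ lt) y′≤N w) (lt , eq)))

        ⊨local : ∀ w → (M , I ⊨ ⟦ localScheme ⟧ (top W w)) ⇔
          ((M , I ⊨ ⟦ carryScheme ⟧ (top W w)) × (M , I ⊨ ⟦ stepScheme ⟧ (top W w)) ×
           (M , I ⊨ ⟦ memoryScheme ⟧ (top W w)) × (M , I ⊨ ⟦ blankScheme ⟧ (top W w)))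
        ⊨local w = mk⇔
          (λ h → let p , h₁ = to a h ; q , h₂ = to b h₁ ; r , t = to c h₂ in p , q , r , t)
          (λ (p , q , r , t) → from a (p , from b (q , from c (r , t))))
          where
          a = ⊨and′ {I} {ρ = top W w} carryScheme (stepScheme and′ (memoryScheme and′ blankScheme))
          b = ⊨and′ {I} {ρ = top W w} stepScheme (memoryScheme and′ blankScheme)
          c = ⊨and′ {I} {ρ = top W w} memoryScheme blankScheme

        ⊨provision : ∀ a → (M , I ⊨ provision a) ⇔ (y ≡ x × T (provides a (moment y)))
        ⊨provision a = ⊨and′ {I} {ρ = ⊥-elim} point′ body ∙
          mk⇔ (λ (p , q) → to (⊨point x≤y y≤N) p , to inner q)
              (λ (p , q) → from (⊨point x≤y y≤N) p , from inner q)
          where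
          body : Scheme ⊥
          body = rightMoment λ r → guard (provides a r)
          inner : (M , I ⊨ ⟦ body ⟧ ⊥-elim) ⇔ T (provides a (moment y))
          inner = ⊨rightMoment x≤y y≤N (λ r → guard (provides a r)) ∙ ⊨guard {ρ = ⊥-elim} (provides a (moment y))

      ⊨chained : ∀ w {z z′} (z≤z′ : z ≤ z′) (z′≤N : z′ ≤ N) →
        (M , interval z z′ z≤z′ z′≤N ⊨ chained w) ⇔ (z′ ≡ z × Provided z w)
      ⊨chained [] z≤z′ z′≤N = ⊨provision z≤z′ z′≤N nothing ∙
        mk⇔ (λ { (refl , p) → refl , z′≤N , p }) (λ { (refl , _ , p) → refl , p })
      ⊨chained (a ∷ w) {z} {z′} z≤z′ z′≤N = both ∙ mk⇔ forth back′
        where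
        I    = interval z z′ z≤z′ z′≤N
        rest = ⟨A⟩ (unit-formula and ⟨A⟩ (chained w))
        both = ⊨and {I} (provision (just a)) rest
        both′ : ∀ {y} (z′≤y : z′ ≤ y) (y≤N : y ≤ N) → _
        both′ {y} z′≤y y≤N = ⊨and {interval z′ y z′≤y y≤N} unit-formula (⟨A⟩ (chained w))
        forth : ((M , I ⊨ provision (just a)) × (M , I ⊨ rest)) → z′ ≡ z × Provided z (a ∷ w)
        forth (p , y , z′≤y , y≤N , h) with to (⊨provision z≤z′ z′≤N (just a)) p | to (both′ z′≤y y≤N) h
        ... | refl , q | u , y′ , y≤y′ , y′≤N , h′ with to (⊨unit z′≤y y≤N) u
        ... | refl = refl , q , proj₂ (to (⊨chained w y≤y′ y′≤N) h′)
        back′ : z′ ≡ z × Provided z (a ∷ w) → (M , I ⊨ provision (just a)) × (M , I ⊨ rest)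
        back′ (refl , q , ps) = from (⊨provision z≤z′ z′≤N (just a)) (refl , q) ,
          suc z , n≤1+n z , lt , from (both′ (n≤1+n z) lt)
            (from (⊨unit (n≤1+n z) lt) refl , suc z , ≤-refl , lt , from (⊨chained w ≤-refl lt) (refl , ps))
          where
          lt = provided-bound w ps

      whole : Interval N
      whole = interval 0 N z≤n ≤-refl

      StartsAt : ℕ → List (Fin s) → Set
      StartsAt x w = T (isRunning (moment x)) × Provided (suc x) w

      ⊨start : ∀ w {x y} (x≤y : x ≤ y) (y≤N : y ≤ N) →
        (M , interval x y x≤y y≤N ⊨ ⟦ chainScheme ⟧ (top W w)) ⇔ (y ≡ suc x × StartsAt x w)
      ⊨start w {x} {y} x≤y y≤N = mk⇔ forth back′
        where
        I = interval x y x≤y y≤N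
        runs = leftMoment (λ r → guard (isRunning r))
        both = ⊨and′ {I} {ρ = top W w} unit′ (runs and′ A′ (leaf chain))
        both′ = ⊨and′ {I} {ρ = top W w} runs (A′ (leaf chain))
        run⇔ : x < y → (M , I ⊨ ⟦ runs ⟧ (top W w)) ⇔ T (isRunning (moment x))
        run⇔ lt = ⊨leftMoment x≤y y≤N lt (λ r → guard (isRunning r)) ∙ ⊨guard {ρ = top W w} (isRunning (moment x))
        forth : M , I ⊨ ⟦ chainScheme ⟧ (top W w) → y ≡ suc x × StartsAt x w
        forth h with to both h
        ... | u , h₁ with to both′ h₁
        ... | r , y′ , y≤y′ , y′≤N , c with to (⊨unit x≤y y≤N) u
        ... | refl = refl , to (run⇔ ≤-refl) r , proj₂ (to (⊨chained w y≤y′ y′≤N) c)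
        back′ : y ≡ suc x × StartsAt x w → M , I ⊨ ⟦ chainScheme ⟧ (top W w)
        back′ (refl , r , ps) = from both (from (⊨unit x≤y y≤N) refl , from both′
          (from (run⇔ ≤-refl) r , suc x , ≤-refl , y≤N , from (⊨chained w ≤-refl y≤N) (refl , ps)))

      satisfied⇔valid : ∀ w → (M , whole ⊨ formula W w) ⇔ Valid w
      satisfied⇔valid w = mk⇔ forth back′
        where
        ρ = top W w
        both = ⊨and′ {whole} {ρ = ρ} acceptScheme (everywhere localScheme and′ B′ (A′ chainScheme))
        both′ = ⊨and′ {whole} {ρ = ρ} (everywhere localScheme) (B′ (A′ chainScheme))
        accept⇔ : 0 < N → (M , whole ⊨ ⟦ acceptScheme ⟧ ρ) ⇔ T (accepts (moment 0))
        accept⇔ lt = ⊨leftMoment z≤n ≤-refl lt (λ r → guard (accepts r)) ∙ ⊨guard {ρ = ρ} (accepts (moment 0))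
        forth : M , whole ⊨ formula W w → Valid w
        forth h with to both h
        ... | acc , h₁ with to both′ h₁
        ... | loc , x , _ , x<N , y , x≤y , y≤N , c with to (⊨start w x≤y y≤N) c
        ... | _ , starts = record
          -- A clause is read off at an interval that exposes it: `[0 , z]` if it concerns a right
          -- endpoint only, and otherwise the interval between the two points that it compares.
          { accepting = to (accept⇔ 0<N) acc
          ; carrying  = λ z≤N → to (⊨carries z≤n z≤N w) (proj₁ (local 0<N z≤n z≤N))
          ; stepping  = λ {x} x<N → to (⊨step (n≤1+n x) x<N w) (proj₁ (proj₂ (local x<N (n≤1+n x) x<N))) refl
          ; reading   = λ x<y y≤N → to (⊨memory (<⇒≤ x<y) y≤N w)
              (proj₁ (proj₂ (proj₂ (local (≤-trans x<y y≤N) (<⇒≤ x<y) y≤N)))) x<y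
          ; blank     = λ y≤N → to (⊨blank z≤n y≤N w) (proj₂ (proj₂ (proj₂ (local 0<N z≤n y≤N))))
          ; starting  = x , starts
          }
          where
          -- The chain guarantees a second point. Without one, `everywhere` would be vacuous and the
          -- left endpoint of the whole interval unreadable.
          0<N = ≤-trans (s≤s z≤n) x<N
          local : ∀ {x y} → x < N → (x≤y : x ≤ y) (y≤N : y ≤ N) → _
          local x<N x≤y y≤N = to (⊨local x≤y y≤N w)
            (to (⊨everywhere (⟦ localScheme ⟧ ρ)) loc x<N x≤y y≤N)
        back′ : Valid w → M , whole ⊨ formula W w
        back′ v = from both (from (accept⇔ 0<N) accepting , from both′
          (from (⊨everywhere (⟦ localScheme ⟧ ρ)) (λ x<N x≤y y≤N → from (⊨local x≤y y≤N w)
             (from (⊨carries x≤y y≤N w) (carrying y≤N) ,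
              from (⊨step x≤y y≤N w) (λ { refl → stepping y≤N }) ,
              from (⊨memory x≤y y≤N w) (λ x<y → reading x<y y≤N) ,
              from (⊨blank x≤y y≤N w) (blank y≤N))) ,
           x , z≤n , x<N , suc x , n≤1+n x , x<N , from (⊨start w (n≤1+n x) x<N) (refl , proj₂ starting)))
          where
          open Valid v
          x   = proj₁ starting
          x<N = provided-bound w (proj₂ (proj₂ starting))
          0<N = ≤-trans (s≤s z≤n) x<N

-- From models to accepting runs

witness : ∀ {A : Set} (d : Dec A) → T (does d) → A
witness (yes a) _ = a

-- `Succ` is addition modulo `2 ^ m`. Wrapping around is excluded here by a bound, for moves to the
-- right and for the provisions, and in the next lemma by a nonzero result, for moves to the left.
number-succ-below : ∀ m {f k g} → Carries m f k → Succ m f k g → suc (number m f) < 2 ^ m →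
  number m g ≡ suc (number m f)
number-succ-below m {f} {k} {g} c sc lt with k m | number-succ m c sc
... | false | eq = trans (sym (+-identityʳ _)) eq
... | true  | eq = contradiction lt (≤⇒≯ (≤-trans (≤-trans (m≤m+n (2 ^ m) 0) (m≤n+m _ (number m g))) (≤-reflexive eq)))

number-succ-nonzero : ∀ m {f k g} → Carries m f k → Succ m f k g → number m g ≢ 0 →
  number m g ≡ suc (number m f)
number-succ-nonzero m {f} {k} {g} c sc ≢0 with k m | number-succ m c sc
... | false | eq = trans (sym (+-identityʳ _)) eq
-- With a carry out, the result plus `2 ^ m` equals a number of at most `2 ^ m`, so the result would
-- be 0.
... | true  | eq = contradiction (n≤0⇒n≡0 (+-cancelʳ-≤ (2 ^ m) (number m g) 0
  (≤-trans (≤-reflexive (trans (cong (number m g +_) (sym (+-identityʳ (2 ^ m)))) eq)) (number-bound m f)))) ≢0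

≡ᵇ-refl : ∀ n → (n ≡ᵇ n) ≡ true
≡ᵇ-refl zero    = refl
≡ᵇ-refl (suc n) = ≡ᵇ-refl n

≢⇒≡ᵇ : ∀ {m n} → m ≢ n → (m ≡ᵇ n) ≡ false
≢⇒≡ᵇ {m} {n} ne with m ≡ᵇ n in eq
... | false = refl
... | true  = contradiction (≡ᵇ⇒≡ m n (subst T (sym eq) tt)) ne

module Runs {s : ℕ} (D : Decider s) where

  open Decider D
  open DeciderRun D

  step-running : ∀ c {q b mv} → verdict (state c) ≡ nothing →
    δ (state c) (read (work c)) ≡ (q , b , mv) → step c ≡ config q (act (work c) (b , mv))
  step-running c eq eq′ with verdict (state c) | eq
  ... | nothing | refl rewrite eq′ = refl

  step-stopped : ∀ c {b} → verdict (state c) ≡ just b → step c ≡ c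
  step-stopped c eq with verdict (state c) | eq
  ... | just _ | refl = refl

  verdict-stable : ∀ w k t {b} → verdict (state (run w t)) ≡ just b →
    verdict (state (run w (k + t))) ≡ just b
  verdict-stable w zero    t eq = eq
  verdict-stable w (suc k) t eq =
    trans (cong (verdict ∘ state) (step-stopped (run w (k + t)) (verdict-stable w k t eq)))
          (verdict-stable w k t eq)

  verdict-unique : ∀ w t t′ {b b′} → verdict (state (run w t)) ≡ just b →
    verdict (state (run w t′)) ≡ just b′ → b ≡ b′
  verdict-unique w t t′ eq eq′ = just-injective (trans (sym (verdict-stable w t′ t eq))
    (trans (cong (λ u → verdict (state (run w u))) (+-comm t′ t)) (verdict-stable w t t′ eq′)))

module Memory {s : ℕ} (D : Decider s) (heads : ℕ → ℕ) (writes : ℕ → Maybe (Decider.Γ D)) where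

  -- The contents of cell j after the points beyond z, of which there are f.
  memory : ℕ → ℕ → ℕ → Maybe (Decider.Γ D)
  memory zero    z j = nothing
  memory (suc f) z j = if j ≡ᵇ heads (suc z) then writes (suc z) else memory f (suc z) j

  data Lookup (N z j : ℕ) (v : Maybe (Decider.Γ D)) : Set where
    untouched : (∀ {y} → z < y → y ≤ N → heads y ≢ j) → v ≡ nothing → Lookup N z j v
    touched   : ∀ y → z < y → y ≤ N → heads y ≡ j →
      (∀ {y′} → z < y′ → y′ < y → heads y′ ≢ j) → v ≡ writes y → Lookup N z j v

  beyond-next : ∀ {z j y} → (j ≡ᵇ heads (suc z)) ≡ false → z < y → (suc z < y → heads y ≢ j) → heads y ≢ j
  beyond-next {z} {j} miss z<y other with m≤n⇒m<n∨m≡n z<y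
  ... | inj₁ lt   = other lt
  ... | inj₂ refl = λ h → subst T miss (≡⇒≡ᵇ j (heads (suc z)) (sym h))

  -- The bridge between tape contents as computed recursively and the order-theoretic description by
  -- a first later point, which is what the formula can express.
  lookup-memory : ∀ {N} f z j → z + f ≡ N → Lookup N z j (memory f z j)
  lookup-memory zero z j eq = untouched
    (λ z<y y≤N _ → <-irrefl refl (≤-trans z<y (≤-trans y≤N (≤-reflexive (trans (sym eq) (+-identityʳ z)))))) refl
  lookup-memory {N} (suc f) z j eq with j ≡ᵇ heads (suc z) in hit
  ... | true = touched (suc z) ≤-refl
    (≤-trans (s≤s (m≤m+n z f)) (≤-reflexive (trans (sym (+-suc z f)) eq)))
    (sym (≡ᵇ⇒≡ j (heads (suc z)) (subst T (sym hit) tt)))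
    (λ z<y′ y′<sz _ → <-irrefl refl (≤-trans z<y′ (s≤s⁻¹ y′<sz))) refl
  ... | false with lookup-memory f (suc z) j (trans (sym (+-suc z f)) eq)
  ...   | untouched none v = untouched (λ z<y y≤N → beyond-next hit z<y (λ lt → none lt y≤N)) v
  ...   | touched y z<y y≤N h earlier v =
    touched y (<-trans (n<1+n z) z<y) y≤N h (λ z<y′ y′<y → beyond-next hit z<y′ (λ lt → earlier lt y′<y)) v

module Soundness {s : ℕ} (D : Decider s) (W : ℕ) where

  open Decider D
  open DeciderRun D
  open Runs D
  open Reduction D hiding (m)

  m = 2 ^ W

  module _ {N : ℕ} {L : Labels W} where

    open Labels L
    open Validity W N L

    -- The left neighbour of a running point is forced to be running, in the successor state. From
    -- the starting point leftwards the labels therefore have no freedom to leave the computation.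
    kind-running : ∀ r {q a x y} → KindHolds (kind r (just (running q a))) x y →
      ∃[ q′ ] ∃[ a′ ] (r ≡ just (running q′ a′) × verdict q ≡ nothing × q′ ≡ proj₁ (δ q a) ×
        KindHolds (moveKind (proj₂ (proj₂ (δ q a)))) x y)
    kind-running (just (running q′ a′)) {q} {a} h with verdict q
    ... | nothing with q′ Fin.≟ proj₁ (δ q a)
    ...   | yes eq = q′ , a′ , refl , refl , eq , h
    kind-running (just (providing nothing))  ()
    kind-running (just (providing (just _))) ()
    kind-running nothing                     ()

    kind-just : ∀ r r′ {x y} → KindHolds (kind r r′) x y → ∃[ r₀ ] r′ ≡ just r₀
    kind-just r (just r₀) h = r₀ , refl
    kind-just (just (running _ _))          nothing ()
    kind-just (just (providing nothing))    nothing ()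
    kind-just (just (providing (just _)))   nothing ()
    kind-just nothing                       nothing ()

    kind-begin : ∀ {q a b x y} → KindHolds (kind (just (running q a)) (just (providing b))) x y →
      q ≡ start × Same m (bits x) (bits y) × Zeros m (bits y)
    kind-begin {q} h with q Fin.≟ start
    ... | yes eq = eq , h

    provides-elim : ∀ {a} r → T (provides a r) → r ≡ just (providing a)
    provides-elim {a} (just (providing a′)) h =
      cong (just ∘ inj₂) (sym (witness (≡-decᵐ Fin._≟_ a a′) h))

    module _ {w : List (Fin s)} (valid : Valid w) (small : length w < 2 ^ m)
             (inSpace : ∀ t → head (work (run w t)) < 2 ^ m) where

      open Valid valid

      heads : ℕ → ℕ
      heads z = number m (bits z)

      writes : ℕ → Maybe Γ
      writes z = Maybe.maybe′ written nothing (moment z)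

      open Memory D heads writes

      moment-just : ∀ {z} → z < N → ∃[ r ] moment (suc z) ≡ just r
      moment-just {z} z<N = kind-just (moment z) (moment (suc z)) (stepping z<N)

      -- The two cases of `Lookup` are exactly the premises of the clauses `blank` and `reading`.
      reads-memory : ∀ {z f q a} → z + f ≡ N → moment z ≡ just (running q a) →
        a ≡ memory f z (heads z)
      reads-memory {z} {f} {q} {a} eq mz with lookup-memory f z (heads z) eq
      ... | untouched none v = trans
        (witness (a ≟ᶜ nothing) (subst (T ∘ readsBlank) mz
          (blank (≤-trans (m≤m+n z f) (≤-reflexive eq)) λ z<y y≤N agree → none z<y y≤N (sym (number-same m agree)))))
        (sym v)
      ... | touched (suc y) z<y y≤N h earlier v with moment-just y≤N
      ...   | r , my = trans
        (witness (a ≟ᶜ written r) (subst T (cong₂ compatible mz my)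
          (reading z<y y≤N (number-injective m (sym h))
            λ z<y′ y′<y agree → earlier z<y′ y′<y (sym (number-same m agree)))))
        (sym (trans v (cong (Maybe.maybe′ written nothing) my)))

      provided-moment : ∀ {z} v → Provided z v → ∃[ a ] moment z ≡ just (providing a)
      provided-moment []      (_ , p) = nothing , provides-elim _ p
      provided-moment (a ∷ v) (p , _) = just a , provides-elim _ p

      -- Only the cells from `i` on are described, since the lower ones are provided by points that
      -- are not beyond `z`. At `x₀` this covers the whole tape.
      filled-memory : ∀ v z i f → Provided (suc z) v → heads (suc z) ≡ i → i + length v ≡ length w →
        z + f ≡ N → ∀ j → memory f z (i + j) ≡ Maybe.map inj₁ (nth v j)
      filled-memory v z i zero p h len eq j =
        contradiction (provided-bound v p) (<⇒≱ (s≤s (≤-reflexive (trans (sym eq) (+-identityʳ z)))))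
      filled-memory [] z i (suc f) (sz≤N , p) h len eq j
        with m≤n⇒m<n∨m≡n sz≤N
      -- `kind` lets nothing follow the blank provision, so the model ends there and no stray point
      -- can fill another cell.
      ... | inj₁ lt = ⊥-elim (subst (λ r → KindHolds (kind r (moment (suc (suc z)))) (suc z) (suc (suc z)))
        (provides-elim (moment (suc z)) p) (stepping lt))
      ... | inj₂ last with i + j ≡ᵇ heads (suc z)
      ...   | true  = cong (Maybe.maybe′ written nothing) (provides-elim (moment (suc z)) p)
      ...   | false with f | +-cancelˡ-≡ (suc z) f 0 (trans (sym (+-suc z f)) (trans eq (trans (sym last) (sym (+-identityʳ (suc z))))))
      ...     | zero | _ = refl
      filled-memory (a ∷ v) z i (suc f) (p , ps) h len eq zero
        rewrite +-identityʳ i | h | ≡ᵇ-refl i = cong (Maybe.maybe′ written nothing) (provides-elim (moment (suc z)) p)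
      filled-memory (a ∷ v) z i (suc f) (p , ps) h len eq (suc j)
        rewrite h | ≢⇒≡ᵇ {i + suc j} {i} (λ e → contradiction (trans (sym (+-suc i j)) e) (>⇒≢ (s≤s (m≤m+n i j)))) =
        trans (cong (memory f (suc z)) (+-suc i j))
          (filled-memory v (suc z) (suc i) f ps next-head len′ (trans (sym (+-suc z f)) eq) j)
        where
        len′ = trans (sym (+-suc i (length v))) len
        sz<N = provided-bound v ps
        down : Succ m (bits (suc z)) (carry′ (suc z)) (bits (suc (suc z)))
        down with moment (suc z) | moment (suc (suc z)) | provides-elim {just a} (moment (suc z)) p
               | proj₂ (provided-moment v ps) | stepping sz<N
        ... | _ | _ | refl | refl | h = h
        next-head : heads (suc (suc z)) ≡ suc i
        next-head = trans (number-succ-below m (carrying (<⇒≤ sz<N)) down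
          (subst (λ k → suc k < 2 ^ m) (sym h)
            (≤-<-trans (≤-trans (m≤m+n (suc i) (length v)) (≤-reflexive len′)) small)))
          (cong suc h)

      x₀ = proj₁ starting

      record Simulates (t z f : ℕ) : Set where
        field
          q         : State
          a         : Maybe Γ
          moment-eq : moment z ≡ just (running q a)
          state-eq  : state (run w t) ≡ q
          head-eq   : head (work (run w t)) ≡ heads z
          cells-eq  : ∀ j → cells (work (run w t)) j ≡ memory f z j

      x₀<N : x₀ < N
      x₀<N = provided-bound w (proj₂ (proj₂ starting))

      simulates-start : ∀ f → x₀ + f ≡ N → Simulates 0 x₀ f
      simulates-start f eq with moment x₀ in mx | proj₁ (proj₂ starting)
      ... | just (running q a) | _ = record
        { q = q ; a = a ; moment-eq = mx ; state-eq = sym (proj₁ begins)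
        ; head-eq = sym (trans (number-same m (proj₁ (proj₂ begins))) zero-head)
        ; cells-eq = λ j → sym (filled-memory w x₀ 0 f (proj₂ (proj₂ starting)) zero-head refl eq j)
        }
        where
        begins : q ≡ start × Same m (bits x₀) (bits (suc x₀)) × Zeros m (bits (suc x₀))
        begins = kind-begin {q} {a} {proj₁ filler} {x₀} {suc x₀}
          (subst₂ (λ r r′ → KindHolds (kind r r′) x₀ (suc x₀)) mx (proj₂ filler) (stepping x₀<N))
          where
          filler = provided-moment w (proj₂ (proj₂ starting))
        zero-head : heads (suc x₀) ≡ 0
        zero-head = number-zeros m (proj₂ (proj₂ begins))

      -- Induction on time is induction leftwards along the model: one further step of the decider
      -- moves `z` down by one and adds one point to those that determine the memory.
      simulates : ∀ t z f → z + t ≡ x₀ → z + f ≡ N → Simulates t z f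
      simulates zero z f zt eq rewrite trans (sym (+-identityʳ z)) zt = simulates-start f eq
      simulates (suc t) z zero zt eq = contradiction x₀<N
        (≤⇒≯ (≤-trans (≤-reflexive (trans (sym eq) (+-identityʳ z))) (≤-trans (m≤m+n z (suc t)) (≤-reflexive zt))))
      simulates (suc t) z (suc f) zt eq = go (simulates t (suc z) f (trans (sym (+-suc z t)) zt) sz+f)
        where
        sz+f = trans (sym (+-suc z f)) eq
        z<N : z < N
        z<N = ≤-trans (m≤m+n (suc z) f) (≤-reflexive sz+f)
        go : Simulates t (suc z) f → Simulates (suc t) z (suc f)
        go sim = record
          { q = proj₁ inv ; a = proj₁ (proj₂ inv) ; moment-eq = proj₁ (proj₂ (proj₂ inv))
          ; state-eq = trans (cong state step-eq) (sym q′-eq)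
          ; head-eq = trans (cong (head ∘ work) step-eq) (trans (cong (moveHead mv) head-eq)
              (moved mv kh (subst (_< 2 ^ m) (trans (cong (head ∘ work) step-eq) (cong (moveHead mv) head-eq)) (inSpace (suc t)))))
          ; cells-eq = λ j → trans (cong (λ c → cells (work c) j) step-eq) (cell j)
          }
          where
          open Simulates sim
          inv = kind-running (moment z) {q} {a}
            (subst (λ r → KindHolds (kind (moment z) r) z (suc z)) moment-eq (stepping z<N))
          not-done = proj₁ (proj₂ (proj₂ (proj₂ inv)))
          q′-eq    = proj₁ (proj₂ (proj₂ (proj₂ (proj₂ inv))))
          kh       = proj₂ (proj₂ (proj₂ (proj₂ (proj₂ inv))))
          b        = proj₁ (proj₂ (δ q a))
          mv       = proj₂ (proj₂ (δ q a))
          c        = run w t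
          read-eq : read (work c) ≡ a
          read-eq = trans (cong (cells (work c)) head-eq)
            (trans (cells-eq (heads (suc z))) (sym (reads-memory sz+f moment-eq)))
          step-eq : run w (suc t) ≡ config (proj₁ (δ q a)) (act (work c) (b , mv))
          step-eq = step-running c (trans (cong verdict state-eq) not-done) (cong₂ δ state-eq read-eq)
          cell : ∀ j → (if j ≡ᵇ head (work c) then b else cells (work c) j) ≡ memory (suc f) z j
          cell j rewrite head-eq | moment-eq | cells-eq j = refl
          -- The space bound at the next time prevents the word from wrapping around on a right
          -- move. On a left move the old position is known to be nonzero, or it is 0 and `pred`
          -- keeps it.
          moved : ∀ mv → KindHolds (moveKind mv) z (suc z) → moveHead mv (heads (suc z)) < 2 ^ m →
            moveHead mv (heads (suc z)) ≡ heads z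
          moved left  (inj₁ (zs , agree)) lt =
            trans (cong pred (number-zeros m zs)) (sym (trans (number-same m agree) (number-zeros m zs)))
          moved left  (inj₂ (¬zs , sc)) lt =
            cong pred (number-succ-nonzero m (carrying (<⇒≤ z<N)) sc (¬zs ∘ zeros-number m))
          moved stay  agree lt = sym (number-same m agree)
          moved right sc   lt = sym (number-succ-below m (carrying z<N) sc lt)

      accepted : ∃[ t ] verdict (state (run w t)) ≡ just true
      accepted = x₀ , trans (cong verdict state-eq) (accepting-verdict (subst (T ∘ accepts) moment-eq accepting))
        where
        open Simulates (simulates x₀ 0 N refl refl)
        accepting-verdict : T (isAccepting (verdict q)) → verdict q ≡ just true
        accepting-verdict h with verdict q
        ... | just true = refl

-- From accepting runs to models

unwitness : ∀ {A : Set} (d : Dec A) → A → T (does d)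
unwitness (yes _) _ = tt
unwitness (no ¬a) a = ¬a a

unletter : Letter → List Bool
unletter zero       = []
unletter 1+[2 b ]  = false ∷ unletter b
unletter 2[1+ b ]  = true ∷ unletter b

unletter-letter : ∀ bs → unletter (letter bs) ≡ bs
unletter-letter []           = refl
unletter-letter (false ∷ bs) = cong (false ∷_) (unletter-letter bs)
unletter-letter (true ∷ bs)  = cong (true ∷_) (unletter-letter bs)

vecOf-cong : ∀ {f g} → (∀ i → f i ≡ g i) → ∀ k → vecOf f k ≡ vecOf g k
vecOf-cong eq zero    = refl
vecOf-cong eq (suc k) = cong₂ _∷_ (eq k) (vecOf-cong eq k)

T-ext : ∀ {a b} → (T a → T b) → (T b → T a) → a ≡ b
T-ext {true}  {true}  f g = refl
T-ext {true}  {false} f g = ⊥-elim (f tt)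
T-ext {false} {true}  f g = ⊥-elim (g tt)
T-ext {false} {false} f g = refl

-- Any valuation of the points extends to a homogeneous one; the quantifier over an interval is
-- bounded, hence decidable.
module HomogeneousModel (N : ℕ) (V : ℕ → Letter → Bool) where

  throughout? : ∀ p x y → Dec (∀ z → x ≤ z → z ≤ y → T (V z p))
  throughout? p x y = map′ (λ h z x≤z z≤y → h (s≤s z≤y) x≤z) (λ h {z} z<y x≤z → h z x≤z (s≤s⁻¹ z<y))
    (allUpTo? (λ z → (x ≤? z) →-dec T? (V z p)) (suc y))

  model : Model
  model = record { N = N ; 𝒱 = λ I p → does (throughout? p (Interval.lo I) (Interval.hi I)) }

  at-point : ∀ p z → T (does (throughout? p z z)) ⇔ T (V z p)
  at-point p z = mk⇔ (λ h → witness (throughout? p z z) h z ≤-refl ≤-refl)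
    (λ v → unwitness (throughout? p z z) λ z′ z≤z′ z′≤z → subst (λ z → T (V z p)) (≤-antisym z≤z′ z′≤z) v)

  homogeneous : Homogeneous model
  homogeneous p x y x≤y y≤N = mk⇔
    (λ h z x≤z z≤y → from (at-point p z) (witness (throughout? p x y) h z x≤z z≤y))
    (λ h → unwitness (throughout? p x y) λ z x≤z z≤y → to (at-point p z) (h z x≤z z≤y))

  open Semantics model

  value-at-model : ∀ {z} → z ≤ N → ∀ p → value-at z p ≡ V z p
  value-at-model {z} z≤N p = trans (value-at-point z≤N p)
    (T-ext (to (at-point p z)) (from (at-point p z)))

module Completeness {s : ℕ} (D : Decider s) (W : ℕ) where

  open Decider D
  open DeciderRun D
  open Runs D
  open Reduction D hiding (m)

  m = 2 ^ W

  module _ (w : List (Fin s)) (small : length w < 2 ^ m)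
           (inSpace : ∀ t → head (work (run w t)) < 2 ^ m)
           (end : ℕ) (going : ∀ {t} → t < end → verdict (state (run w t)) ≡ nothing)
           (done : verdict (state (run w end)) ≡ just true) where

    n = length w
    -- Points `0 , … , end` are the times in reverse, and `n + 1` provisions come after them.
    N = end + suc n

    -- inj₁ t is the time t, and inj₂ i is the provision of cell i.
    place : ℕ → ℕ ⊎ ℕ
    place z = if z ≤ᵇ end then inj₁ (end ∸ z) else inj₂ (z ∸ suc end)

    place-time : ∀ {z t} → z + t ≡ end → place z ≡ inj₁ t
    place-time {z} {t} eq with z ≤ᵇ end in le
    ... | true  = cong inj₁ (trans (cong (_∸ z) (sym eq)) (m+n∸m≡n z t))
    ... | false = ⊥-elim (subst T le (≤⇒≤ᵇ (≤-trans (m≤m+n z t) (≤-reflexive eq))))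

    place-cell : ∀ i → place (suc end + i) ≡ inj₂ i
    place-cell i with suc end + i ≤ᵇ end in le
    ... | true  = contradiction (≤-trans (m≤m+n (suc end) i) (≤ᵇ⇒≤ (suc end + i) end (subst T (sym le) tt))) (<-irrefl refl)
    ... | false = cong inj₂ (m+n∸m≡n (suc end) i)

    momentOf : ℕ ⊎ ℕ → Moment
    momentOf (inj₁ t) = running (state (run w t)) (read (work (run w t)))
    momentOf (inj₂ i) = providing (nth w i)

    headOf : ℕ ⊎ ℕ → ℕ
    headOf (inj₁ t) = head (work (run w t))
    headOf (inj₂ i) = i

    theMoment : ℕ → Moment
    theMoment = momentOf ∘ place

    heads : ℕ → ℕ
    heads = headOf ∘ place

    -- After its tag, a moment letter carries its index in unary, while bits and carries have theirs
    -- in binary; hence `length` here and `value` there.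
    valuation : ℕ → List Bool → Bool
    valuation z (false ∷ bs)        = length bs ≡ᵇ toℕ (Finite.index moments (theMoment z))
    valuation z (true ∷ false ∷ bs) = word (heads z) (value bs)
    valuation z (true ∷ true ∷ bs)  = carry (word (heads z)) (value bs)
    valuation z _                   = false

    open HomogeneousModel N (λ z p → valuation z (unletter p))
    open Semantics model using (value-at)

    L = labels W model
    open Labels L
    open Validity W N L

    data Place (z : ℕ) : Set where
      time : ∀ t → z + t ≡ end → Place z
      cell : ∀ i → i ≤ n → z ≡ suc end + i → Place z

    place? : ∀ {z} → z ≤ N → Place z
    place? {z} z≤N with z ≤? end
    ... | yes z≤end = time (end ∸ z) (m+[n∸m]≡n z≤end)
    ... | no z≰end = cell (z ∸ suc end)
      (≤-trans (∸-monoˡ-≤ (suc end) z≤N) (≤-reflexive (trans (cong (_∸ suc end) (+-suc end n)) (m+n∸m≡n (suc end) n))))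
      (sym (m+[n∸m]≡n (≰⇒> z≰end)))

    heads-bound : ∀ {z} → z ≤ N → heads z < 2 ^ m
    heads-bound {z} z≤N with place? z≤N
    ... | time t eq rewrite place-time {z} eq = inSpace t
    ... | cell i i≤n refl rewrite place-cell i = ≤-<-trans i≤n small

    in-range : ∀ {j} → j ≤ m → j < 2 ^ suc W
    in-range j≤m = ≤-<-trans j≤m (m<m+n m (≤-trans (m^n>0 2 W) (m≤m+n m 0)))

    module _ {z} (z≤N : z ≤ N) where

      moment-model : moment z ≡ just (theMoment z)
      moment-model = trans (cong (decode moments) (vecOf-cong letter-value K)) (decode-code moments (theMoment z))
        where
        letter-value : ∀ i → value-at z (letter (recordLetter i)) ≡ (i ≡ᵇ toℕ (Finite.index moments (theMoment z)))
        letter-value i = trans (value-at-model z≤N (letter (recordLetter i)))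
          (trans (cong (valuation z) (unletter-letter (recordLetter i)))
            (cong (_≡ᵇ toℕ (Finite.index moments (theMoment z))) (length-replicate i)))

      bits-model : ∀ {j} → j ≤ m → bits z j ≡ word (heads z) j
      bits-model {j} j≤m = trans (value-at-model z≤N (letter (bitTag ++ numeral (suc W) j)))
        (trans (cong (valuation z) (unletter-letter (bitTag ++ numeral (suc W) j)))
          (cong (word (heads z)) (value-numeral (suc W) j (in-range j≤m))))

      carry-model : ∀ {j} → j ≤ m → carry′ z j ≡ carry (word (heads z)) j
      carry-model {j} j≤m = trans (value-at-model z≤N (letter (carryTag ++ numeral (suc W) j)))
        (trans (cong (valuation z) (unletter-letter (carryTag ++ numeral (suc W) j)))
          (cong (carry (word (heads z))) (value-numeral (suc W) j (in-range j≤m))))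

      carries-model : Carries m (bits z) (carry′ z)
      carries-model = carries (carry-model z≤n) λ j j<m →
        trans (carry-model j<m) (sym (cong₂ _∧_ (carry-model (<⇒≤ j<m)) (bits-model (<⇒≤ j<m))))

      number-model : number m (bits z) ≡ heads z
      number-model = trans (number-same m λ j j<m → bits-model (<⇒≤ j<m)) (number-word m (heads z) (heads-bound z≤N))

    module _ {x y} (x≤N : x ≤ N) (y≤N : y ≤ N) where

      same-model : heads x ≡ heads y → Same m (bits x) (bits y)
      same-model eq = number-injective m (trans (number-model x≤N) (trans eq (sym (number-model y≤N))))

      model-same : Same m (bits x) (bits y) → heads x ≡ heads y
      model-same sm = trans (sym (number-model x≤N)) (trans (number-same m sm) (number-model y≤N))

      succ-model : heads y ≡ suc (heads x) → Succ m (bits x) (carry′ x) (bits y)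
      succ-model eq j j<m = trans (bits-model y≤N (<⇒≤ j<m)) (trans (cong (λ h → word h j) eq)
        (sym (cong₂ _xor_ (bits-model x≤N (<⇒≤ j<m)) (carry-model x≤N (<⇒≤ j<m)))))

    writes : ℕ → Maybe Γ
    writes = written ∘ theMoment

    open Memory D heads writes

    provided-memory : ∀ f i j → i + f ≡ suc n →
      memory f (end + i) (i + j) ≡ Maybe.map inj₁ (nth w (i + j))
    provided-memory zero i j eq = cong (Maybe.map inj₁) (sym (nth-beyond w (i + j)
      (≤-trans (n≤1+n n) (≤-trans (≤-reflexive (trans (sym eq) (+-identityʳ i))) (m≤m+n i j)))))
    provided-memory (suc f) i zero eq
      rewrite place-cell i | +-identityʳ i | ≡ᵇ-refl i = refl
    provided-memory (suc f) i (suc j) eq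
      rewrite place-cell i
            | ≢⇒≡ᵇ {i + suc j} {i} (λ e → contradiction (trans (sym (+-suc i j)) e) (>⇒≢ (s≤s (m≤m+n i j))))
            | sym (+-suc end i) | +-suc i j =
      provided-memory f (suc i) j (trans (sym (+-suc i f)) eq)

    beyond : ∀ {x t f} → x + t ≡ end → x + f ≡ N → ∃[ f′ ] (f ≡ suc f′ × suc x + f′ ≡ N)
    beyond {x} {t} {zero} xt eq = contradiction
      (≤-trans (≤-reflexive (trans (sym eq) (+-identityʳ x))) (≤-trans (m≤m+n x t) (≤-reflexive xt)))
      (<⇒≱ (m<m+n end (s≤s z≤n)))
    beyond {x} {f = suc f} xt eq = f , refl , trans (sym (+-suc x f)) eq

    step-at : ∀ {t} → t < end → let c = run w t ; q , b , mv = δ (state c) (read (work c)) in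
      run w (suc t) ≡ config q (act (work c) (b , mv))
    step-at {t} t< = step-running (run w t) (going t<) refl

    earlier : ∀ {x t} → x + suc t ≡ end → t < end
    earlier {x} {t} eq = ≤-trans (m≤n+m (suc t) x) (≤-reflexive eq)

    -- Each step of the run writes one cell, and its point is the next one that `memory` consults.
    -- The provisions account for the initial tape.
    cells-memory : ∀ t x f → x + t ≡ end → x + f ≡ N → ∀ j → cells (work (run w t)) j ≡ memory f x j
    cells-memory zero x f xt eq j = sym (trans
      (cong (λ x → memory f x j) (trans (trans (sym (+-identityʳ x)) xt) (sym (+-identityʳ end))))
      (provided-memory f 0 j (+-cancelˡ-≡ end f (suc n)
        (trans (cong (_+ f) (sym (trans (sym (+-identityʳ x)) xt))) eq))))
    cells-memory (suc t) x f xt eq j with beyond {x} {suc t} {f} xt eq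
    ... | f′ , refl , eq′
      rewrite step-at (earlier {x} xt) | place-time {suc x} (trans (sym (+-suc x t)) xt)
            | cells-memory t (suc x) f′ (trans (sym (+-suc x t)) xt) eq′ j = refl

    -- It identifies the point found by `Lookup` with the one singled out by the clause `reading`.
    first-unique : ∀ {x y y′} → x < y → x < y′ → heads y ≡ heads x → heads y′ ≡ heads x →
      (∀ {z} → x < z → z < y → heads z ≢ heads x) → (∀ {z} → x < z → z < y′ → heads z ≢ heads x) → y ≡ y′
    first-unique {y = y} {y′} lt lt′ h h′ e e′ with <-cmp y y′
    ... | tri< a _ _ = contradiction h (e′ lt a)
    ... | tri≈ _ a _ = a
    ... | tri> _ _ a = contradiction h′ (e lt′ a)

    read-memory : ∀ {x t} → x + t ≡ end → read (work (run w t)) ≡ memory (N ∸ x) x (heads x)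
    read-memory {x} {t} eq = trans (cells-memory t x (N ∸ x) eq (m+[n∸m]≡n x≤N) _)
      (cong (memory (N ∸ x) x) (cong headOf (sym (place-time {x} eq))))
      where
      x≤N = ≤-trans (≤-trans (m≤m+n x t) (≤-reflexive eq)) (m≤m+n end (suc n))

    stepKind-moves : ∀ {q′ v} {d : State × Maybe Γ × Move} → v ≡ nothing → q′ ≡ proj₁ d →
      stepKind q′ v d ≡ moveKind (proj₂ (proj₂ d))
    stepKind-moves {q′} refl refl with q′ Fin.≟ q′
    ... | yes _ = refl
    ... | no ¬p = contradiction refl ¬p

    kind-start : ∀ {a b} → kind (just (running start a)) (just (providing b)) ≡ begin
    kind-start with start Fin.≟ start
    ... | yes _ = refl
    ... | no ¬p = contradiction refl ¬p

    steps : ∀ {x} → x < N → KindHolds (kind (just (theMoment x)) (just (theMoment (suc x)))) x (suc x)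
    steps {x} x<N with place? (<⇒≤ x<N)
    ... | time (suc t) eq = subst (λ k → KindHolds k x (suc x)) (sym kind-eq) (moves (proj₂ (proj₂ (δ (state c) (read (work c))))) head-eq)
      where
      c = run w t
      next-place = place-time {suc x} (trans (sym (+-suc x t)) eq)
      kind-eq : kind (just (theMoment x)) (just (theMoment (suc x))) ≡ moveKind (proj₂ (proj₂ (δ (state c) (read (work c)))))
      kind-eq = trans (cong₂ (λ p p′ → kind (just (momentOf p)) (just (momentOf p′))) (place-time {x} eq) next-place)
        (stepKind-moves {d = δ (state c) (read (work c))} (going (earlier {x} eq)) (cong state (step-at (earlier {x} eq))))
      head-eq : heads x ≡ moveHead (proj₂ (proj₂ (δ (state c) (read (work c))))) (heads (suc x))
      head-eq = trans (cong headOf (place-time {x} eq)) (trans (cong (head ∘ work) (step-at (earlier {x} eq)))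
        (cong (moveHead (proj₂ (proj₂ (δ (state c) (read (work c)))))) (cong headOf (sym next-place))))
      moves : ∀ mv → heads x ≡ moveHead mv (heads (suc x)) → KindHolds (moveKind mv) x (suc x)
      -- The two cases of `pred` are the two alternatives of `back`.
      moves left eq with heads (suc x) in hs
      ... | zero  = inj₁ (zeros-number m (trans (number-model x<N) hs) , same-model (<⇒≤ x<N) x<N (trans eq (sym hs)))
      ... | suc k = inj₂ ((λ zs → contradiction (trans (sym hs) (trans (sym (number-model x<N)) (number-zeros m zs))) λ ()) ,
                          succ-model (<⇒≤ x<N) x<N (trans hs (cong suc (sym eq))))
      moves stay  eq = same-model (<⇒≤ x<N) x<N eq
      moves right eq = succ-model x<N (<⇒≤ x<N) eq
    -- At the boundary both points have head position 0: the initial head, and the first cell to be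
    -- provided.
    ... | time zero eq = subst (λ k → KindHolds k x (suc x)) (sym kind-eq)
      (same-model (<⇒≤ x<N) x<N (trans (cong headOf (place-time {x} eq)) (sym head-next)) ,
       zeros-number m (trans (number-model x<N) head-next))
      where
      next-place : place (suc x) ≡ inj₂ 0
      next-place = trans (cong (place ∘ suc) (trans (trans (sym (+-identityʳ x)) eq) (sym (+-identityʳ end)))) (place-cell 0)
      head-next : heads (suc x) ≡ 0
      head-next = cong headOf next-place
      kind-eq : kind (just (theMoment x)) (just (theMoment (suc x))) ≡ begin
      kind-eq = trans (cong₂ (λ p p′ → kind (just (momentOf p)) (just (momentOf p′))) (place-time {x} eq) next-place) (kind-start {read (work (run w 0))} {nth w 0})
    ... | cell i i≤n refl = subst (λ k → KindHolds k x (suc x)) (sym kind-eq)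
      (succ-model (<⇒≤ x<N) x<N (trans (cong headOf next-place) (cong suc (sym (cong headOf (place-cell i))))))
      where
      next-place : place (suc x) ≡ inj₂ (suc i)
      next-place = trans (cong place (sym (+-suc (suc end) i))) (place-cell (suc i))
      i<n : i < n
      i<n = +-cancelˡ-≤ (suc end) (suc i) n (≤-trans (≤-reflexive (+-suc (suc end) i)) (≤-trans x<N (≤-reflexive (+-suc end n))))
      kind-eq : kind (just (theMoment x)) (just (theMoment (suc x))) ≡ filled
      kind-eq = trans (cong₂ (λ p p′ → kind (just (momentOf p)) (just (momentOf p′))) (place-cell i) next-place)
        (cong (λ a → kind (just (providing a)) (just (providing (nth w (suc i))))) (proj₂ (nth-inside w i i<n)))

    provided : ∀ v i → i + length v ≡ n → (∀ j → nth w (i + j) ≡ nth v j) → Provided (suc end + i) v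
    provided v i len suffix = go v len (trans (cong (nth w) (sym (+-identityʳ i))) (suffix 0)) suffix
      where
      i≤n = ≤-trans (m≤m+n i (length v)) (≤-reflexive len)
      z≤N : suc end + i ≤ N
      z≤N = ≤-trans (+-monoʳ-≤ (suc end) i≤n) (≤-reflexive (sym (+-suc end n)))
      provides-it : ∀ {a} → nth w i ≡ a → T (provides a (moment (suc end + i)))
      provides-it {a} eq rewrite moment-model z≤N | place-cell i | eq = unwitness (≡-decᵐ Fin._≟_ a a) refl
      go : ∀ v → i + length v ≡ n → nth w i ≡ nth v 0 → (∀ j → nth w (i + j) ≡ nth v j) → Provided (suc end + i) v
      go []      len eq suffix = z≤N , provides-it eq
      go (a ∷ v) len eq suffix = provides-it eq ,
        subst (λ z → Provided z v) (+-suc (suc end) i) (provided v (suc i) (trans (sym (+-suc i (length v))) len)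
          λ j → trans (cong (nth w) (sym (+-suc i j))) (suffix (suc j)))

    valid : Valid w
    valid = record
      { accepting = accepting′
      ; carrying  = carries-model
      ; stepping  = λ {x} x<N → subst₂ (λ r r′ → KindHolds (kind r r′) x (suc x))
          (sym (moment-model (<⇒≤ x<N))) (sym (moment-model x<N)) (steps x<N)
      ; reading   = reading′
      ; blank     = blank′
      ; starting  = end , starts , subst (λ z → Provided z w) (+-identityʳ (suc end)) (provided w 0 refl λ _ → refl)
      }
      where
      end≤N = m≤m+n end (suc n)
      accepting′ : T (accepts (moment 0))
      accepting′ rewrite moment-model z≤n | place-time {0} {end} refl | done = tt
      starts : T (isRunning (moment end))
      starts rewrite moment-model end≤N | place-time {end} {0} (+-identityʳ end) = tt
      reading′ : ∀ {x y} → x < y → y ≤ N → Same m (bits x) (bits y) →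
        (∀ {y′} → x < y′ → y′ < y → ¬ Same m (bits x) (bits y′)) → T (compatible (moment x) (moment y))
      reading′ {x} {y} x<y y≤N sm fresh
        rewrite moment-model (≤-trans (<⇒≤ x<y) y≤N) | moment-model y≤N
        with place? (≤-trans (<⇒≤ x<y) y≤N)
      ... | cell i _ refl rewrite place-cell i = tt
      ... | time t eq rewrite place-time {x} eq = unwitness (_ ≟ᶜ _) (trans (read-memory {x} eq) (found (lookup-memory (N ∸ x) x (heads x) (m+[n∸m]≡n x≤N))))
        where
        x≤N = ≤-trans (<⇒≤ x<y) y≤N
        hxy = sym (model-same x≤N y≤N sm)
        fresh′ : ∀ {z} → x < z → z < y → heads z ≢ heads x
        fresh′ x<z z<y h = fresh x<z z<y (same-model x≤N (≤-trans (<⇒≤ z<y) y≤N) (sym h))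
        found : ∀ {v} → Lookup N x (heads x) v → v ≡ writes y
        found (untouched none _) = contradiction hxy (none x<y y≤N)
        found (touched y′ x<y′ _ h fr v) = trans v (cong writes (first-unique x<y′ x<y h hxy fr fresh′))
      blank′ : ∀ {y} → y ≤ N → (∀ {y′} → y < y′ → y′ ≤ N → ¬ Same m (bits y) (bits y′)) → T (readsBlank (moment y))
      blank′ {y} y≤N fresh rewrite moment-model y≤N with place? y≤N
      ... | cell i _ refl rewrite place-cell i = tt
      ... | time t eq rewrite place-time {y} eq = unwitness (_ ≟ᶜ _) (trans (read-memory {y} eq) (found (lookup-memory (N ∸ y) y (heads y) (m+[n∸m]≡n y≤N))))
        where
        found : ∀ {v} → Lookup N y (heads y) v → v ≡ nothing
        found (untouched _ v) = v
        found (touched y′ y<y′ y′≤N h _ _) = contradiction (same-model y≤N y′≤N (sym h)) (fresh y<y′ y′≤N)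

    satisfiable : Satisfiable (formula W w)
    satisfiable = model , homogeneous , from (satisfied⇔valid W model w) valid

-- The first verdict of a run, and the reduction assembled

module _ {s : ℕ} (D : Decider s) where

  open Decider D
  open DeciderRun D
  open Runs D

  GoingUntil : List (Fin s) → ℕ → Set
  GoingUntil w t = ∀ {u} → u < t → verdict (state (run w u)) ≡ nothing

  first-verdict : ∀ w t → GoingUntil w t ⊎
    (∃[ end ] ∃[ b ] (GoingUntil w end × verdict (state (run w end)) ≡ just b))
  first-verdict w zero    = inj₁ λ ()
  first-verdict w (suc t) with first-verdict w t
  ... | inj₂ found = inj₂ found
  ... | inj₁ going with verdict (state (run w t)) in eq
  ...   | just b  = inj₂ (t , b , going , eq)
  ...   | nothing = inj₁ λ {u} u<st → going′ (m≤n⇒m<n∨m≡n (s≤s⁻¹ u<st))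
    where
    going′ : ∀ {u} → u < t ⊎ u ≡ t → verdict (state (run w u)) ≡ nothing
    going′ (inj₁ lt)   = going lt
    going′ (inj₂ refl) = eq

  -- The model has to stop at the first verdict, since `stepKind` forbids a step from a state that
  -- has one.
  first-acceptance : ∀ w t → verdict (state (run w t)) ≡ just true →
    ∃[ end ] (GoingUntil w end × verdict (state (run w end)) ≡ just true)
  first-acceptance w t eq with first-verdict w (suc t)
  ... | inj₁ going = contradict (trans (sym (going ≤-refl)) eq)
    where
    contradict : ∀ {A : Set} → nothing ≡ just true → A
    contradict ()
  ... | inj₂ (end , b , going , done) =
    end , going , trans done (cong just (verdict-unique w end t done eq))

theorem4 : EXPSPACE-Hard AB-SAT
theorem4 {s} L (D , p , decides , inSpace) = reduce ,
  printed-logSpace link linkPrefix (provision nothing) encode-link d scheme ,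
  λ w → mk⇔ (complete w) (sound w)
  where
  open Decider D
  open DeciderRun D
  open Runs D
  open Reduction D
  d = proj₁ (headBits-dominate p)
  width : List (Fin s) → ℕ
  width w = indexWidth d (length w)
  reduce : List (Fin s) → List Symbol
  reduce w = encode (formula (width w) w)
  small : ∀ w → length w < 2 ^ 2 ^ width w
  small w = ≤-<-trans (proj₁ (proj₂ (headBits-dominate p) (length w))) (n<2^n (2 ^ width w))
  inSpace′ : ∀ w t → head (work (run w t)) < 2 ^ 2 ^ width w
  inSpace′ w t = ≤-trans (inSpace w t) (^-monoʳ-≤ 2 (proj₂ (proj₂ (headBits-dominate p) (length w))))
  complete : ∀ w → L w → AB-SAT (reduce w)
  complete w l with decides w
  ... | t , true , eq , _ with first-acceptance D w t eq
  ...   | end , going , done = formula (width w) w , refl ,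
    Completeness.satisfiable D (width w) w (small w) (inSpace′ w) end going done
  complete w l | t , false , eq , b⇔l with from b⇔l l
  ... | ()
  sound : ∀ w → AB-SAT (reduce w) → L w
  -- Appending the empty list turns unique decoding of prefixes into injectivity of `encode`, so `φ`
  -- is the formula of the reduction.
  sound w (φ , eq , M , _ , sat) with encode-prefixFree φ (formula (width w) w) (cong (_++ []) eq)
  ... | refl , _ with decides w
  -- The acceptance extracted from the model and the verdict `b` may occur at different times, but
  -- verdicts are final and hence agree.
  ... | t , b , eq′ , b⇔l = to b⇔l (subst T (verdict-unique w (proj₁ accepted) t (proj₂ accepted) eq′) tt)
    where
    accepted = Soundness.accepted D (width w) {L = labels (width w) M} (to (satisfied⇔valid (width w) M w) sat)
      (small w) (inSpace′ w)
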